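{- Let $w$ be a biword in lexicographic order on $[n]$ with key-pair $(\nu,\beta)$. Let $0\le p\le k<n$ and $1\le r_k<\cdots<r_{p+1}<r_1<\cdots<r_p<n$, with $r_1-r_{p+1}>1$ if $p>0$, and put $e_j:=n-r_j$ for $p+1\le j\le k$. The following are equivalent: (a) $w$ consists of a multiset of cells of the staircase $\rho=\{(i,j):i+j\le n+1\}$ together with the $k$ cells $(r_k+1,e_k+1),\dots,(r_{p+1}+1,e_{p+1}+1)$, $(r_1+1,n-r_1+1),\dots,(r_p+1,n-r_p+1)$ above it, each of these $k$ cells occurring in $w$ with multiplicity at least one. (b) $s_{e_k}\cdots s_{e_{p+1}}\beta\not\le\omega s_{r_p}\cdots\widehat{s_{r_i}}\cdots s_{r_1}\nu$ for $i=1,\dots,p$; $s_{e_k}\cdots\widehat{s_{e_i}}\cdots s_{e_{p+1}}\beta\not\le\omega s_{r_p}\cdots s_{r_1}\nu$ for $i=p+1,\dots,k$; and $s_{e_k}\cdots s_{e_{p+1}}\beta\le\omega s_{r_p}\cdots s_{r_1}\nu$.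
   Context: Cells $(i,j)$ are in French convention (row $i$ from the bottom, column $j$ from the left). A biword on $[n]$ is a two-row array $\binom{j_1\cdots j_l}{i_1\cdots i_l}$ with entries in $[n]$, lexicographically ordered with respect to the first row; the biletter $\binom{j}{i}$ is identified with the cell $(i,j)$, and "$w$ consists of a multiset of cells of $D$" means every biletter's cell lies in $D$. SSAFs: for a reverse SSYT $\widetilde P$ (French; rows weakly decreasing left to right, columns strictly decreasing upward) with entries in $[n]$, $\varrho(\widetilde P)$ is obtained by starting from a basement row $0$ containing $1,\dots,n$ in columns $1,\dots,n$, placing each entry of the first column of $\widetilde P$ above the equal basement entry, and then, for $i\ge1$, inserting the entries of column $i+1$ of $\widetilde P$ in decreasing order, each entry $a$ placed in row $i+1$ on top of the leftmost entry $b$ of row $i$ with $b\ge a$ and empty cell above $b$. Its shape $sh\in\mathbb N^n$ is the vector of column heights (basement excluded). $\Phi(w)=(\varrho(\widetilde P),\varrho(\widetilde Q))$, where $(\widetilde P,\widetilde Q)$ is obtained by applying RSK to $\binom{n-j_l+1\cdots n-j_1+1}{n-i_l+1\cdots n-i_1+1}$ and replacing each entry $a$ by $n-a+1$. The key-pair of $w$ is $(sh(F),sh(G))$ where $(F,G)=\Phi(w)$. $\mathfrak S_n$ acts on $\mathbb N^n$ by permuting positions; $s_i$ swaps entries $i,i+1$; $s_as_b\alpha=s_a(s_b\alpha)$; $\omega(\alpha_1,\dots,\alpha_n)=(\alpha_n,\dots,\alpha_1)$. Bruhat order on $\mathbb N^n$: $\alpha\le\gamma$ iff $\gamma$ is obtained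 from $\alpha$ by a finite (possibly empty) sequence of steps $\delta\mapsto t\delta$ with $t=(i\,j)$, $i<j$, $\delta_i>\delta_j$ (so $\alpha,\gamma$ are rearrangements of each other). $\not\le$ means the relation fails; $\widehat{\ }$ denotes omission. -}

module Defs where

open import Data.Nat using (ℕ; zero; suc; _+_; _∸_; _≤_; _<_; _≤ᵇ_; _<ᵇ_; _≡ᵇ_)
open import Data.Bool using (Bool; true; false; if_then_else_)
open import Data.Maybe using (Maybe; just; nothing; is-just)
open import Data.List using (List; []; _∷_; _++_; map; foldl; reverse; length; filter; upTo; replicate; mapMaybe)
open import Data.List.Relation.Unary.All using (All)
open import Data.List.Relation.Unary.Linked using (Linked)
open import Data.List.Membership.Propositional using (_∈_)
open import Data.Product using (_×_; _,_; proj₁; proj₂)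
open import Data.Sum using (_⊎_)
open import Relation.Binary.PropositionalEquality using (_≡_)
open import Relation.Nullary using (¬_)
open import Function.Bundles using (_⇔_)

range : ℕ → ℕ → List ℕ
range a b = map (a +_) (upTo (suc b ∸ a))

omit : ℕ → List ℕ → List ℕ
omit i [] = []
omit i (x ∷ xs) = if x ≡ᵇ i then omit i xs else x ∷ omit i xs

lookupM : {A : Set} → List A → ℕ → Maybe A
lookupM [] _ = nothing
lookupM (x ∷ xs) zero = just x
lookupM (x ∷ xs) (suc k) = lookupM xs k

at : List ℕ → ℕ → ℕ
at [] _ = 0
at (x ∷ xs) zero = x
at (x ∷ xs) (suc k) = at xs k

setAt : {A : Set} → ℕ → A → List A → List A
setAt _ a [] = []
setAt zero a (x ∷ xs) = a ∷ xs
setAt (suc k) a (x ∷ xs) = x ∷ setAt k a xs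

-- Compositions in ℕ^n (as lists of length n), the S_n action, ω, Bruhat

imapFrom : ℕ → (ℕ → ℕ → ℕ) → List ℕ → List ℕ
imapFrom k f [] = []
imapFrom k f (x ∷ xs) = f k x ∷ imapFrom (suc k) f xs

swapPos : ℕ → ℕ → List ℕ → List ℕ
swapPos i j δ = imapFrom 0 (λ m x → if m ≡ᵇ i then at δ j else (if m ≡ᵇ j then at δ i else x)) δ

-- s_r (1 ≤ r < n) swaps entries r and r+1 (1-indexed)
s : ℕ → List ℕ → List ℕ
s r = swapPos (r ∸ 1) r

-- applyS [a₁, …, a_m] α = s_{a_m} ⋯ s_{a₁} α  (a₁ acts first)
applyS : List ℕ → List ℕ → List ℕ
applyS [] α = α
applyS (a ∷ as) α = applyS as (s a α)

ω : List ℕ → List ℕ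
ω = reverse

-- Bruhat order: γ obtained from α by steps δ ↦ (i j)δ, i<j, δ_i > δ_j
-- (positions 0-indexed here)
data _≤B_ (α : List ℕ) : List ℕ → Set where
  bruhat-refl : α ≤B α
  bruhat-step : ∀ {δ} (i j : ℕ) → i < j → j < length δ → at δ j < at δ i →
                α ≤B δ → α ≤B swapPos i j δ

-- Biwords: a biletter is (top , bottom) = (j , i), identified with cell (i , j)

Biletter : Set
Biletter = ℕ × ℕ

cell : Biletter → ℕ × ℕ
cell (j , i) = (i , j)

LexLeq : Biletter → Biletter → Set
LexLeq (j , i) (j' , i') = j < j' ⊎ (j ≡ j' × i ≤ i')

InRange : ℕ → ℕ → Set
InRange n x = 1 ≤ x × x ≤ n

Biword : ℕ → List Biletter → Set
Biword n w = All (λ b → InRange n (proj₁ b) × InRange n (proj₂ b)) w × Linked LexLeq w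

-- RSK (row insertion, French convention: rows listed from the bottom)

Tableau : Set
Tableau = List (List ℕ)

rowIns : ℕ → List ℕ → Maybe ℕ × List ℕ
rowIns x [] = nothing , x ∷ []
rowIns x (y ∷ ys) = if x <ᵇ y then (just y , x ∷ ys)
                    else (let r = rowIns x ys in proj₁ r , y ∷ proj₂ r)

insertP : ℕ → Tableau → Tableau × ℕ
insertP x [] = (x ∷ []) ∷ [] , 0
insertP x (row ∷ rows) with rowIns x row
... | nothing , row' = row' ∷ rows , 0
... | just y , row' = let r = insertP y rows in row' ∷ proj₁ r , suc (proj₂ r)

addAt : ℕ → ℕ → Tableau → Tableau
addAt zero t [] = (t ∷ []) ∷ []
addAt (suc k) t [] = (t ∷ []) ∷ []
addAt zero t (row ∷ rows) = (row ++ t ∷ []) ∷ rows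
addAt (suc k) t (row ∷ rows) = row ∷ addAt k t rows

rskStep : Tableau × Tableau → Biletter → Tableau × Tableau
rskStep (P , Q) (t , x) = let r = insertP x P in proj₁ r , addAt (proj₂ r) t Q

RSK : List Biletter → Tableau × Tableau
RSK = foldl rskStep ([] , [])

-- The map ρ (SSAF from a reverse SSYT) and shapes

columnOf : Tableau → ℕ → List ℕ
columnOf T c = mapMaybe (λ row → lookupM row c) T

columns : Tableau → List (List ℕ)
columns [] = []
columns (row ∷ rows) = map (columnOf (row ∷ rows)) (upTo (length row))

Row : Set
Row = List (Maybe ℕ)

placeLeft : ℕ → Row → Row → Row
placeLeft a (just b ∷ ps) (nothing ∷ ns) =
  if a ≤ᵇ b then just a ∷ ns else nothing ∷ placeLeft a ps ns
placeLeft a (_ ∷ ps) (m ∷ ns) = m ∷ placeLeft a ps ns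
placeLeft a _ ns = ns

-- first column: each entry a placed above the basement entry a (column a)
firstRow : ℕ → List ℕ → Row
firstRow n col = foldl (λ acc a → setAt (a ∸ 1) (just a) acc) (replicate n nothing) col

-- next row: entries (in decreasing order, i.e. bottom-to-top of the column)
nextRow : ℕ → Row → List ℕ → Row
nextRow n prev col = foldl (λ acc a → placeLeft a prev acc) (replicate n nothing) col

buildRows : ℕ → Row → List (List ℕ) → List Row
buildRows n prev [] = []
buildRows n prev (c ∷ cs) = nextRow n prev c ∷ buildRows n (nextRow n prev c) cs

-- ρ(P̃): rows 1, 2, … of the SSAF (basement row 0 = 1 … n omitted)
ρ : ℕ → Tableau → List Row
ρ n T with columns T
... | [] = []
... | c ∷ cs = firstRow n c ∷ buildRows n (firstRow n c) cs

-- shape: column heights (basement excluded)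
occupied : Row → ℕ → Bool
occupied [] _ = false
occupied (x ∷ xs) zero = is-just x
occupied (x ∷ xs) (suc k) = occupied xs k

sh : ℕ → List Row → List ℕ
sh n F = map (λ c → length (filter (λ row → occupied row c Data.Bool.≟ true) F)) (upTo n)

cmpl : ℕ → ℕ → ℕ
cmpl n a = suc n ∸ a

flipBiword : ℕ → List Biletter → List Biletter
flipBiword n w = reverse (map (λ b → cmpl n (proj₁ b) , cmpl n (proj₂ b)) w)

Φ : ℕ → List Biletter → List Row × List Row
Φ n w = let PQ = RSK (flipBiword n w)
            P~ = map (map (cmpl n)) (proj₁ PQ)
            Q~ = map (map (cmpl n)) (proj₂ PQ)
        in ρ n P~ , ρ n Q~

keyPair : ℕ → List Biletter → List ℕ × List ℕ
keyPair n w = sh n (proj₁ (Φ n w)) , sh n (proj₂ (Φ n w))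

-- Data of Theorem 5 (r is indexed by 1 … k; other values are irrelevant)

e : ℕ → (ℕ → ℕ) → ℕ → ℕ
e n r j = n ∸ r j

rSeq : ℕ → ℕ → (ℕ → ℕ) → List ℕ
rSeq p k r = map r (reverse (range (suc p) k)) ++ map r (range 1 p)

RHyp : ℕ → ℕ → ℕ → (ℕ → ℕ) → Set
RHyp n p k r = Linked _<_ (rSeq p k r) × All (λ x → 1 ≤ x × x < n) (rSeq p k r)

InStaircase : ℕ → ℕ × ℕ → Set
InStaircase n (i , j) = i + j ≤ suc n

extraCells : ℕ → ℕ → ℕ → (ℕ → ℕ) → List (ℕ × ℕ)
extraCells n p k r =
  map (λ j → suc (r j) , suc (e n r j)) (reverse (range (suc p) k))
  ++ map (λ i → suc (r i) , suc (n ∸ r i)) (range 1 p)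

CondA : ℕ → List Biletter → ℕ → ℕ → (ℕ → ℕ) → Set
CondA n w p k r =
  All (λ b → InStaircase n (cell b) ⊎ cell b ∈ extraCells n p k r) w
  × All (λ c → Data.List.Relation.Unary.Any.Any (λ b → cell b ≡ c) w) (extraCells n p k r)
  where import Data.List.Relation.Unary.Any

CondB : ℕ → List Biletter → ℕ → ℕ → (ℕ → ℕ) → Set
CondB n w p k r =
  (∀ i → 1 ≤ i → i ≤ p →
     ¬ (applyS es β ≤B ω (applyS (map r (omit i (range 1 p))) ν)))
  × (∀ i → suc p ≤ i → i ≤ k →
     ¬ (applyS (map (e n r) (omit i (range (suc p) k))) β ≤B ω (applyS rs ν)))
  × (applyS es β ≤B ω (applyS rs ν))
  where
    ν = proj₁ (keyPair n w)
    β = proj₂ (keyPair n w)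
    es = map (e n r) (range (suc p) k)   -- s_{e_{p+1}} acts first
    rs = map r (range 1 p)               -- s_{r_1} acts first

{-# OPTIONS --safe #-}
module Submission where

-- Let (P , Q) be the pair of tableaux of w.  The parts of ν in positions ≤ u,
-- sorted, form a partition; its m-th column is denoted A (n - u) P m, and C is
-- the complementary column count, from the parts in positions > u.  Both are
-- computed greedily from the boxes of P in the order of their entries, and
-- likewise for β and Q.  Following A and C through one RSK insertion by means
-- of Fomin's local rules gives the central fact: w has no letter in the block
-- { i > u , j > t } iff C (n - u) P ≤ A (n - t) Q columnwise, i.e. iff
--   tot m ≤ #{ c ≤ t : β c > m } + #{ c ≤ u : ν c > m }   for all m,
-- where tot m is the total number of parts > m.
--
-- The tableau criterion turns the Bruhat comparisons of (b) into the same kind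
-- of inequality with t + u = n, for prefix counts of the permuted vectors.
-- A product of simple transpositions with increasing indices carries one entry
-- to the right along each run of consecutive indices, and comparing these
-- counts with those of β and ν translates (b) into the emptiness, resp.
-- non-emptiness, of blocks that describes (a).

open import Defs
open import Data.Bool using (Bool; true; false; if_then_else_; T)
import Data.Bool as Bool
open import Data.Maybe using (Maybe; just; nothing)
open import Data.Nat using (ℕ; zero; suc; _+_; _∸_; _≤_; _<_; z≤n; s≤s; _≤?_; _<?_; _≟_; _<ᵇ_; _≤ᵇ_; _≡ᵇ_)
open import Data.Nat.Properties
open import Data.Nat.Solver using (module +-*-Solver)
open import Data.List using (List; []; _∷_; _++_; map; foldl; foldr; length; replicate; applyUpTo; upTo; filter; reverse)
open import Data.List.Properties
open import Data.List.Membership.Propositional using (_∈_; lose)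
open import Data.List.Membership.Propositional.Properties using (∈-map⁺; ∈-map⁻; ∈-++⁺ˡ; ∈-++⁺ʳ; ∈-++⁻; ∈-applyUpTo⁺; ∈-applyUpTo⁻)
open import Data.List.Membership.DecPropositional _≟_ using (_∈?_)
open import Data.List.Relation.Unary.All using (All; []; _∷_)
import Data.List.Relation.Unary.All as All
import Data.List.Relation.Unary.All.Properties as All
open import Data.List.Relation.Unary.AllPairs using (AllPairs; []; _∷_)
import Data.List.Relation.Unary.AllPairs.Properties as AllPairs
open import Data.List.Relation.Unary.Any using (Any; here; there; any?)
open import Data.List.Relation.Unary.Any.Properties using (reverse⁺; reverse⁻)
open import Data.List.Relation.Unary.Linked using (Linked; []; [-]; _∷_)
import Data.List.Relation.Unary.Linked as Linked
open import Data.List.Relation.Unary.Linked.Properties using (Linked⇒AllPairs)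
open import Data.Product using (_×_; _,_; proj₁; proj₂; ∃-syntax)
import Data.Product.Properties as Product
open import Data.Sum using (_⊎_; inj₁; inj₂)
open import Data.Unit using (⊤; tt)
open import Function.Bundles using (_⇔_; mk⇔)
open import Relation.Binary.Definitions using (tri<; tri≈; tri>)
open import Relation.Binary.PropositionalEquality
open import Relation.Nullary using (¬_; Dec; yes; no; contradiction)

-- The central fact is proved by induction on `w` from its last letter, the one inserted first.
-- While j > t, all entries of Q stay at or below the threshold, so A (n - t) Q is zero, whereas C
-- (n - u) P is nonzero exactly when some letter has i > u. From then on j ≤ t, no letter lies in
-- the block, and each insertion enlarges both tableaux in one common column; it remains to see that
-- neither C ≤ A nor its failure is ever undone. C ≤ A survives because A of Q takes a box whenever
-- it can. Its failure survives by an extra invariant: an insertion enlarging A of P in column h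
-- finds no part of size h + 1 in C. In (b) a negated comparison says only that some inequality
-- fails somewhere. To locate it at the omitted index, indices are treated from the largest down: if
-- the block there were empty and no later one were, the shortened comparison would hold throughout.
-- The condition r_1 - r_{p+1} > 1 keeps the two products from acting at equal or adjacent places of
-- the antidiagonal t + u = n, so each side is handled with the other one unchanged.

-- Sequences with one value incremented, and addable corners.

sucIf : {P : Set} → Dec P → ℕ → ℕ
sucIf (yes _) m = suc m
sucIf (no _)  m = m

infixl 6 _⊕_

_⊕_ : (ℕ → ℕ) → ℕ → ℕ → ℕ
(f ⊕ j) k = sucIf (k ≟ j) (f k)

⊕-at : ∀ f j → (f ⊕ j) j ≡ suc (f j)
⊕-at f j with j ≟ j
... | yes _  = refl
... | no j≢j = contradiction refl j≢j

⊕-off : ∀ f {j k} → k ≢ j → (f ⊕ j) k ≡ f k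
⊕-off f {j} {k} k≢j with k ≟ j
... | yes k≡j = contradiction k≡j k≢j
... | no _    = refl

⊕-≤ : ∀ f j k → f k ≤ (f ⊕ j) k
⊕-≤ f j k with k ≟ j
... | yes _ = n≤1+n (f k)
... | no _  = ≤-refl

⊕-cong : ∀ {f g} j → f ≗ g → f ⊕ j ≗ g ⊕ j
⊕-cong j f≗g k with k ≟ j
... | yes _ = cong suc (f≗g k)
... | no _  = f≗g k

⊕-comm : ∀ f i j → (f ⊕ i) ⊕ j ≗ (f ⊕ j) ⊕ i
⊕-comm f i j k with k ≟ j | k ≟ i
... | yes _ | yes _ = refl
... | yes _ | no _  = refl
... | no _  | yes _ = refl
... | no _  | no _  = refl

⊕-+ˡ : ∀ (f g : ℕ → ℕ) j k → (f ⊕ j) k + g k ≡ ((λ i → f i + g i) ⊕ j) k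
⊕-+ˡ f g j k with k ≟ j
... | yes _ = refl
... | no _  = refl

⊕-+ʳ : ∀ (f g : ℕ → ℕ) j k → f k + (g ⊕ j) k ≡ ((λ i → f i + g i) ⊕ j) k
⊕-+ʳ f g j k with k ≟ j
... | yes _ = +-suc (f k) (g k)
... | no _  = refl

-- An addable corner at index `j` of a partition `f`; index 0 is always addable.
Desc : (ℕ → ℕ) → ℕ → Set
Desc f zero    = ⊤
Desc f (suc j) = f (suc j) < f j

Antitone : (ℕ → ℕ) → Set
Antitone f = ∀ j → f (suc j) ≤ f j

antitone-≤ : ∀ {f} → Antitone f → ∀ {i j} → i ≤ j → f j ≤ f i
antitone-≤ anti {i} {zero} z≤n = ≤-refl
antitone-≤ anti {i} {suc j} i≤j with i ≟ suc j
... | yes refl = ≤-refl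
... | no i≢j   = ≤-trans (anti j) (antitone-≤ anti (≤-pred (≤∧≢⇒< i≤j i≢j)))

antitone-⊕ : ∀ {f} j → Antitone f → Desc f j → Antitone (f ⊕ j)
antitone-⊕ {f} j anti d k with suc k ≟ j
... | yes refl = ≤-trans d (⊕-≤ f j k)
... | no _     = ≤-trans (anti k) (⊕-≤ f j k)

antitone-≗ : ∀ {f g} → g ≗ f → Antitone f → Antitone g
antitone-≗ g≗f anti j = subst₂ _≤_ (sym (g≗f (suc j))) (sym (g≗f j)) (anti j)

desc-≗ : ∀ {f g} j → g ≗ f → Desc f j → Desc g j
desc-≗ zero    g≗f d = tt
desc-≗ (suc j) g≗f d = subst₂ _<_ (sym (g≗f (suc j))) (sym (g≗f j)) d

desc-⊕ : ∀ {f} i j → j ≢ i → Desc f j → Desc (f ⊕ i) j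
desc-⊕ i zero j≢i d = tt
desc-⊕ {f} i (suc j) j≢i d = subst (_< (f ⊕ i) j) (sym (⊕-off f j≢i)) (<-≤-trans d (⊕-≤ f i j))

+-squeezeˡ : ∀ {a b c d} → a ≤ b → c ≤ d → a + c ≡ b + d → a ≡ b
+-squeezeˡ {a} {b} {c} {d} a≤b c≤d eq with <-cmp a b
... | tri< a<b _ _ = contradiction eq (<⇒≢ (+-mono-<-≤ a<b c≤d))
... | tri≈ _ a≡b _ = a≡b
... | tri> _ _ b<a = contradiction a≤b (<⇒≱ b<a)

-- Row insertion on chains.

-- Chains: a tableau recorded as the list of its boxes (entry , row), last
-- added first.

Chain : Set
Chain = List (ℕ × ℕ)

len : Chain → ℕ → ℕ
len []            = λ _ → 0
len ((v , k) ∷ c) = len c ⊕ k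

-- A box added to row `k` lies in column `len c k`, counted from 0 and measured before the addition.
colLen : Chain → ℕ → ℕ
colLen []            = λ _ → 0
colLen ((v , k) ∷ c) = colLen c ⊕ len c k

-- Boxes are recorded in the order of their entries, equal ones from left to
-- right, i.e. in weakly decreasing rows.
Before : ℕ → ℕ → Chain → Set
Before v k []             = ⊤
Before v k ((v′ , k′) ∷ _) = v′ < v ⊎ (v′ ≡ v × k ≤ k′)

data Valid : Chain → Set where
  []   : Valid []
  cons : ∀ {v k c} → Desc (len c) k → Before v k c → Valid c → Valid ((v , k) ∷ c)

-- Row insertion of x, expressed on recorded boxes: the new box travels through
-- the chain, and pushes a later box that meets it in its row to the next row.
data Ins (x : ℕ) : Chain → Chain → ℕ → Set where
  nil  : Ins x [] ((x , 0) ∷ []) 0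
  top  : ∀ {v i c} → v ≤ x → Ins x ((v , i) ∷ c) ((x , 0) ∷ (v , i) ∷ c) 0
  bump : ∀ {v i c c′} → x < v → Ins x c c′ i → Ins x ((v , i) ∷ c) ((v , suc i) ∷ c′) (suc i)
  keep : ∀ {v i c c′ k} → x < v → Ins x c c′ k → k ≢ i → Ins x ((v , i) ∷ c) ((v , i) ∷ c′) k

ins-total : ∀ x c → ∃[ c′ ] ∃[ k ] Ins x c c′ k
ins-total x [] = _ , _ , nil
ins-total x ((v , i) ∷ c) with v ≤? x
... | yes v≤x = _ , _ , top v≤x
... | no v≰x with ins-total x c
... | c′ , k , ins with k ≟ i
... | yes refl = _ , _ , bump (≰⇒> v≰x) ins
... | no k≢i   = _ , _ , keep (≰⇒> v≰x) ins k≢i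

len-antitone : ∀ {c} → Valid c → Antitone (len c)
len-antitone []                      = λ _ → z≤n
len-antitone {(v , k) ∷ c} (cons d _ vc) = antitone-⊕ k (len-antitone vc) d

ins-len : ∀ {x c c′ k} → Ins x c c′ k → len c′ ≗ len c ⊕ k
ins-len nil          j = refl
ins-len (top _)      j = refl
ins-len {c = (_ , i) ∷ c} (bump _ ins) j = ⊕-cong (suc i) (ins-len ins) j
ins-len {c = (_ , i) ∷ c} {k = k} (keep _ ins _) j =
  trans (⊕-cong i (ins-len ins) j) (⊕-comm (len c) k i j)

desc-len-suc : ∀ {c i} → Valid c → Desc (len c ⊕ i) (suc i)
desc-len-suc {c} {i} vc = subst₂ _<_ (sym (⊕-off (len c) {i} {suc i} (λ ()))) (sym (⊕-at (len c) i))
                           (s≤s (len-antitone vc i))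

ins-desc : ∀ {x c c′ k} → Valid c → Ins x c c′ k → Desc (len c) k
ins-desc _ nil     = tt
ins-desc _ (top _) = tt
ins-desc (cons _ _ vc) (bump _ _) = desc-len-suc vc
ins-desc {c = (_ , i) ∷ _} {k = k} (cons _ _ vc) (keep _ ins k≢i) = desc-⊕ i k k≢i (ins-desc vc ins)

-- If the insertion ends in the row `i` of the next box `v`, that box is pushed to `suc i`, so the
-- order has to hold for this row. Only a tie with the last box of `c` needs care: it lies in a row
-- `i′ ≥ i`, and ending in row `i` forces `i < i′`.
ins-before : ∀ {x c c′ k v i} → x < v → Ins x c c′ k → Before v i c →
             (k ≢ i → Before v i c′) × (k ≡ i → Before v (suc i) c′)
ins-before x<v nil b = (λ _ → inj₁ x<v) , (λ _ → inj₁ x<v)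
ins-before x<v (top _) b = (λ _ → inj₁ x<v) , (λ _ → inj₁ x<v)
ins-before x<v (bump _ _) (inj₁ lt) = (λ _ → inj₁ lt) , (λ _ → inj₁ lt)
ins-before x<v (bump _ _) (inj₂ (e , le)) =
  (λ _ → inj₂ (e , m≤n⇒m≤1+n le)) , (λ { refl → contradiction le (<⇒≱ ≤-refl) })
ins-before x<v (keep _ _ _) (inj₁ lt) = (λ _ → inj₁ lt) , (λ _ → inj₁ lt)
ins-before x<v (keep _ _ k≢i) (inj₂ (e , le)) =
  (λ _ → inj₂ (e , le)) , (λ { refl → inj₂ (e , ≤∧≢⇒< le k≢i) })

ins-valid : ∀ {x c c′ k} → Valid c → Ins x c c′ k → Valid c′
ins-valid _ nil = cons tt tt []
ins-valid vc (top v≤x) with m≤n⇒m<n∨m≡n v≤x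
... | inj₁ v<x  = cons tt (inj₁ v<x) vc
... | inj₂ refl = cons tt (inj₂ (refl , z≤n)) vc
ins-valid {c′ = (_ , suc i) ∷ c′} (cons _ b vc) (bump x<v ins) =
  cons (desc-≗ (suc i) (ins-len ins) (desc-len-suc vc)) (proj₂ (ins-before x<v ins b) refl) (ins-valid vc ins)
ins-valid {c′ = (_ , i) ∷ c′} {k} (cons d b vc) (keep x<v ins k≢i) =
  cons (desc-≗ i (ins-len ins) (desc-⊕ k i (≢-sym k≢i) d)) (proj₁ (ins-before x<v ins b) k≢i) (ins-valid vc ins)

-- The row bumping lemma.
ins-rows : ∀ {x y c c₁ c₂ k₁ k₂} → x ≤ y → Ins x c c₁ k₁ → Ins y c₁ c₂ k₂ → k₂ ≤ k₁
ins-rows x≤y nil (top _) = z≤n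
ins-rows x≤y nil (bump y<x _) = contradiction x≤y (<⇒≱ y<x)
ins-rows x≤y nil (keep y<x _ _) = contradiction x≤y (<⇒≱ y<x)
ins-rows x≤y (top _) (top _) = z≤n
ins-rows x≤y (top _) (bump y<x _) = contradiction x≤y (<⇒≱ y<x)
ins-rows x≤y (top _) (keep y<x _ _) = contradiction x≤y (<⇒≱ y<x)
ins-rows x≤y (bump _ _) (top _) = z≤n
ins-rows x≤y (bump _ p) (bump _ q) = contradiction (ins-rows x≤y p q) (<⇒≱ ≤-refl)
ins-rows x≤y (bump _ p) (keep _ q _) = m≤n⇒m≤1+n (ins-rows x≤y p q)
ins-rows x≤y (keep _ _ _) (top _) = z≤n
ins-rows x≤y (keep _ p k≢i) (bump _ q) = ≤∧≢⇒< (ins-rows x≤y p q) (≢-sym k≢i)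
ins-rows x≤y (keep _ p _) (keep _ q _) = ins-rows x≤y p q

-- Mutual with `colLen-at`: addability makes the column reached by row `k` have exactly `k` boxes,
-- so that one added box respects conjugation.
conjugate : ∀ {c} → Valid c → ∀ i j → (j < len c i → i < colLen c j) × (i < colLen c j → j < len c i)
colLen-at : ∀ {c k} → Valid c → Desc (len c) k → colLen c (len c k) ≡ k

conjugate [] i j = (λ ()) , (λ ())
conjugate {(v , k) ∷ c} (cons d _ vc) i j with i ≟ k | j ≟ len c k
... | yes refl | yes refl rewrite colLen-at vc d = (λ _ → ≤-refl) , (λ _ → ≤-refl)
... | yes refl | no j≢ = (λ { (s≤s le) → proj₁ (conjugate vc i j) (≤∧≢⇒< le j≢) })
                       , (λ lt → m<n⇒m<1+n (proj₂ (conjugate vc i j) lt))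
... | no i≢k | yes refl = (λ lt → m<n⇒m<1+n (proj₁ (conjugate vc i j) lt))
                        , (λ { (s≤s le) → proj₂ (conjugate vc i j)
                               (≤∧≢⇒< le (λ e → i≢k (trans e (colLen-at vc d)))) })
... | no _ | no _ = conjugate vc i j

colLen-at {c} {zero} vc d with colLen c (len c 0) in eq
... | zero = refl
... | suc m = contradiction (proj₂ (conjugate vc 0 (len c 0)) (subst (0 <_) (sym eq) (s≤s z≤n))) (<-irrefl refl)
colLen-at {c} {suc k} vc d =
  ≤-antisym (≮⇒≥ (λ lt → <-irrefl refl (proj₂ (conjugate vc (suc k) (len c (suc k))) lt)))
            (proj₁ (conjugate vc k (len c (suc k))) d)

colLen-desc : ∀ {c k} → Valid c → Desc (len c) k → Desc (colLen c) (len c k)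
colLen-desc {c} {k} vc d with len c k in eq
... | zero = tt
... | suc j = subst (_< colLen c j) (sym (trans (cong (colLen c) (sym eq)) (colLen-at vc d)))
                (proj₁ (conjugate vc k j) (subst (j <_) (sym eq) ≤-refl))

-- Distribution of the boxes between a prefix and its complement.

-- `f` counts parts by size, so a drop after `j` exhibits a part of size exactly `suc j` to be
-- enlarged. In column 0 the SSAF entry n + 1 - v must be one of the first u = n - v₀ basement
-- entries, that is, v₀ < v.
Can : ℕ → ℕ → (ℕ → ℕ) → ℕ → Set
Can v₀ v f zero    = v₀ < v
Can v₀ v f (suc j) = f (suc j) < f j

can? : ∀ v₀ v f j → Dec (Can v₀ v f j)
can? v₀ v f zero    = v₀ <? v
can? v₀ v f (suc j) = f (suc j) <? f j

can⇒desc : ∀ {v₀ v f} j → Can v₀ v f j → Desc f j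
can⇒desc zero    _   = tt
can⇒desc (suc j) can = can

choose : {P X : Set} → Dec P → X → X → X
choose (yes _) x y = x
choose (no _)  x y = y

-- A box of column j with entry v enlarges a part of size j of the composition; it
-- takes the leftmost one, hence one counted by A if there is any.  Parts of
-- size 0 sit over the basement, where v has to be above the threshold v₀.
A C : ℕ → Chain → ℕ → ℕ
A v₀ []            = λ _ → 0
A v₀ ((v , k) ∷ c) = choose (can? v₀ v (A v₀ c) (len c k)) (A v₀ c ⊕ len c k) (A v₀ c)

C v₀ []            = λ _ → 0
C v₀ ((v , k) ∷ c) = choose (can? v₀ v (A v₀ c) (len c k)) (C v₀ c) (C v₀ c ⊕ len c k)

data VStep (v₀ v j : ℕ) (a c a′ c′ : ℕ → ℕ) : Set where
  va : Can v₀ v a j → a′ ≗ a ⊕ j → c′ ≗ c → VStep v₀ v j a c a′ c′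
  vc : ¬ Can v₀ v a j → a′ ≗ a → c′ ≗ c ⊕ j → VStep v₀ v j a c a′ c′

vstep : ∀ v₀ v k c → VStep v₀ v (len c k) (A v₀ c) (C v₀ c) (A v₀ ((v , k) ∷ c)) (C v₀ ((v , k) ∷ c))
vstep v₀ v k c with can? v₀ v (A v₀ c) (len c k)
... | yes can = va can (λ _ → refl) (λ _ → refl)
... | no ¬can = vc ¬can (λ _ → refl) (λ _ → refl)

vstep-+ : ∀ {v₀ v j a c a′ c′} → VStep v₀ v j a c a′ c′ →
          (λ i → a′ i + c′ i) ≗ (λ i → a i + c i) ⊕ j
vstep-+ {j = j} {a} {c} (va _ ea ec) i = trans (cong₂ _+_ (ea i) (ec i)) (⊕-+ˡ a c j i)
vstep-+ {j = j} {a} {c} (vc _ ea ec) i = trans (cong₂ _+_ (ea i) (ec i)) (⊕-+ʳ a c j i)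

A+C : ∀ v₀ c → (λ j → A v₀ c j + C v₀ c j) ≗ colLen c
A+C v₀ []            j = refl
A+C v₀ ((v , k) ∷ c) j = trans (vstep-+ (vstep v₀ v k c) j) (⊕-cong (len c k) (A+C v₀ c) j)

-- The total drops at `j`; if the share of A does not, the drop belongs to C. Hence C can always
-- take what A refuses.
desc-remainder : ∀ {v₀ v a c} j → ¬ Can v₀ v a j → Desc (λ i → a i + c i) j → Desc c j
desc-remainder zero ¬can d = tt
desc-remainder {a = a} {c} (suc j) ¬can d =
  +-cancelˡ-< (a (suc j)) _ _ (<-≤-trans d (+-monoˡ-≤ (c j) (≮⇒≥ ¬can)))

addable : ∀ v₀ {c k} → Valid c → Desc (len c) k → Desc (λ i → A v₀ c i + C v₀ c i) (len c k)
addable v₀ {c} {k} valid d = desc-≗ (len c k) (A+C v₀ c) (colLen-desc valid d)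

A-antitone : ∀ v₀ c → Antitone (A v₀ c)
A-antitone v₀ [] j = z≤n
A-antitone v₀ ((v , k) ∷ c) with vstep v₀ v k c
... | va can ea _ = antitone-≗ ea (antitone-⊕ (len c k) (A-antitone v₀ c) (can⇒desc (len c k) can))
... | vc _ ea _   = antitone-≗ ea (A-antitone v₀ c)

C-antitone : ∀ v₀ {c} → Valid c → Antitone (C v₀ c)
C-antitone v₀ [] j = z≤n
C-antitone v₀ {(v , k) ∷ c} (cons d _ valid) with vstep v₀ v k c
... | va _ _ ec    = antitone-≗ ec (C-antitone v₀ valid)
... | vc ¬can _ ec = antitone-≗ ec
  (antitone-⊕ (len c k) (C-antitone v₀ valid) (desc-remainder (len c k) ¬can (addable v₀ valid d)))

-- Local rules for one insertion.

-- Effect of an insertion whose new box is in column h.  The equation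
-- c h ≡ c (suc h) is what makes block-fails work.
data Horiz (h : ℕ) (a c a′ c′ : ℕ → ℕ) : Set where
  up-a : a′ ≗ a ⊕ h → c′ ≗ c → Desc a h → c h ≡ c (suc h) → Horiz h a c a′ c′
  up-c : a′ ≗ a → c′ ≗ c ⊕ h → Desc c h → Horiz h a c a′ c′

desc-mono : ∀ {f g} h → g h ≡ f h → (∀ k → f k ≤ g k) → Desc f h → Desc g h
desc-mono zero    _ _ _ = tt
desc-mono {f} {g} (suc h) e f≤g d = subst (_< g h) (sym e) (<-≤-trans d (f≤g h))

≗⊕-≤ : ∀ {f g j} → g ≗ f ⊕ j → ∀ k → f k ≤ g k
≗⊕-≤ {f} {j = j} e k = subst (f k ≤_) (sym (e k)) (⊕-≤ f j k)

≗⊕-off : ∀ {f g j k} → g ≗ f ⊕ j → k ≢ j → g k ≡ f k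
≗⊕-off {f} e k≢j = trans (e _) (⊕-off f k≢j)

≗⊕-at : ∀ {f g j} → g ≗ f ⊕ j → g j ≡ suc (f j)
≗⊕-at {f} e = trans (e _) (⊕-at f _)

can-≗ : ∀ {v₀ v f g} j → g ≗ f → Can v₀ v f j → Can v₀ v g j
can-≗ zero    e can = can
can-≗ (suc j) e can = subst₂ _<_ (sym (e (suc j))) (sym (e j)) can

can-forth : ∀ {v₀ v h a a₁} l → a₁ ≗ a ⊕ h → h ≢ l → Can v₀ v a l → Can v₀ v a₁ l
can-forth zero    e h≢l can = can
can-forth (suc l) e h≢l can = desc-mono (suc l) (≗⊕-off e (≢-sym h≢l)) (≗⊕-≤ e) can

-- Only `l = h` is delicate: the increment at `h` might create the part of size `suc h` that is
-- used. As `c` is flat from `h` to `suc h`, the drop of the total there is a drop of `a`, so such a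
-- part existed before.
can-back : ∀ {v₀ v h} {a a₁ c : ℕ → ℕ} l → a₁ ≗ a ⊕ h → h ≢ l → Desc (λ i → a i + c i) l → c h ≡ c (suc h) →
           Can v₀ v a₁ l → Can v₀ v a l
can-back zero e h≢l d ch can = can
can-back {h = h} {a} {c = c} (suc l) e h≢l d ch can with l ≟ h
... | yes refl = +-cancelʳ-< (c (suc h)) _ _ (subst (λ z → a (suc h) + c (suc h) < a h + z) ch d)
... | no l≢h   = subst₂ _<_ (≗⊕-off e (≢-sym h≢l)) (≗⊕-off e l≢h) can

module _ {v₀ v h l : ℕ} {a a₁ a₂ a₃ c c₁ c₂ c₃ : ℕ → ℕ} where

  private
    swap₂ : ∀ {f f₁ f₂ f₃ : ℕ → ℕ} → f₁ ≗ f ⊕ h → f₂ ≗ f ⊕ l → f₃ ≗ f₁ ⊕ l → f₃ ≗ f₂ ⊕ h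
    swap₂ {f} e₁ e₂ e₃ k =
      trans (e₃ k) (trans (⊕-cong l e₁ k) (trans (⊕-comm f h l k) (sym (⊕-cong h e₂ k))))

    swap₁ : ∀ {f f₁ f₂ f₃ : ℕ → ℕ} {j} → f₁ ≗ f ⊕ j → f₂ ≗ f → f₃ ≗ f₁ → f₃ ≗ f₂ ⊕ j
    swap₁ {j = j} e₁ e₂ e₃ k = trans (e₃ k) (trans (e₁ k) (sym (⊕-cong j e₂ k)))

    swap₀ : ∀ {f f₁ f₂ f₃ : ℕ → ℕ} → f₁ ≗ f → f₂ ≗ f ⊕ l → f₃ ≗ f₁ ⊕ l → f₃ ≗ f₂
    swap₀ e₁ e₂ e₃ k = trans (e₃ k) (trans (⊕-cong l e₁ k) (sym (e₂ k)))

    same : ∀ {f f₁ f₂ f₃ : ℕ → ℕ} → f₁ ≗ f → f₂ ≗ f → f₃ ≗ f₁ → f₃ ≗ f₂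
    same e₁ e₂ e₃ k = trans (e₃ k) (trans (e₁ k) (sym (e₂ k)))

  -- In different columns the increments commute; the content is that the recorded box chooses the
  -- same side before and after the insertion.
  horiz-pass : h ≢ l → Desc (λ i → a i + c i) l → Horiz h a c a₁ c₁ →
               VStep v₀ v l a c a₂ c₂ → VStep v₀ v l a₁ c₁ a₃ c₃ → Horiz h a₂ c₂ a₃ c₃
  horiz-pass h≢l d (up-a ea ec da ch) (va can ea₂ ec₂) (va can₁ ea₃ ec₃) =
    up-a (swap₂ ea ea₂ ea₃) (same ec ec₂ ec₃) (desc-mono h (≗⊕-off ea₂ h≢l) (≗⊕-≤ ea₂) da)
         (trans (ec₂ h) (trans ch (sym (ec₂ (suc h)))))
  horiz-pass h≢l d (up-a ea ec da ch) (va can _ _) (vc ¬can₁ _ _) =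
    contradiction (can-forth l ea h≢l can) ¬can₁
  horiz-pass h≢l d (up-a ea ec da ch) (vc ¬can _ _) (va can₁ _ _) =
    contradiction (can-back {c = c} l ea h≢l d ch can₁) ¬can
  horiz-pass h≢l d (up-a ea ec da ch) (vc ¬can ea₂ ec₂) (vc ¬can₁ ea₃ ec₃) =
    up-a (swap₁ ea ea₂ ea₃) (swap₀ ec ec₂ ec₃) (desc-≗ h ea₂ da) ch₂
    where
    ch₂ : c₂ h ≡ c₂ (suc h)
    ch₂ with suc h ≟ l
    -- A box refused by A in column `suc h` requires C to drop there, contrary to the flatness of C
    -- at `h`.
    ... | yes refl = contradiction (desc-remainder {v₀} {v} {a} {c} (suc h) ¬can d) (<-irrefl (sym ch))
    ... | no sh≢l  = trans (≗⊕-off ec₂ h≢l) (trans ch (sym (≗⊕-off ec₂ sh≢l)))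
  horiz-pass h≢l d (up-c ea ec dc) (va can ea₂ ec₂) (va can₁ ea₃ ec₃) =
    up-c (swap₀ ea ea₂ ea₃) (swap₁ ec ec₂ ec₃) (desc-≗ h ec₂ dc)
  horiz-pass h≢l d (up-c ea ec dc) (va can _ _) (vc ¬can₁ _ _) =
    contradiction (can-≗ l ea can) ¬can₁
  horiz-pass h≢l d (up-c ea ec dc) (vc ¬can _ _) (va can₁ _ _) =
    contradiction (can-≗ l (λ k → sym (ea k)) can₁) ¬can
  horiz-pass h≢l d (up-c ea ec dc) (vc ¬can ea₂ ec₂) (vc ¬can₁ ea₃ ec₃) =
    up-c (same ea ea₂ ea₃) (swap₂ ec ec₂ ec₃) (desc-mono h (≗⊕-off ec₂ h≢l) (≗⊕-≤ ec₂) dc)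

⊕-same : ∀ {f f₁ f₂ f₃ : ℕ → ℕ} {j m} → f₁ ≗ f ⊕ j → f₂ ≗ f ⊕ j → f₃ ≗ f₁ ⊕ m → f₃ ≗ f₂ ⊕ m
⊕-same {m = m} e₁ e₂ e₃ k = trans (e₃ k) (⊕-cong m (λ i → trans (e₁ i) (sym (e₂ i))) k)

-- When both increments are in column m, Fomin's rule moves them on to the column
-- m′ ≤ m in which the next row ends; this is the case m′ = m.
horiz-stay : ∀ {v₀ v m a a₁ a₂ a₃ c c₁ c₂ c₃} → (∀ {k} → a₁ ≗ a ⊕ k → v₀ < v) →
             Desc (λ i → a₁ i + c₁ i) m → Horiz m a c a₁ c₁ →
             VStep v₀ v m a c a₂ c₂ → VStep v₀ v m a₁ c₁ a₃ c₃ → Horiz m a₂ c₂ a₃ c₃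
horiz-stay {m = m} pos d (up-a ea ec da ch) (va can ea₂ ec₂) (va can₁ ea₃ ec₃) =
  up-a (⊕-same ea ea₂ ea₃) (λ k → trans (ec₃ k) (trans (ec k) (sym (ec₂ k))))
       (desc-≗ m (λ k → trans (ea₂ k) (sym (ea k))) (can⇒desc m can₁))
       (trans (ec₂ m) (trans ch (sym (ec₂ (suc m)))))
horiz-stay {m = m} pos d (up-a ea ec da ch) (va can ea₂ ec₂) (vc ¬can₁ ea₃ ec₃) =
  up-c (λ k → trans (ea₃ k) (trans (ea k) (sym (ea₂ k))))
       (λ k → trans (ec₃ k) (⊕-cong m (λ i → trans (ec i) (sym (ec₂ i))) k))
       (desc-≗ m (λ k → trans (ec₂ k) (sym (ec k))) (desc-remainder m ¬can₁ d))
horiz-stay {m = zero} pos d (up-a ea ec da ch) (vc ¬can _ _) _ = contradiction (pos ea) ¬can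
horiz-stay {m = suc m} pos d (up-a ea ec da ch) (vc ¬can _ _) _ = contradiction da ¬can
horiz-stay {m = m} pos d (up-c ea ec dc) (va can ea₂ ec₂) (va can₁ ea₃ ec₃) =
  up-c (λ k → trans (ea₃ k) (trans (⊕-cong m ea k) (sym (ea₂ k))))
       (λ k → trans (ec₃ k) (trans (ec k) (sym (⊕-cong m ec₂ k))))
       (desc-≗ m ec₂ dc)
horiz-stay {m = m} pos d (up-c ea ec dc) (va can _ _) (vc ¬can₁ _ _) = contradiction (can-≗ m ea can) ¬can₁
horiz-stay {m = m} pos d (up-c ea ec dc) (vc ¬can _ _) (va can₁ _ _) =
  contradiction (can-≗ m (λ k → sym (ea k)) can₁) ¬can
horiz-stay {m = m} pos d (up-c ea ec dc) (vc ¬can ea₂ ec₂) (vc ¬can₁ ea₃ ec₃) =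
  up-c (λ k → trans (ea₃ k) (trans (ea k) (sym (ea₂ k)))) (⊕-same ec ec₂ ec₃)
       (desc-≗ m (λ k → trans (ec₂ k) (sym (ec k))) (desc-remainder m ¬can₁ d))

-- Were the insertion to enlarge C and the recorded box A, both would drop at `m`, a total drop of
-- at least two that a single box cannot fill; but the columns from `m′` to `m` have equal heights.
-- Conversely, an insertion enlarging A in a column `m > 0` already proves that A can take the
-- recorded box.
horiz-vstep-agree : ∀ {v₀ v m m′ a a₁ a₂ c c₁ c₂} → m′ < m →
                    (∀ j → m′ ≤ j → j ≤ m → a₂ j + c₂ j ≡ a₂ m + c₂ m) →
                    Horiz m a c a₁ c₁ → VStep v₀ v m a c a₂ c₂ → (a₁ ≗ a₂) × (c₁ ≗ c₂)
horiz-vstep-agree m′<m const (up-a ea ec da ch) (va _ ea₂ ec₂) =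
  (λ k → trans (ea k) (sym (ea₂ k))) , (λ k → trans (ec k) (sym (ec₂ k)))
horiz-vstep-agree {m = suc _} m′<m const (up-a ea ec da ch) (vc ¬can _ _) = contradiction da ¬can
horiz-vstep-agree m′<m const (up-c ea ec dc) (vc _ ea₂ ec₂) =
  (λ k → trans (ea k) (sym (ea₂ k))) , (λ k → trans (ec k) (sym (ec₂ k)))
horiz-vstep-agree {m = suc g} {a₂ = a₂} {c₂ = c₂} (s≤s m′≤g) const (up-c ea ec dc) (va can ea₂ ec₂) =
  contradiction (const g m′≤g (n≤1+n g)) (≢-sym (<⇒≢ lt))
  where
  lt : a₂ (suc g) + c₂ (suc g) < a₂ g + c₂ g
  lt = subst₂ (λ x y → x + y < a₂ g + c₂ g) (sym (≗⊕-at ea₂)) (sym (ec₂ (suc g)))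
         (<-≤-trans (+-mono-≤-< can dc)
            (+-mono-≤ (≗⊕-≤ ea₂ g) (≤-reflexive (sym (ec₂ g)))))

-- Since both steps in column `m` agree, only the displaced box in column `m′` is new. The flatness
-- of C for `up-a` holds because the total is constant from `m′` to `suc m′` while A and C both
-- decrease weakly.
horiz-move : ∀ {v₀ v m m′ a a₁ a₂ a₃ c c₁ c₂ c₃} → m′ < m → Antitone a₂ → Antitone c₂ →
             (∀ j → m′ ≤ j → j ≤ m → a₂ j + c₂ j ≡ a₂ m + c₂ m) →
             Desc (λ i → a₁ i + c₁ i) m′ → Horiz m a c a₁ c₁ →
             VStep v₀ v m a c a₂ c₂ → VStep v₀ v m′ a₁ c₁ a₃ c₃ → Horiz m′ a₂ c₂ a₃ c₃
horiz-move {v₀} {v} {m} {m′} {a} {a₁} {a₂} {a₃} {c} {c₁} {c₂} {c₃} m′<m antia antic const d hz vs vs₃ =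
  finish (proj₁ agree) (proj₂ agree) vs₃
  where
  agree : (a₁ ≗ a₂) × (c₁ ≗ c₂)
  agree = horiz-vstep-agree m′<m const hz vs
  finish : a₁ ≗ a₂ → c₁ ≗ c₂ → VStep v₀ v m′ a₁ c₁ a₃ c₃ → Horiz m′ a₂ c₂ a₃ c₃
  finish e f (va can ea₃ ec₃) =
    up-a (λ k → trans (ea₃ k) (⊕-cong m′ e k)) (λ k → trans (ec₃ k) (f k))
         (desc-≗ m′ (λ k → sym (e k)) (can⇒desc m′ can))
         (sym (+-squeezeˡ (antic m′) (antia m′) (trans (+-comm (c₂ (suc m′)) _) (trans
            (trans (const (suc m′) (n≤1+n m′) m′<m) (sym (const m′ ≤-refl (<⇒≤ m′<m)))) (+-comm (a₂ m′) _)))))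
  finish e f (vc ¬can ea₃ ec₃) =
    up-c (λ k → trans (ea₃ k) (e k)) (λ k → trans (ec₃ k) (⊕-cong m′ f k))
         (desc-≗ m′ (λ k → sym (f k)) (desc-remainder m′ ¬can d))

valid-head : ∀ {v k c} → Valid ((v , k) ∷ c) → All (λ b → proj₁ b ≤ v) c
valid-head (cons _ _ []) = []
valid-head (cons _ b (cons {c = c} d b′ valid)) = le b ∷ All.map (λ le′ → ≤-trans le′ (le b)) (valid-head (cons d b′ valid))
  where
  le : ∀ {v k v′ k′} → v′ < v ⊎ (v′ ≡ v × k ≤ k′) → v′ ≤ v
  le (inj₁ lt)         = <⇒≤ lt
  le (inj₂ (refl , _)) = ≤-refl

A-zero : ∀ {v₀ c} → All (λ b → proj₁ b ≤ v₀) c → ∀ j → A v₀ c j ≡ 0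
A-zero [] j = refl
A-zero {v₀} {(v , k) ∷ c} (v≤ ∷ vs) j with vstep v₀ v k c
... | vc _ ea _ = trans (ea j) (A-zero vs j)
... | va can _ _ with len c k | can
...   | zero  | lt = contradiction v≤ (<⇒≱ lt)
...   | suc g | lt = contradiction (subst (A v₀ c (suc g) <_) (A-zero vs g) lt) (λ ())

C-zero : ∀ {v₀ c} → Valid c → All (λ b → v₀ < proj₁ b) c → ∀ j → C v₀ c j ≡ 0
C-zero [] [] j = refl
C-zero {v₀} {(v , k) ∷ c} (cons d _ valid) (v< ∷ vs) j with vstep v₀ v k c
... | va _ _ ec = trans (ec j) (C-zero valid vs j)
... | vc ¬can _ _ with len c k | desc-remainder (len c k) ¬can (addable v₀ valid d) | ¬can
...   | zero  | _ | ¬lt = contradiction v< ¬lt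
...   | suc g | lt | _ = contradiction (subst (C v₀ c (suc g) <_) (C-zero valid vs g) lt) (λ ())

ins-all : ∀ {x c c′ k} {P : ℕ → Set} → P x → All (λ b → P (proj₁ b)) c → Ins x c c′ k → All (λ b → P (proj₁ b)) c′
ins-all px ps nil = px ∷ ps
ins-all px ps (top _) = px ∷ ps
ins-all px (p ∷ ps) (bump _ ins) = p ∷ ins-all px ps ins
ins-all px (p ∷ ps) (keep _ ins _) = p ∷ ins-all px ps ins

colLen-top : ∀ {c} → Valid c → ∀ j → len c 0 ≤ j → colLen c j ≡ 0
colLen-top {c} valid j le with colLen c j in eq
... | zero  = refl
... | suc _ = contradiction (proj₂ (conjugate valid 0 j) (subst (0 <_) (sym eq) (s≤s z≤n))) (≤⇒≯ le)

-- The new box lies to the right of all columns, where C vanishes and is therefore flat.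
ins-top : ∀ v₀ x {c} → Valid c → Horiz (len c 0) (A v₀ c) (C v₀ c) (A v₀ ((x , 0) ∷ c)) (C v₀ ((x , 0) ∷ c))
ins-top v₀ x {c} valid with vstep v₀ x 0 c
... | va can ea ec = up-a ea ec (can⇒desc (len c 0) can)
    (trans (C0 (len c 0) ≤-refl) (sym (C0 (suc (len c 0)) (n≤1+n _))))
  where
  C0 : ∀ j → len c 0 ≤ j → C v₀ c j ≡ 0
  C0 j le = m+n≡0⇒n≡0 (A v₀ c j) (trans (A+C v₀ c j) (colLen-top valid j le))
... | vc ¬can ea ec = up-c ea ec (desc-remainder (len c 0) ¬can (addable v₀ valid tt))

horiz-cong : ∀ {h h′ a c a′ c′} → h ≡ h′ → Horiz h a c a′ c′ → Horiz h′ a c a′ c′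
horiz-cong refl hz = hz

-- Each later box is one square of the growth diagram: `keep` is the case of different columns,
-- while `bump` moves the increment to the column where the next row ends.
ins-horiz : ∀ v₀ {x c c′ k} → Valid c → Ins x c c′ k → Horiz (len c k) (A v₀ c) (C v₀ c) (A v₀ c′) (C v₀ c′)
ins-horiz v₀ {x} [] nil = ins-top v₀ x []
ins-horiz v₀ {x} valid (top _) = ins-top v₀ x valid
ins-horiz v₀ {x} {(v , i) ∷ c} {(_ , _) ∷ c′} {k} (cons d b valid) (keep x<v ins k≢i) =
  horiz-cong (sym (⊕-off (len c) k≢i))
    (horiz-pass h≢l (addable v₀ valid d) (ins-horiz v₀ valid ins) (vstep v₀ v i c)
       (subst (λ j → VStep v₀ v j (A v₀ c′) (C v₀ c′) (A v₀ ((v , i) ∷ c′)) (C v₀ ((v , i) ∷ c′)))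
          (≗⊕-off (ins-len ins) (≢-sym k≢i)) (vstep v₀ v i c′)))
  where
  -- A column has only one addable row, its height.
  h≢l : len c k ≢ len c i
  h≢l e = k≢i (trans (sym (colLen-at valid (ins-desc valid ins))) (trans (cong (colLen c) e) (colLen-at valid d)))
ins-horiz v₀ {x} {(v , i) ∷ c} {(_ , _) ∷ c′} valid₂@(cons d b valid) (bump x<v ins) =
  horiz-cong (sym (⊕-off (len c) (λ ()))) main
  where
  m m′ : ℕ
  m  = len c i
  m′ = len c (suc i)
  valid′ : Valid c′
  valid′ = ins-valid valid ins
  d′ : Desc (len c′) (suc i)
  d′ = desc-≗ (suc i) (ins-len ins) (desc-len-suc valid)
  em′ : len c′ (suc i) ≡ m′
  em′ = ≗⊕-off (ins-len ins) (λ ())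
  hz : Horiz m (A v₀ c) (C v₀ c) (A v₀ c′) (C v₀ c′)
  hz = ins-horiz v₀ valid ins
  vs₂ : VStep v₀ v m (A v₀ c) (C v₀ c) (A v₀ ((v , i) ∷ c)) (C v₀ ((v , i) ∷ c))
  vs₂ = vstep v₀ v i c
  vs₃ : VStep v₀ v m′ (A v₀ c′) (C v₀ c′) (A v₀ ((v , suc i) ∷ c′)) (C v₀ ((v , suc i) ∷ c′))
  vs₃ = subst (λ j → VStep v₀ v j (A v₀ c′) (C v₀ c′) (A v₀ ((v , suc i) ∷ c′)) (C v₀ ((v , suc i) ∷ c′)))
          em′ (vstep v₀ v (suc i) c′)
  dm′ : Desc (λ j → A v₀ c′ j + C v₀ c′ j) m′
  dm′ = subst (Desc _) em′ (addable v₀ valid′ d′)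
  pos : ∀ {j} → A v₀ c′ ≗ A v₀ c ⊕ j → v₀ < v
  pos {j} e with v₀ <? v
  ... | yes lt = lt
  ... | no ¬lt = contradiction (trans (sym (A-zero (ins-all (≤-trans (<⇒≤ x<v) (≮⇒≥ ¬lt))
                   (All.map (λ le → ≤-trans le (≮⇒≥ ¬lt)) (valid-head valid₂)) ins) j)) (≗⊕-at e)) (λ ())
  -- With `v` in row `i`, this row reaches column `m` and row `suc i` stops before `m′`; the columns
  -- in between have height `suc i`.
  const : ∀ j → m′ ≤ j → j ≤ m → colLen ((v , i) ∷ c) j ≡ suc i
  const j lo hi = ≤-antisym
    (≮⇒≥ (λ lt → <⇒≱ (subst (j <_) (⊕-off (len c) {i} {suc i} (λ ())) (proj₂ (conjugate valid₂ (suc i) j) lt)) lo))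
    (proj₁ (conjugate valid₂ i j) (subst (j <_) (sym (⊕-at (len c) i)) (s≤s hi)))
  main : Horiz m′ (A v₀ ((v , i) ∷ c)) (C v₀ ((v , i) ∷ c)) (A v₀ ((v , suc i) ∷ c′)) (C v₀ ((v , suc i) ∷ c′))
  main with m≤n⇒m<n∨m≡n (len-antitone valid i)
  ... | inj₁ m′<m = horiz-move m′<m (A-antitone v₀ ((v , i) ∷ c)) (C-antitone v₀ valid₂)
        (λ j lo hi → trans (A+C v₀ ((v , i) ∷ c) j) (trans (const j lo hi)
           (sym (trans (A+C v₀ ((v , i) ∷ c) m) (const m (<⇒≤ m′<m) ≤-refl)))))
        dm′ hz vs₂ vs₃
  ... | inj₂ m′≡m = horiz-cong (sym m′≡m) (horiz-stay pos
        (subst (Desc _) m′≡m dm′) hz vs₂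
        (subst (λ j → VStep v₀ v j (A v₀ c′) (C v₀ c′) (A v₀ ((v , suc i) ∷ c′)) (C v₀ ((v , suc i) ∷ c′))) m′≡m vs₃))

-- RSK of a biword on chains.

-- flipBiword reverses w, so the first letter of w is inserted last.
data Rsk (n : ℕ) : List Biletter → Chain → Chain → Set where
  []   : Rsk n [] [] []
  step : ∀ {j i w p p′ q k} → Rsk n w p q → Ins (cmpl n i) p p′ k →
         Rsk n ((j , i) ∷ w) p′ ((cmpl n j , k) ∷ q)

rsk-total : ∀ n w → ∃[ p ] ∃[ q ] Rsk n w p q
rsk-total n [] = _ , _ , []
rsk-total n ((j , i) ∷ w) with rsk-total n w
... | p , q , r with ins-total (cmpl n i) p
... | p′ , k , ins = _ , _ , step r ins

cmpl-> : ∀ {n t j} → j ≤ n → j ≤ t → n ∸ t < cmpl n j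
cmpl-> {n} {t} {j} j≤n j≤t =
  subst (n ∸ t <_) (sym (+-∸-assoc 1 j≤n)) (s≤s (∸-monoʳ-≤ n j≤t))

cmpl-≤ : ∀ {n t j} → t < j → cmpl n j ≤ n ∸ t
cmpl-≤ {n} t<j = ∸-monoʳ-≤ (suc n) t<j

-- For equal top letters the bottoms increase weakly along `w`; complementing and reversing inserts
-- weakly increasing values, and the row bumping lemma orders the new boxes from left to right.
rsk-before : ∀ {n j i w p p′ q k} → Biword n ((j , i) ∷ w) → Rsk n w p q → Ins (cmpl n i) p p′ k →
             Before (cmpl n j) k q
rsk-before _ [] _ = tt
rsk-before (_ ∷ ((_ , j′≤n) , _) ∷ _ , inj₁ j<j′ ∷ _) (step _ _) _ =
  inj₁ (∸-monoʳ-< j<j′ (m≤n⇒m≤1+n j′≤n))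
rsk-before {n} (_ , inj₂ (refl , i≤i′) ∷ _) (step _ ins₁) ins₂ =
  inj₂ (refl , ins-rows (∸-monoʳ-≤ (suc n) i≤i′) ins₁ ins₂)

rsk-valid : ∀ {n w p q} → Biword n w → Rsk n w p q → Valid p × Valid q × (len p ≗ len q)
rsk-valid _ [] = [] , [] , λ _ → refl
rsk-valid {n} bw@(_ ∷ ranges , lex) (step {k = k} r ins)
  with rsk-valid (ranges , Linked.tail lex) r
... | vp , vq , eq = ins-valid vp ins
                   , cons (desc-≗ k (λ m → sym (eq m)) (ins-desc vp ins)) (rsk-before bw r ins) vq
                   , λ m → trans (ins-len ins m) (⊕-cong k eq m)

horiz-+ : ∀ {h a c a′ c′} → Horiz h a c a′ c′ → (λ i → a′ i + c′ i) ≗ (λ i → a i + c i) ⊕ h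
horiz-+ {h} {a} {c} (up-a ea ec _ _) i = trans (cong₂ _+_ (ea i) (ec i)) (⊕-+ˡ a c h i)
horiz-+ {h} {a} {c} (up-c ea ec _) i   = trans (cong₂ _+_ (ea i) (ec i)) (⊕-+ʳ a c h i)

ins-colLen : ∀ {x c c′ k} → Valid c → Ins x c c′ k → colLen c′ ≗ colLen c ⊕ len c k
ins-colLen {c = c} {c′} {k} valid ins i =
  trans (sym (A+C 0 c′ i)) (trans (horiz-+ (ins-horiz 0 valid ins) i) (⊕-cong (len c k) (A+C 0 c) i))

rsk-colLen : ∀ {n w p q} → Biword n w → Rsk n w p q → colLen p ≗ colLen q
rsk-colLen _ [] i = refl
rsk-colLen (_ ∷ ranges , lex) (step {p = p} {q = q} {k = k} r ins) i with rsk-valid (ranges , Linked.tail lex) r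
... | vp , vq , eq = trans (ins-colLen vp ins i)
    (trans (⊕-cong (len p k) (rsk-colLen (ranges , Linked.tail lex) r) i)
           (cong (λ j → (colLen q ⊕ j) i) (eq k)))

rsk-allP : ∀ {n w p q} {P : ℕ → Set} → All (λ b → P (cmpl n (proj₂ b))) w → Rsk n w p q → All (λ b → P (proj₁ b)) p
rsk-allP [] [] = []
rsk-allP {P = P} (px ∷ ps) (step r ins) = ins-all {P = P} px (rsk-allP {P = P} ps r) ins

rsk-allQ : ∀ {n w p q} {P : ℕ → Set} → All (λ b → P (cmpl n (proj₁ b))) w → Rsk n w p q → All (λ b → P (proj₁ b)) q
rsk-allQ [] [] = []
rsk-allQ {P = P} (px ∷ ps) (step r ins) = px ∷ rsk-allQ {P = P} ps r

ins-any : ∀ {x c c′ k} {P : ℕ → Set} → P x ⊎ Any (λ b → P (proj₁ b)) c → Ins x c c′ k → Any (λ b → P (proj₁ b)) c′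
ins-any (inj₁ px) nil = here px
ins-any (inj₂ ()) nil
ins-any (inj₁ px) (top _) = here px
ins-any (inj₂ ps) (top _) = there ps
ins-any (inj₁ px) (bump _ ins) = there (ins-any (inj₁ px) ins)
ins-any (inj₂ (here p)) (bump _ ins) = here p
ins-any (inj₂ (there ps)) (bump _ ins) = there (ins-any (inj₂ ps) ins)
ins-any (inj₁ px) (keep _ ins _) = there (ins-any (inj₁ px) ins)
ins-any (inj₂ (here p)) (keep _ ins _) = here p
ins-any (inj₂ (there ps)) (keep _ ins _) = there (ins-any (inj₂ ps) ins)

rsk-anyP : ∀ {n w p q} {P : ℕ → Set} → Any (λ b → P (cmpl n (proj₂ b))) w → Rsk n w p q → Any (λ b → P (proj₁ b)) p
rsk-anyP {P = P} (here px)  (step r ins) = ins-any {P = P} (inj₁ px) ins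
rsk-anyP {P = P} (there ps) (step r ins) = ins-any {P = P} (inj₂ (rsk-anyP {P = P} ps r)) ins

lex-tops : ∀ {b w} → Linked LexLeq (b ∷ w) → All (λ b′ → proj₁ b ≤ proj₁ b′) w
lex-tops [-] = []
lex-tops {b} (_∷_ {x = x} {y} lt ls) = le lt ∷ All.map (≤-trans (le lt)) (lex-tops ls)
  where
  le : ∀ {b b′} → LexLeq b b′ → proj₁ b ≤ proj₁ b′
  le (inj₁ j<j′)       = <⇒≤ j<j′
  le (inj₂ (refl , _)) = ≤-refl

C-grows : ∀ v₀ v k c j → C v₀ c j ≤ C v₀ ((v , k) ∷ c) j
C-grows v₀ v k c j with vstep v₀ v k c
... | va _ _ ec = ≤-reflexive (sym (ec j))
... | vc _ _ ec = ≗⊕-≤ ec j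

-- The box added first has the least entry, lies in column 0, and is refused by A if that entry is
-- at most `v₀`.
C-pos : ∀ {v₀ c} → Valid c → Any (λ b → proj₁ b ≤ v₀) c → 0 < C v₀ c 0
C-pos {v₀} {(v , k) ∷ c} (cons _ _ valid) (there small) = <-≤-trans (C-pos valid small) (C-grows v₀ v k c 0)
C-pos {v₀} {(v , k) ∷ []} (cons _ _ _) (here v≤) with vstep v₀ v k []
... | va lt _ _ = contradiction v≤ (<⇒≱ lt)
... | vc _ _ ec = subst (0 <_) (sym (≗⊕-at ec)) (s≤s z≤n)
C-pos {v₀} {(v , k) ∷ (v′ , k′) ∷ c} valid@(cons _ _ valid′) (here v≤) with valid-head valid
... | v′≤v ∷ _ = <-≤-trans (C-pos valid′ (here (≤-trans v′≤v v≤))) (C-grows v₀ v k ((v′ , k′) ∷ c) 0)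

-- Empty blocks and column inequalities.

≗⊕-mono : ∀ {f f′ g g′ : ℕ → ℕ} {j} → f′ ≗ f ⊕ j → g′ ≗ g ⊕ j → ∀ k → f k ≤ g k → f′ k ≤ g′ k
≗⊕-mono {f} {g = g} {j = j} ef eg k le with k ≟ j
... | yes refl = subst₂ _≤_ (sym (≗⊕-at ef)) (sym (≗⊕-at eg)) (s≤s le)
... | no k≢j   = subst₂ _≤_ (sym (≗⊕-off ef k≢j)) (sym (≗⊕-off eg k≢j)) le

-- Suppose C grows in column `h` and A of the recording tableau does not. Column 0 is excluded by
-- `t₀ < t`. For `h = suc g` the refusal means b g ≤ b h, and c h < c g ≤ b g ≤ b h leaves room for
-- one more.
block-keeps : ∀ {t₀ t h a c a′ c′ b d b′ d′} → t₀ < t → Horiz h a c a′ c′ → VStep t₀ t h b d b′ d′ →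
              (∀ k → c k ≤ b k) → ∀ k → c′ k ≤ b′ k
block-keeps {b = b} {b′ = b′} lt (up-a _ ec _ _) vs c≤b k =
  ≤-trans (≤-reflexive (ec k)) (≤-trans (c≤b k) (grow vs))
  where
  grow : ∀ {d d′ t₀ t h} → VStep t₀ t h b d b′ d′ → b k ≤ b′ k
  grow (va _ eb _) = ≗⊕-≤ eb k
  grow (vc _ eb _) = ≤-reflexive (sym (eb k))
block-keeps lt (up-c _ ec _) (va _ eb _) c≤b k = ≗⊕-mono ec eb k (c≤b k)
block-keeps {h = zero} lt (up-c _ _ _) (vc ¬can _ _) c≤b k = contradiction lt ¬can
block-keeps {h = suc g} {c = c} lt (up-c _ ec dc) (vc ¬can eb _) c≤b k with k ≟ suc g
... | yes refl = subst₂ _≤_ (sym (≗⊕-at ec)) (sym (eb (suc g)))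
                   (≤-trans dc (≤-trans (c≤b g) (≮⇒≥ ¬can)))
... | no k≢    = subst₂ _≤_ (sym (≗⊕-off ec k≢)) (sym (eb k)) (c≤b k)

-- The danger is that `b` grows exactly at the witness `h` while `c` does not. Then c h = c (h + 1)
-- and b (h + 1) ≤ b h, so `suc h` is a new witness.
block-fails : ∀ {t₀ t h a c a′ c′ b d b′ d′} → Antitone b → Horiz h a c a′ c′ → VStep t₀ t h b d b′ d′ →
              ∃[ k ] b k < c k → ∃[ k ] b′ k < c′ k
block-fails anti (up-a _ ec _ _) (vc _ eb _) (k , lt) = k , subst₂ _<_ (sym (eb k)) (sym (ec k)) lt
block-fails {h = h} {c = c} {b = b} anti (up-a _ ec _ ch) (va _ eb _) (k , lt) with k ≟ h
... | no k≢h   = k , subst₂ _<_ (sym (≗⊕-off eb k≢h)) (sym (ec k)) lt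
... | yes refl = suc h , subst₂ _<_ (sym (≗⊕-off {k = suc h} eb 1+n≢n)) (sym (ec (suc h)))
                           (≤-<-trans (anti h) (subst (b h <_) ch lt))
block-fails anti (up-c _ ec _) (vc _ eb _) (k , lt) =
  k , subst (_< _) (sym (eb k)) (<-≤-trans lt (≗⊕-≤ ec k))
block-fails {h = h} anti (up-c _ ec _) (va _ eb _) (k , lt) with k ≟ h
... | yes refl = k , subst₂ _<_ (sym (≗⊕-at eb)) (sym (≗⊕-at ec)) (s≤s lt)
... | no k≢h   = k , subst₂ _<_ (sym (≗⊕-off eb k≢h)) (sym (≗⊕-off ec k≢h)) lt

InBlock : ℕ → ℕ → Biletter → Set
InBlock t u b = t < proj₁ b × u < proj₂ b

vstep-cong : ∀ {v₀ v j j′ a c a′ c′} → j ≡ j′ → VStep v₀ v j a c a′ c′ → VStep v₀ v j′ a c a′ c′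
vstep-cong refl vs = vs

-- The tops are sorted: once the first letter has `j > t`, so do all the others, and emptiness of
-- the block bounds every `i` by `u`, which makes C zero.
block-empty⇒ : ∀ {n w p q} t u → Biword n w → Rsk n w p q → All (λ b → ¬ InBlock t u b) w →
               ∀ k → C (n ∸ u) p k ≤ A (n ∸ t) q k
block-empty⇒ t u _ [] _ k = z≤n
block-empty⇒ {n} t u bw@(((_ , j≤n) , _) ∷ ranges , lex) rs@(step {j} {i} {w} {p} {p′} {q} {h} r ins) (e ∷ es)
  with j ≤? t
... | yes j≤t with rsk-valid (ranges , Linked.tail lex) r
...   | vp , vq , eq = block-keeps (cmpl-> j≤n j≤t) (ins-horiz (n ∸ u) vp ins)
                         (vstep-cong (sym (eq h)) (vstep (n ∸ t) (cmpl n j) h q))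
                         (block-empty⇒ t u (ranges , Linked.tail lex) r es)
block-empty⇒ {n} t u bw@(range ∷ ranges , lex) rs@(step {j} {i} {w} {p} {p′} {q} {h} r ins) (e ∷ es)
  | no j≰t = λ k → ≤-trans (≤-reflexive (C-zero (proj₁ (rsk-valid bw rs))
                     (rsk-allP {P = n ∸ u <_} (All.zipWith large
                        (range ∷ ranges , All.zip (≤-refl ∷ lex-tops lex , e ∷ es))) rs) k)) z≤n
  where
  large : ∀ {b} → (InRange n (proj₁ b) × InRange n (proj₂ b)) × (j ≤ proj₁ b × ¬ InBlock t u b) →
          n ∸ u < cmpl n (proj₂ b)
  large ((_ , (_ , i≤n)) , (j≤j′ , ¬in)) =
    cmpl-> i≤n (≮⇒≥ (λ u<i → ¬in (<-≤-trans (≰⇒> j≰t) j≤j′ , u<i)))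

-- If the first letter has `j > t`, all entries of Q are at most the threshold and A is zero, while
-- the letter in the block makes C positive. A letter with `j ≤ t` is outside the block and leaves
-- the failure intact.
block-nonempty⇒ : ∀ {n w p q} t u → Biword n w → Rsk n w p q → Any (InBlock t u) w →
                  ∃[ k ] A (n ∸ t) q k < C (n ∸ u) p k
block-nonempty⇒ {n} t u bw@(_ ∷ ranges , lex) rs@(step {j} {i} {w} {p} {p′} {q} {h} r ins) bad
  with j ≤? t | bad
... | yes j≤t | here (t<j , _) = contradiction j≤t (<⇒≱ t<j)
... | yes j≤t | there bad′ with rsk-valid (ranges , Linked.tail lex) r
...   | vp , vq , eq = block-fails (A-antitone (n ∸ t) q) (ins-horiz (n ∸ u) vp ins)
                         (vstep-cong (sym (eq h)) (vstep (n ∸ t) (cmpl n j) h q))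
                         (block-nonempty⇒ t u (ranges , Linked.tail lex) r bad′)
block-nonempty⇒ {n} t u bw@(_ ∷ ranges , lex) rs@(step {j} {i} {w} {p} {p′} {q} {h} r ins) bad
  | no j≰t | _ = 0 , subst (_< C (n ∸ u) p′ 0)
      (sym (A-zero (rsk-allQ {P = _≤ n ∸ t} (All.map (λ j≤j′ → cmpl-≤ (<-≤-trans (≰⇒> j≰t) j≤j′))
                                  (≤-refl ∷ lex-tops lex)) rs) 0))
      (C-pos (proj₁ (rsk-valid bw rs)) (rsk-anyP {P = _≤ n ∸ u} (small bad) rs))
  where
  small : ∀ {w} → Any (InBlock t u) w → Any (λ b → cmpl n (proj₂ b) ≤ n ∸ u) w
  small (here (_ , u<i)) = here (cmpl-≤ u<i)
  small (there bad)      = there (small bad)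

-- Agreement of chains with the tableau algorithm.

toTab : Chain → Tableau
toTab []            = []
toTab ((v , k) ∷ c) = addAt k v (toTab c)

<ᵇ-true : ∀ {m n} → m < n → (m <ᵇ n) ≡ true
<ᵇ-true {m} {n} m<n with m <ᵇ n | <⇒<ᵇ m<n
... | true | _ = refl

<ᵇ-false : ∀ {m n} → n ≤ m → (m <ᵇ n) ≡ false
<ᵇ-false {m} {n} n≤m with m <ᵇ n in eq
... | false = refl
... | true  = contradiction n≤m (<⇒≱ (<ᵇ⇒< m n (subst T (sym eq) tt)))

≤ᵇ-true : ∀ {m n} → m ≤ n → (m ≤ᵇ n) ≡ true
≤ᵇ-true {m} {n} m≤n with m ≤ᵇ n | ≤⇒≤ᵇ m≤n
... | true | _ = refl

≤ᵇ-false : ∀ {m n} → n < m → (m ≤ᵇ n) ≡ false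
≤ᵇ-false {m} {n} n<m with m ≤ᵇ n in eq
... | false = refl
... | true  = contradiction n<m (≤⇒≯ (≤ᵇ⇒≤ m n (subst T (sym eq) tt)))

rowIns-append : ∀ {x row} → All (_≤ x) row → rowIns x row ≡ (nothing , row ++ x ∷ [])
rowIns-append [] = refl
rowIns-append {x} {y ∷ row} (y≤x ∷ ys) rewrite <ᵇ-false y≤x | rowIns-append ys = refl

insertP-append : ∀ {x T} → All (All (_≤ x)) T → insertP x T ≡ (addAt 0 x T , 0)
insertP-append [] = refl
insertP-append (ys ∷ _) rewrite rowIns-append ys = refl

rowIns-nothing : ∀ {x v row row′} → x < v → rowIns x row ≡ (nothing , row′) →
                 rowIns x (row ++ v ∷ []) ≡ (just v , row′)
rowIns-nothing {row = []} x<v refl rewrite <ᵇ-true x<v = refl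
rowIns-nothing {x} {v} {row = y ∷ row} x<v eq with x <ᵇ y
... | true  = contradiction (cong proj₁ eq) (λ ())
... | false with rowIns x row in eq′
...   | nothing , row″ rewrite rowIns-nothing {v = v} {row} x<v eq′ = cong (just v ,_) (cong proj₂ eq)
...   | just _ , _     = contradiction (cong proj₁ eq) (λ ())

rowIns-just : ∀ {x v row row′ y} → rowIns x row ≡ (just y , row′) →
              rowIns x (row ++ v ∷ []) ≡ (just y , row′ ++ v ∷ [])
rowIns-just {row = []} ()
rowIns-just {x} {v} {row = z ∷ row} eq with x <ᵇ z
... | true  with refl ← eq = refl
... | false with rowIns x row in eq′
...   | just _ , row″ with refl ← eq rewrite rowIns-just {v = v} {row} eq′ = refl
...   | nothing , _   = contradiction (cong proj₁ eq) (λ ())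

rowIns-bumped : ∀ {x row row′ y} {P : ℕ → Set} → All P row → rowIns x row ≡ (just y , row′) → P y
rowIns-bumped [] ()
rowIns-bumped {x} {z ∷ row} (pz ∷ ps) eq with x <ᵇ z
... | true  with refl ← eq = pz
... | false with rowIns x row in eq′
...   | just _ , row″ with refl ← eq = rowIns-bumped {row = row} ps eq′
...   | nothing , _   = contradiction (cong proj₁ eq) (λ ())

-- Whatever is bumped out of a row under `i` is smaller than `v`; so it either displaces an earlier
-- entry of row `i` or displaces `v`, which is then appended to row `suc i`.
data Fits (v : ℕ) : ℕ → Tableau → Set where
  here  : ∀ {T} → All (All (_≤ v)) T → Fits v 0 T
  there : ∀ {i row rows} → All (_< v) row → Fits v i rows → Fits v (suc i) (row ∷ rows)

insertP-keep : ∀ {x v i T T′ k} → Fits v i T → x < v → insertP x T ≡ (T′ , k) → k ≢ i →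
               insertP x (addAt i v T) ≡ (addAt i v T′ , k)
insertP-keep {T = []} (here _) x<v refl k≢i = contradiction refl k≢i
insertP-keep {x} {v} {T = row ∷ rows} (here _) x<v eq k≢i with rowIns x row in eq′
... | nothing , row′ with refl ← eq = contradiction refl k≢i
... | just y , row′  with refl ← eq rewrite rowIns-just {v = v} {row} eq′ = refl
insertP-keep {x} {T = row ∷ rows} (there ps fits) x<v eq k≢i with rowIns x row in eq′
... | nothing , row′ with refl ← eq = refl
... | just y , row′  with refl ← eq
  rewrite insertP-keep fits (rowIns-bumped {row = row} ps eq′) refl (λ e → k≢i (cong suc e)) = refl

insertP-bump : ∀ {x v i T T′} → Fits v i T → x < v → insertP x T ≡ (T′ , i) →
               insertP x (addAt i v T) ≡ (addAt (suc i) v T′ , suc i)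
insertP-bump {T = []} (here _) x<v refl rewrite <ᵇ-true x<v = refl
insertP-bump {x} {v} {T = row ∷ rows} (here (_ ∷ small)) x<v eq with rowIns x row in eq′
... | nothing , row′ with refl ← eq rewrite rowIns-nothing {v = v} {row} x<v eq′ | insertP-append small = refl
... | just y , row′  = contradiction (cong proj₂ eq) (λ ())
insertP-bump {x} {T = row ∷ rows} (there ps fits) x<v eq with rowIns x row in eq′
... | nothing , row′ = contradiction (cong proj₂ eq) (λ ())
... | just y , row′  with refl ← eq
  rewrite insertP-bump fits (rowIns-bumped {row = row} ps eq′) refl = refl

rowLen : Tableau → ℕ → ℕ
rowLen []           _       = 0
rowLen (row ∷ rows) zero    = length row
rowLen (row ∷ rows) (suc i) = rowLen rows i

rowLen-pos : ∀ T {i m} → m < rowLen T i → i < length T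
rowLen-pos (row ∷ rows) {zero}  lt = s≤s z≤n
rowLen-pos (row ∷ rows) {suc i} lt = s≤s (rowLen-pos rows lt)

length-snoc : ∀ {X : Set} (xs : List X) x → length (xs ++ x ∷ []) ≡ suc (length xs)
length-snoc xs x = trans (length-++ xs) (+-comm (length xs) 1)

rowLen-addAt-at : ∀ {v} T i → i ≤ length T → rowLen (addAt i v T) i ≡ suc (rowLen T i)
rowLen-addAt-at [] zero _ = refl
rowLen-addAt-at (row ∷ rows) zero _ = length-snoc row _
rowLen-addAt-at (row ∷ rows) (suc i) (s≤s le) = rowLen-addAt-at rows i le

rowLen-addAt-off : ∀ {v} T i k → i ≤ length T → k ≢ i → rowLen (addAt i v T) k ≡ rowLen T k
rowLen-addAt-off [] zero zero _ k≢i = contradiction refl k≢i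
rowLen-addAt-off [] zero (suc k) _ k≢i = refl
rowLen-addAt-off (row ∷ rows) zero zero _ k≢i = contradiction refl k≢i
rowLen-addAt-off (row ∷ rows) zero (suc k) _ k≢i = refl
rowLen-addAt-off (row ∷ rows) (suc i) zero _ k≢i = refl
rowLen-addAt-off (row ∷ rows) (suc i) (suc k) (s≤s le) k≢i = rowLen-addAt-off rows i k le (λ e → k≢i (cong suc e))

toTab-len : ∀ {c} → Valid c → rowLen (toTab c) ≗ len c
toTab-height : ∀ {c k} → Valid c → Desc (len c) k → k ≤ length (toTab c)

toTab-len [] i = refl
toTab-len {(v , k) ∷ c} (cons d _ valid) i with i ≟ k
... | yes refl = trans (rowLen-addAt-at (toTab c) k (toTab-height valid d)) (cong suc (toTab-len valid k))
... | no i≢k   = trans (rowLen-addAt-off (toTab c) k i (toTab-height valid d) i≢k) (toTab-len valid i)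

toTab-height {k = zero} _ _ = z≤n
toTab-height {c} {suc k} valid d = rowLen-pos (toTab c) (subst (len c (suc k) <_) (sym (toTab-len valid k)) d)

addAt-all : ∀ {P : ℕ → Set} {v} i T → P v → All (All P) T → All (All P) (addAt i v T)
addAt-all zero    []           pv ps       = (pv ∷ []) ∷ []
addAt-all (suc i) []           pv ps       = (pv ∷ []) ∷ []
addAt-all zero    (row ∷ rows) pv (p ∷ ps) = All.++⁺ p (pv ∷ []) ∷ ps
addAt-all (suc i) (row ∷ rows) pv (p ∷ ps) = p ∷ addAt-all i rows pv ps

toTab-all : ∀ {P : ℕ → Set} {c} → All (λ b → P (proj₁ b)) c → All (All P) (toTab c)
toTab-all [] = []
toTab-all {c = (v , k) ∷ c} (p ∷ ps) = addAt-all k (toTab c) p (toTab-all ps)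

fits-strict : ∀ {v} i {T} → All (All (_< v)) T → i ≤ length T → Fits v i T
fits-strict zero    ps       _        = here (All.map (All.map <⇒≤) ps)
fits-strict (suc i) (p ∷ ps) (s≤s le) = there p (fits-strict i ps le)

fits-all : ∀ {v i T} → Fits v i T → All (All (_≤ v)) T
fits-all (here ps)      = ps
fits-all (there p fits) = All.map <⇒≤ p ∷ fits-all fits

fits-addAt : ∀ {v i′ i T} → i′ ≤ i → Fits v i T → Fits v i′ (addAt i v T)
fits-addAt {i = i} {T} z≤n fits = here (addAt-all i T ≤-refl (fits-all fits))
fits-addAt (s≤s le) (there p fits) = there p (fits-addAt le fits)

valid-fits : ∀ {v k c} → Valid ((v , k) ∷ c) → Fits v k (toTab c)
valid-fits {k = zero}  (cons d b []) = here []
valid-fits {k = suc k} (cons () b [])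
valid-fits {k = k} (cons d (inj₁ v′<v) valid@(cons _ _ _)) =
  fits-strict k (toTab-all (v′<v ∷ All.map (λ le → ≤-<-trans le v′<v) (valid-head valid))) (toTab-height valid d)
valid-fits {k = k} (cons d (inj₂ (refl , k≤k′)) valid@(cons _ _ _)) = fits-addAt k≤k′ (valid-fits valid)

ins-insertP : ∀ {x c c′ k} → Valid c → Ins x c c′ k → insertP x (toTab c) ≡ (toTab c′ , k)
ins-insertP _ nil = refl
ins-insertP valid (top v≤x) =
  insertP-append (toTab-all (v≤x ∷ All.map (λ le → ≤-trans le v≤x) (valid-head valid)))
ins-insertP valid@(cons _ _ valid′) (bump x<v ins) =
  insertP-bump (valid-fits valid) x<v (ins-insertP valid′ ins)
ins-insertP valid@(cons _ _ valid′) (keep x<v ins k≢i) =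
  insertP-keep (valid-fits valid) x<v (ins-insertP valid′ ins) k≢i

rsk-correct : ∀ {n w p q} → Biword n w → Rsk n w p q → RSK (flipBiword n w) ≡ (toTab p , toTab q)
rsk-correct {n} {w} bw r = trans (reverse-foldl rskStep ([] , []) (map (λ b → cmpl n (proj₁ b) , cmpl n (proj₂ b)) w)) (go bw r)
  where
  go : ∀ {w p q} → Biword n w → Rsk n w p q →
       foldr (λ b s → rskStep s b) ([] , []) (map (λ b → cmpl n (proj₁ b) , cmpl n (proj₂ b)) w) ≡ (toTab p , toTab q)
  go _ [] = refl
  go (_ ∷ ranges , lex) (step r ins)
    rewrite go (ranges , Linked.tail lex) r
          | ins-insertP (proj₁ (rsk-valid (ranges , Linked.tail lex) r)) ins = refl

-- Columns of a chain.

snocIf : {P : Set} → Dec P → List ℕ → ℕ → List ℕ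
snocIf (yes _) xs v = xs ++ v ∷ []
snocIf (no _)  xs v = xs

cols : Chain → ℕ → List ℕ
cols []            j = []
cols ((v , k) ∷ c) j = snocIf (j ≟ len c k) (cols c j) v

lookupM-snoc-at : ∀ (row : List ℕ) v → lookupM (row ++ v ∷ []) (length row) ≡ just v
lookupM-snoc-at []        v = refl
lookupM-snoc-at (_ ∷ row) v = lookupM-snoc-at row v

lookupM-snoc-off : ∀ (row : List ℕ) v j → j ≢ length row → lookupM (row ++ v ∷ []) j ≡ lookupM row j
lookupM-snoc-off []        v zero    j≢ = contradiction refl j≢
lookupM-snoc-off []        v (suc j) j≢ = refl
lookupM-snoc-off (_ ∷ row) v zero    j≢ = refl
lookupM-snoc-off (_ ∷ row) v (suc j) j≢ = lookupM-snoc-off row v j (λ e → j≢ (cong suc e))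

lookupM-beyond : ∀ (row : List ℕ) j → length row ≤ j → lookupM row j ≡ nothing
lookupM-beyond []        j       _        = refl
lookupM-beyond (_ ∷ row) (suc j) (s≤s le) = lookupM-beyond row j le

columnOf-empty : ∀ T j → (∀ i → rowLen T i ≤ j) → columnOf T j ≡ []
columnOf-empty [] j _ = refl
columnOf-empty (row ∷ rows) j le rewrite lookupM-beyond row j (le 0) = columnOf-empty rows j (λ i → le (suc i))

columnOf-addAt-off : ∀ {v} T i j → i ≤ length T → j ≢ rowLen T i → columnOf (addAt i v T) j ≡ columnOf T j
columnOf-addAt-off [] zero zero _ j≢ = contradiction refl j≢
columnOf-addAt-off [] zero (suc j) _ j≢ = refl
columnOf-addAt-off {v} (row ∷ rows) zero j _ j≢ rewrite lookupM-snoc-off row v j j≢ = refl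
columnOf-addAt-off (row ∷ rows) (suc i) j (s≤s le) j≢ with lookupM row j
... | just x  = cong (x ∷_) (columnOf-addAt-off rows i j le j≢)
... | nothing = columnOf-addAt-off rows i j le j≢

columnOf-addAt-at : ∀ {v} T i → i ≤ length T → Antitone (rowLen T) →
                    columnOf (addAt i v T) (rowLen T i) ≡ columnOf T (rowLen T i) ++ v ∷ []
columnOf-addAt-at [] zero _ _ = refl
columnOf-addAt-at {v} (row ∷ rows) zero _ anti
  rewrite lookupM-snoc-at row v | lookupM-beyond row (length row) ≤-refl
        | columnOf-empty rows (length row) (λ i → antitone-≤ anti {0} {suc i} z≤n) = refl
columnOf-addAt-at (row ∷ rows) (suc i) (s≤s le) anti with lookupM row (rowLen rows i)
... | just x  = cong (x ∷_) (columnOf-addAt-at rows i le (λ j → anti (suc j)))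
... | nothing = columnOf-addAt-at rows i le (λ j → anti (suc j))

columnOf-toTab : ∀ {c} → Valid c → ∀ j → columnOf (toTab c) j ≡ cols c j
columnOf-toTab [] j = refl
columnOf-toTab {(v , k) ∷ c} (cons d _ valid) j with j ≟ len c k
... | yes refl = trans (subst (λ m → columnOf (addAt k v (toTab c)) m ≡ columnOf (toTab c) m ++ v ∷ []) (toTab-len valid k)
                   (columnOf-addAt-at (toTab c) k (toTab-height valid d) (antitone-≗ (toTab-len valid) (len-antitone valid))))
                   (cong (_++ v ∷ []) (columnOf-toTab valid j))
... | no j≢    = trans (columnOf-addAt-off (toTab c) k j (toTab-height valid d) (λ e → j≢ (trans e (toTab-len valid k))))
                   (columnOf-toTab valid j)

cols-all : ∀ {P : ℕ → Set} {c} → All (λ b → P (proj₁ b)) c → ∀ j → All P (cols c j)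
cols-all [] j = []
cols-all {c = (v , k) ∷ c} (p ∷ ps) j with j ≟ len c k
... | yes _ = All.++⁺ (cols-all ps j) (p ∷ [])
... | no _  = cols-all ps j

-- Equal entries are added from left to right, so earlier copies of `v` lie strictly to the left of
-- column `len c k`. This makes the new SSAF entry strictly smaller than all entries from its row
-- upward.
cols-strict : ∀ {v k c j} → Valid c → Before v k c → len c k ≤ j → All (_< v) (cols c j)
cols-strict [] _ _ = []
cols-strict {j = j} valid@(cons _ _ _) (inj₁ v′<v) _ =
  cols-all (v′<v ∷ All.map (λ le → ≤-<-trans le v′<v) (valid-head valid)) j
cols-strict {v} {k} {(_ , k′) ∷ c} {j} valid@(cons d b valid′) (inj₂ (refl , k≤k′)) le with j ≟ len c k′
... | yes refl = contradiction (antitone-≤ (len-antitone valid) k≤k′)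
                   (<⇒≱ (subst (len ((v , k′) ∷ c) k <_) (sym (⊕-at (len c) k′)) (s≤s le)))
... | no _     = cols-strict valid′ (before-≤ c b) (≤-trans (⊕-≤ (len c) k′ k) le)
  where
  before-≤ : ∀ c → Before v k′ c → Before v k c
  before-≤ []      _                = tt
  before-≤ (_ ∷ _) (inj₁ lt)        = inj₁ lt
  before-≤ (_ ∷ _) (inj₂ (e , k′≤)) = inj₂ (e , ≤-trans k≤k′ k′≤)

-- The filling grown one box at a time.

bit : Maybe ℕ → ℕ
bit (just _) = 1
bit nothing  = 0

occ : Row → ℕ → ℕ
occ []      _       = 0
occ (x ∷ r) zero    = 0
occ (x ∷ r) (suc u) = bit x + occ r u

-- Over a P N: the row N sits on top of P, and the entries of P are at least a.
data Over (a : ℕ) : Row → Row → Set where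
  []   : Over a [] []
  both : ∀ {b c P N} → a ≤ b → Over a P N → Over a (just b ∷ P) (just c ∷ N)
  free : ∀ {b P N} → a ≤ b → Over a P N → Over a (just b ∷ P) (nothing ∷ N)
  void : ∀ {P N} → Over a P N → Over a (nothing ∷ P) (nothing ∷ N)

over-occ : ∀ {a P N} → Over a P N → ∀ u → occ N u ≤ occ P u
over-occ []           u       = z≤n
over-occ (both _ ov)  zero    = z≤n
over-occ (both _ ov)  (suc u) = s≤s (over-occ ov u)
over-occ (free _ ov) zero    = z≤n
over-occ (free _ ov) (suc u) = m≤n⇒m≤1+n (over-occ ov u)
over-occ (void ov)    zero    = z≤n
over-occ (void ov)    (suc u) = over-occ ov u

over-occupied : ∀ {a P N} → Over a P N → ∀ q → occupied N q ≡ true → occupied P q ≡ true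
over-occupied (both _ ov)  zero    _ = refl
over-occupied (both _ ov)  (suc q) o = over-occupied ov q o
over-occupied (free _ ov) (suc q) o = over-occupied ov q o
over-occupied (void ov)    (suc q) o = over-occupied ov q o

place-over : ∀ {a P N} → Over a P N → Over a P (placeLeft a P N)
place-over [] = []
place-over (both le ov) = both le (place-over ov)
place-over (free le ov) rewrite ≤ᵇ-true le = both le ov
place-over (void ov) = void (place-over ov)

place-occ-grows : ∀ {a P N} → Over a P N → ∀ u → occ N u < occ P u → occ (placeLeft a P N) u ≡ suc (occ N u)
place-occ-grows (both le ov) (suc u) (s≤s lt) = cong suc (place-occ-grows ov u lt)
place-occ-grows (free le ov) (suc u) lt rewrite ≤ᵇ-true le = refl
place-occ-grows (void ov) (suc u) lt = place-occ-grows ov u lt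

place-occ-same : ∀ {a P N} → Over a P N → ∀ u → ¬ (occ N u < occ P u) → occ (placeLeft a P N) u ≡ occ N u
place-occ-same [] u _ = refl
place-occ-same (both le ov) zero _ = refl
place-occ-same (both le ov) (suc u) ¬lt = cong suc (place-occ-same ov u (λ lt → ¬lt (s≤s lt)))
place-occ-same (free le ov) zero _ rewrite ≤ᵇ-true le = refl
place-occ-same (free le ov) (suc u) ¬lt = contradiction (s≤s (over-occ ov u)) ¬lt
place-occ-same (void ov) zero _ = refl
place-occ-same (void ov) (suc u) ¬lt = place-occ-same ov u ¬lt

data Grow (a : ℕ) : Row → Row → Set where
  []   : Grow a [] []
  keep : ∀ {x N N′} → Grow a N N′ → Grow a (x ∷ N) (x ∷ N′)
  fill : ∀ {N N′} → Grow a N N′ → Grow a (nothing ∷ N) (just a ∷ N′)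

grow-refl : ∀ {a} N → Grow a N N
grow-refl []      = []
grow-refl (x ∷ N) = keep (grow-refl N)

place-grow : ∀ {a P N} → Over a P N → Grow a N (placeLeft a P N)
place-grow [] = []
place-grow (both le ov) = keep (place-grow ov)
place-grow {N = _ ∷ N} (free le ov) rewrite ≤ᵇ-true le = fill (grow-refl N)
place-grow (void ov) = keep (place-grow ov)

grow-over : ∀ {a N N′ M} → Grow a N N′ → Over a N M → Over a N′ M
grow-over []       []            = []
grow-over (keep g) (both le ov)  = both le (grow-over g ov)
grow-over (keep g) (free le ov) = free le (grow-over g ov)
grow-over (keep g) (void ov)     = void (grow-over g ov)
grow-over (fill g) (void ov)     = free ≤-refl (grow-over g ov)

-- An entry `x > a` cannot sit on `a`, so the newly filled cell still acts as an empty one.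
grow-place : ∀ {a x N N′} → Grow a N N′ → a < x → ∀ M → placeLeft x N′ M ≡ placeLeft x N M
grow-place [] a<x M = refl
grow-place (keep {just b} g) a<x [] = refl
grow-place (keep {nothing} g) a<x [] = refl
grow-place {x = x} (keep {just b} g) a<x (nothing ∷ M) with x ≤ᵇ b
... | true  = refl
... | false = cong (nothing ∷_) (grow-place g a<x M)
grow-place (keep {just b} g) a<x (just c ∷ M) = cong (just c ∷_) (grow-place g a<x M)
grow-place (keep {nothing} g) a<x (m ∷ M) = cong (m ∷_) (grow-place g a<x M)
grow-place (fill g) a<x [] = refl
grow-place (fill g) a<x (nothing ∷ M) rewrite ≤ᵇ-false a<x = cong (nothing ∷_) (grow-place g a<x M)
grow-place (fill g) a<x (just c ∷ M) = cong (just c ∷_) (grow-place g a<x M)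

grow-nextRow : ∀ {a n N N′ col} → Grow a N N′ → All (a <_) col → nextRow n N′ col ≡ nextRow n N col
grow-nextRow {a} {n} {N} {N′} g = go (replicate n nothing)
  where
  go : ∀ {col} M → All (a <_) col → foldl (λ acc x → placeLeft x N′ acc) M col ≡ foldl (λ acc x → placeLeft x N acc) M col
  go M [] = refl
  go {x ∷ col} M (a<x ∷ ps) rewrite grow-place g a<x M = go (placeLeft x N M) ps

over-weaken : ∀ {a b P N} → a ≤ b → Over b P N → Over a P N
over-weaken le []            = []
over-weaken le (both le′ ov)  = both (≤-trans le le′) (over-weaken le ov)
over-weaken le (free le′ ov) = free (≤-trans le le′) (over-weaken le ov)
over-weaken le (void ov)     = void (over-weaken le ov)

-- Base m r: the entries of r equal their column, the first cell of r being in
-- column m + 1.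
data Base (m : ℕ) : Row → Set where
  []   : Base m []
  put  : ∀ {r} → Base (suc m) r → Base m (just (suc m) ∷ r)
  skip : ∀ {r} → Base (suc m) r → Base m (nothing ∷ r)

base-setAt : ∀ m q {r} → Base m r → Base m (setAt q (just (suc (m + q))) r)
base-setAt m q [] = []
base-setAt m zero (put b) rewrite +-identityʳ m = put b
base-setAt m zero (skip b) rewrite +-identityʳ m = put b
base-setAt m (suc q) (put b) rewrite +-suc m q = put (base-setAt (suc m) q b)
base-setAt m (suc q) (skip b) rewrite +-suc m q = skip (base-setAt (suc m) q b)

Entries : (ℕ → Set) → Row → Set
Entries P r = ∀ {b} → All (λ x → x ≡ just b → P b) r

data Hole : ℕ → Row → Set where
  here  : ∀ {r} → Hole 0 (nothing ∷ r)
  there : ∀ {q x r} → Hole q r → Hole (suc q) (x ∷ r)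

-- If occupied, cell `q` would hold its own column number, which is not among the strictly larger
-- entries.
base-hole : ∀ {m q r} → Base m r → Entries (suc (m + q) <_) r → q < length r → Hole q r
base-hole {m} {zero} (put b) es lt with es {suc m}
... | e ∷ _ = contradiction (e refl) (≤⇒≯ (s≤s (≤-reflexive (sym (+-identityʳ m)))))
base-hole {m} {zero} (skip b) es lt = here
base-hole {m} {suc q} {_ ∷ r} (put b) es (s≤s lt) =
  there (base-hole b (λ {x} → subst (λ z → All (λ y → y ≡ just x → suc z < x) r) (+-suc m q) (All.tail (es {x}))) lt)
base-hole {m} {suc q} {_ ∷ r} (skip b) es (s≤s lt) =
  there (base-hole b (λ {x} → subst (λ z → All (λ y → y ≡ just x → suc z < x) r) (+-suc m q) (All.tail (es {x}))) lt)

hole-grow : ∀ {a q r} → Hole q r → Grow a r (setAt q (just a) r)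
hole-grow (here {r}) = fill (grow-refl r)
hole-grow (there h)  = keep (hole-grow h)

hole-occ-grows : ∀ {a q r} → Hole q r → ∀ u → q < u → occ (setAt q (just a) r) u ≡ suc (occ r u)
hole-occ-grows here (suc u) _ = refl
hole-occ-grows {a} (there {x = x} h) (suc u) (s≤s lt) =
  trans (cong (bit x +_) (hole-occ-grows {a} h u lt)) (+-suc (bit x) _)

hole-occ-same : ∀ {a q r} → Hole q r → ∀ u → ¬ (q < u) → occ (setAt q (just a) r) u ≡ occ r u
hole-occ-same {a} {q} {r} h zero _ = trans (occ-zero (setAt q (just a) r)) (sym (occ-zero r))
  where
  occ-zero : ∀ r → occ r 0 ≡ 0
  occ-zero []      = refl
  occ-zero (_ ∷ _) = refl
hole-occ-same here (suc u) ¬lt = contradiction (s≤s z≤n) ¬lt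
hole-occ-same {a} (there {x = x} h) (suc u) ¬lt =
  cong (bit x +_) (hole-occ-same {a} h u (λ lt → ¬lt (s≤s lt)))

length-setAt : ∀ q {x : Maybe ℕ} r → length (setAt q x r) ≡ length r
length-setAt q       []      = refl
length-setAt zero    (_ ∷ r) = refl
length-setAt (suc q) (_ ∷ r) = cong suc (length-setAt q r)

setAt-entries : ∀ {P : ℕ → Set} {a} q r → P a → Entries P r → Entries P (setAt q (just a) r)
setAt-entries q       []      pa es = []
setAt-entries zero    (_ ∷ r) pa es {b} = (λ { refl → pa }) ∷ All.tail (es {b})
setAt-entries {P} (suc q) (_ ∷ r) pa es {b} =
  All.head (es {b}) ∷ setAt-entries {P} q r pa (λ {x} → All.tail (es {x})) {b}

firstRow-entries : ∀ {P : ℕ → Set} n {col} → All P col → Entries P (firstRow n col)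
firstRow-entries {P} n = go (replicate n nothing) (λ {b} → All.replicate⁺ n (λ ()))
  where
  go : ∀ {col} r → Entries P r → All P col → Entries P (foldl (λ acc a → setAt (a ∸ 1) (just a) acc) r col)
  go r es [] {b} = es {b}
  go r es (_∷_ {x = x} p ps) {b} = go _ (λ {y} → setAt-entries {P} (x ∸ 1) r p (λ {z} → es {z}) {y}) ps {b}

-- The rows of `ρ` as an infinite sequence, empty from some row on, so that adding a box changes no
-- number of rows.
rowF : ℕ → (ℕ → List ℕ) → ℕ → Row
rowF n f zero    = firstRow n (f 0)
rowF n f (suc j) = nextRow n (rowF n f j) (f (suc j))

rowF-cong : ∀ n {f g} → f ≗ g → rowF n f ≗ rowF n g
rowF-cong n f≗g zero    = cong (firstRow n) (f≗g 0)
rowF-cong n f≗g (suc j) = cong₂ (nextRow n) (rowF-cong n f≗g j) (f≗g (suc j))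

rows : ℕ → Chain → ℕ → Row
rows n c = rowF n (λ j → map (cmpl n) (cols c j))

placed : ℕ → ℕ → Chain → ℕ → Row
placed n a c zero    = setAt (a ∸ 1) (just a) (rows n c 0)
placed n a c (suc g) = placeLeft a (rows n c g) (rows n c (suc g))

-- The entry a = n + 1 - v of the last box is smaller than all entries above
-- its row, so it changes that row only.
module _ {n v k : ℕ} {c : Chain} where

  private
    a = cmpl n v
    R  = rows n c
    R′ = rows n ((v , k) ∷ c)

    cols-at : map (cmpl n) (cols ((v , k) ∷ c) (len c k)) ≡ map (cmpl n) (cols c (len c k)) ++ a ∷ []
    cols-at with len c k ≟ len c k
    ... | yes _  = map-++ (cmpl n) (cols c (len c k)) (v ∷ [])
    ... | no j≢j = contradiction refl j≢j

    cols-off : ∀ {j} → j ≢ len c k → map (cmpl n) (cols ((v , k) ∷ c) j) ≡ map (cmpl n) (cols c j)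
    cols-off {j} j≢ with j ≟ len c k
    ... | yes e = contradiction e j≢
    ... | no _  = refl

  rows-step : (∀ j → len c k ≤ j → All (a <_) (map (cmpl n) (cols c j))) →
              Grow a (R (len c k)) (placed n a c (len c k)) →
              ∀ j → (j ≡ len c k → R′ j ≡ placed n a c j) × (j ≢ len c k → R′ j ≡ R j)
  rows-step strict grow zero = hit , (λ j≢ → cong (firstRow n) (cols-off j≢))
    where
    hit : 0 ≡ len c k → R′ 0 ≡ placed n a c 0
    hit e = trans (cong (firstRow n) (subst (λ j → map (cmpl n) (cols ((v , k) ∷ c) j) ≡ map (cmpl n) (cols c j) ++ a ∷ []) (sym e) cols-at))
                 (foldl-++ (λ acc a → setAt (a ∸ 1) (just a) acc) (replicate n nothing) (map (cmpl n) (cols c 0)) (a ∷ []))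
  rows-step strict grow (suc j) = hit , off
    where
    IH = rows-step strict grow j
    hit : suc j ≡ len c k → R′ (suc j) ≡ placed n a c (suc j)
    hit e = trans (cong₂ (nextRow n) (proj₂ IH (λ e′ → 1+n≢n (trans e (sym e′))))
                   (subst (λ j → map (cmpl n) (cols ((v , k) ∷ c) j) ≡ map (cmpl n) (cols c j) ++ a ∷ []) (sym e) cols-at))
                 (foldl-++ (λ acc x → placeLeft x (R j) acc) (replicate n nothing) (map (cmpl n) (cols c (suc j))) (a ∷ []))
    off : suc j ≢ len c k → R′ (suc j) ≡ R (suc j)
    off j≢ with j ≟ len c k
    ... | no j≢′ = cong₂ (nextRow n) (proj₂ IH j≢′) (cols-off j≢)
    ... | yes e  = trans (cong₂ (nextRow n) (proj₁ IH e) (cols-off j≢))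
                     (grow-nextRow (subst (λ i → Grow a (R i) (placed n a c i)) (sym e) grow)
                        (strict (suc j) (subst (_≤ suc j) e (n≤1+n j))))

Within : ℕ → Chain → Set
Within n c = All (λ b → 1 ≤ proj₁ b × proj₁ b ≤ n) c

-- `count` is the aim: it identifies the greedy `A` with occupied cells of the filling. The other
-- fields carry its induction.
record SSAF (n : ℕ) (c : Chain) : Set where
  field
    base  : Base 0 (rows n c 0)
    width : length (rows n c 0) ≡ n
    over  : ∀ {a} → All (λ b → a ≤ cmpl n (proj₁ b)) c → ∀ j → Over a (rows n c j) (rows n c (suc j))
    count : ∀ u → u ≤ n → ∀ j → occ (rows n c j) u ≡ A (n ∸ u) c j

ssaf : ∀ {n c} → Valid c → Within n c → SSAF n c
ssaf {n} [] [] = record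
  { base = base-nothing n ; width = length-replicate n ; over = λ _ j → subst₂ (Over _) (sym (row j)) (sym (row (suc j))) (over-nothing n)
  ; count = λ u _ j → trans (cong (λ r → occ r u) (row j)) (occ-nothing n u) }
  where
  row : ∀ j → rows n [] j ≡ replicate n nothing
  row zero    = refl
  row (suc j) = refl
  base-nothing : ∀ {m} n → Base m (replicate n nothing)
  base-nothing zero    = []
  base-nothing (suc n) = skip (base-nothing n)
  over-nothing : ∀ {a} n → Over a (replicate n nothing) (replicate n nothing)
  over-nothing zero    = []
  over-nothing (suc n) = void (over-nothing n)
  occ-nothing : ∀ n u → occ (replicate n nothing) u ≡ 0
  occ-nothing zero    u       = refl
  occ-nothing (suc n) zero    = refl
  occ-nothing (suc n) (suc u) = occ-nothing n u
ssaf {n} {(v , k) ∷ c} valid₂@(cons d b valid) ((1≤v , v≤n) ∷ range) = record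
  { base = base′ ; width = width′ ; over = over′ ; count = count′ }
  where
  open SSAF (ssaf valid range)
  a = cmpl n v
  jj = len c k
  R  = rows n c
  R′ = rows n ((v , k) ∷ c)
  a≤ : All (λ b → a ≤ cmpl n (proj₁ b)) c
  a≤ = All.map (∸-monoʳ-≤ (suc n)) (valid-head valid₂)
  strict : ∀ j → jj ≤ j → All (a <_) (map (cmpl n) (cols c j))
  strict j le = All.map⁺ (All.map (λ v′<v → ∸-monoʳ-< v′<v (m≤n⇒m≤1+n v≤n)) (cols-strict valid b le))
  a-suc : a ≡ suc (a ∸ 1)
  a-suc = trans (+-∸-assoc 1 v≤n) (cong (λ z → suc (z ∸ 1)) (sym (+-∸-assoc 1 v≤n)))
  a-pred : a ∸ 1 ≡ n ∸ v
  a-pred = cong (_∸ 1) (+-∸-assoc 1 v≤n)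
  hole : 0 ≡ jj → Hole (a ∸ 1) (R 0)
  hole e = base-hole base (λ {x} → firstRow-entries {suc (a ∸ 1) <_} n
             (subst (λ z → All (z <_) (map (cmpl n) (cols c 0))) a-suc (strict 0 (≤-reflexive (sym e)))) {x})
             (subst₂ _<_ (sym a-pred) (sym width) (∸-monoʳ-< 1≤v v≤n))
  grow : ∀ j → j ≡ jj → Grow a (R j) (placed n a c j)
  grow zero    e = hole-grow (hole e)
  grow (suc g) e = place-grow (over a≤ g)
  st : ∀ j → (j ≡ jj → R′ j ≡ placed n a c j) × (j ≢ jj → R′ j ≡ R j)
  st = rows-step strict (grow jj refl)
  base′ : Base 0 (R′ 0)
  base′ = go (0 ≟ jj)
    where
    go : Dec (0 ≡ jj) → Base 0 (R′ 0)
    go (no 0≢) = subst (Base 0) (sym (proj₂ (st 0) 0≢)) base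
    go (yes e) = subst (Base 0) (sym (proj₁ (st 0) e))
                   (subst (λ z → Base 0 (setAt (a ∸ 1) (just z) (R 0))) (sym a-suc) (base-setAt 0 (a ∸ 1) base))
  width′ : length (R′ 0) ≡ n
  width′ = go (0 ≟ jj)
    where
    go : Dec (0 ≡ jj) → length (R′ 0) ≡ n
    go (no 0≢) = trans (cong length (proj₂ (st 0) 0≢)) width
    go (yes e) = trans (cong length (proj₁ (st 0) e)) (trans (length-setAt (a ∸ 1) (R 0)) width)
  over′ : ∀ {a′} → All (λ b → a′ ≤ cmpl n (proj₁ b)) ((v , k) ∷ c) → ∀ j → Over a′ (R′ j) (R′ (suc j))
  over′ (a′≤a ∷ _) j = over-weaken a′≤a (main (j ≟ jj) (suc j ≟ jj))
    where
    main : Dec (j ≡ jj) → Dec (suc j ≡ jj) → Over a (R′ j) (R′ (suc j))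
    main (yes e) (yes e′) = contradiction (trans e′ (sym e)) 1+n≢n
    main (yes e) (no j≢) = subst₂ (Over a) (sym (proj₁ (st j) e)) (sym (proj₂ (st (suc j)) j≢))
                             (grow-over (grow j e) (over a≤ j))
    main (no j≢) (yes e) = subst₂ (Over a) (sym (proj₂ (st j) j≢)) (sym (proj₁ (st (suc j)) e))
                             (place-over (over a≤ j))
    main (no j≢) (no j≢′) = subst₂ (Over a) (sym (proj₂ (st j) j≢)) (sym (proj₂ (st (suc j)) j≢′)) (over a≤ j)
  count′ : ∀ u → u ≤ n → ∀ j → occ (R′ j) u ≡ A (n ∸ u) ((v , k) ∷ c) j
  count′ u u≤n j = go (j ≟ jj) (vstep (n ∸ u) v k c)
    where
    -- The new first-row entry n + 1 - v occupies the cell with index n - v, which is among the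
    -- first `u` cells exactly when n - u < v.
    turn : n ∸ u < v → n ∸ v < u
    turn lt = ≰⇒> (λ u≤ → <⇒≱ lt (subst (_≤ n ∸ u) (m∸[m∸n]≡n v≤n) (∸-monoʳ-≤ n u≤)))
    turn′ : n ∸ v < u → n ∸ u < v
    turn′ lt = ≰⇒> (λ v≤ → <⇒≱ lt (subst (_≤ n ∸ v) (m∸[m∸n]≡n u≤n) (∸-monoʳ-≤ n v≤)))
    grows : ∀ j → j ≡ jj → Can (n ∸ u) v (A (n ∸ u) c) j → occ (placed n a c j) u ≡ suc (occ (R j) u)
    grows zero    e lt = hole-occ-grows {a} (hole e) u (subst (_< u) (sym a-pred) (turn lt))
    grows (suc g) e lt = place-occ-grows (over a≤ g) u
      (subst₂ _<_ (sym (count u u≤n (suc g))) (sym (count u u≤n g)) lt)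
    same : ∀ j → j ≡ jj → ¬ Can (n ∸ u) v (A (n ∸ u) c) j → occ (placed n a c j) u ≡ occ (R j) u
    same zero    e ¬lt = hole-occ-same {a} (hole e) u (λ lt → ¬lt (turn′ (subst (_< u) a-pred lt)))
    same (suc g) e ¬lt = place-occ-same (over a≤ g) u
      (λ lt → ¬lt (subst₂ _<_ (count u u≤n (suc g)) (count u u≤n g) lt))
    go : Dec (j ≡ jj) → VStep (n ∸ u) v jj (A (n ∸ u) c) (C (n ∸ u) c) (A (n ∸ u) ((v , k) ∷ c)) (C (n ∸ u) ((v , k) ∷ c)) →
         occ (R′ j) u ≡ A (n ∸ u) ((v , k) ∷ c) j
    go (no j≢) (va _ ea _) = trans (cong (λ r → occ r u) (proj₂ (st j) j≢)) (trans (count u u≤n j) (sym (≗⊕-off ea j≢)))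
    go (no j≢) (vc _ ea _) = trans (cong (λ r → occ r u) (proj₂ (st j) j≢)) (trans (count u u≤n j) (sym (ea j)))
    go (yes e) (va can ea _) = trans (cong (λ r → occ r u) (proj₁ (st j) e))
      (trans (grows j e (subst (Can _ v _) (sym e) can)) (trans (cong suc (count u u≤n j))
        (sym (subst (λ i → A (n ∸ u) ((v , k) ∷ c) i ≡ suc (A (n ∸ u) c i)) (sym e) (≗⊕-at ea)))))
    go (yes e) (vc ¬can ea _) = trans (cong (λ r → occ r u) (proj₁ (st j) e))
      (trans (same j e (subst (λ i → ¬ Can _ v _ i) (sym e) ¬can)) (trans (count u u≤n j) (sym (ea j))))

-- Prefix counts of the keys.

ind : ℕ → ℕ → ℕ
ind m x = sucIf (m ≤? x) 0

cnt : (ℕ → ℕ) → ℕ → ℕ → ℕ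
cnt f m zero    = 0
cnt f m (suc t) = cnt f m t + ind m (f t)

ind-yes : ∀ {m x} → m ≤ x → ind m x ≡ 1
ind-yes {m} {x} le with m ≤? x
... | yes _ = refl
... | no ¬le = contradiction le ¬le

ind-no : ∀ {m x} → x < m → ind m x ≡ 0
ind-no {m} {x} lt with m ≤? x
... | yes le = contradiction lt (≤⇒≯ le)
... | no _   = refl

boolBit : Bool → ℕ
boolBit true  = 1
boolBit false = 0

occ-suc : ∀ r u → occ r (suc u) ≡ occ r u + boolBit (occupied r u)
occ-suc [] u = refl
occ-suc (just x ∷ [])     zero = refl
occ-suc (just x ∷ _ ∷ _)  zero = refl
occ-suc (nothing ∷ [])    zero = refl
occ-suc (nothing ∷ _ ∷ _) zero = refl
occ-suc (x ∷ r) (suc u) = trans (cong (bit x +_) (occ-suc r u)) (sym (+-assoc (bit x) _ _))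

buildRows-applyUpTo : ∀ n {f g prev} → g 0 ≡ nextRow n prev (f 0) → (∀ j → g (suc j) ≡ nextRow n (g j) (f (suc j))) →
                      ∀ l → buildRows n prev (applyUpTo f l) ≡ applyUpTo g l
buildRows-applyUpTo n e0 es zero = refl
buildRows-applyUpTo n {f} {g} e0 es (suc l) = cong₂ _∷_ (sym e0)
  (subst (λ r → buildRows n r (applyUpTo (λ x → f (suc x)) l) ≡ applyUpTo (λ x → g (suc x)) l) e0
     (buildRows-applyUpTo n (es 0) (λ j → es (suc j)) l))

ρ-rows : ∀ n T → ρ n T ≡ applyUpTo (rowF n (columnOf T)) (rowLen T 0)
ρ-rows n [] = refl
ρ-rows n (row ∷ rs) rewrite map-upTo (columnOf (row ∷ rs)) (length row) with length row
... | zero  = refl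
... | suc l = cong (rowF n (columnOf (row ∷ rs)) 0 ∷_) (buildRows-applyUpTo n refl (λ _ → refl) l)

lookupM-map : ∀ (g : ℕ → ℕ) row j → lookupM (map g row) j ≡ Data.Maybe.map g (lookupM row j)
lookupM-map g []        j       = refl
lookupM-map g (x ∷ row) zero    = refl
lookupM-map g (x ∷ row) (suc j) = lookupM-map g row j

columnOf-map : ∀ (g : ℕ → ℕ) T j → columnOf (map (map g) T) j ≡ map g (columnOf T j)
columnOf-map g [] j = refl
columnOf-map g (row ∷ rs) j rewrite lookupM-map g row j with lookupM row j
... | just x  = cong (g x ∷_) (columnOf-map g rs j)
... | nothing = columnOf-map g rs j

at-applyUpTo : ∀ (f : ℕ → ℕ) n {q} → q < n → at (applyUpTo f n) q ≡ f q
at-applyUpTo f (suc n) {zero}  _        = refl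
at-applyUpTo f (suc n) {suc q} (s≤s lt) = at-applyUpTo (λ x → f (suc x)) n lt

height : (ℕ → Row) → ℕ → ℕ → ℕ
height R l q = length (filter (λ row → occupied row q Bool.≟ true) (applyUpTo R l))

height-≤ : ∀ R l q → height R l q ≤ l
height-≤ R l q = ≤-trans (length-filter (λ row → occupied row q Bool.≟ true) (applyUpTo R l))
                         (≤-reflexive (length-applyUpTo R l))

height-zero : ∀ R l q → (∀ j → occupied (R j) q ≡ false) → height R l q ≡ 0
height-zero R zero    q none = refl
height-zero R (suc l) q none rewrite none 0 = height-zero (λ j → R (suc j)) l q (λ j → none (suc j))

-- By `nested` the occupied cells of a column form an initial segment, so the height exceeds `j`
-- exactly when cell `j` is occupied.
height-ind : ∀ R l q → (∀ j → occupied (R (suc j)) q ≡ true → occupied (R j) q ≡ true) →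
             ∀ {j} → j < l → ind (suc j) (height R l q) ≡ boolBit (occupied (R j) q)
height-ind R (suc l) q nested {j} j<l with occupied (R 0) q in eq
height-ind R (suc l) q nested {zero}  j<l | true rewrite eq = ind-yes {1} {suc (height (λ j → R (suc j)) l q)} (s≤s z≤n)
height-ind R (suc l) q nested {suc j} (s≤s j<l) | true = trans ind-suc
    (height-ind (λ j → R (suc j)) l q (λ j → nested (suc j)) j<l)
  where
  ind-suc : ∀ {m x} → ind (suc m) (suc x) ≡ ind m x
  ind-suc {m} {x} with m ≤? x
  ... | yes le = ind-yes (s≤s le)
  ... | no ¬le = ind-no (s≤s (≰⇒> ¬le))
height-ind R (suc l) q nested {j} j<l | false =
  trans (cong (ind (suc j)) (height-zero (λ j → R (suc j)) l q (λ j → none (suc j))))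
        (trans (ind-no {suc j} (s≤s z≤n)) (sym (cong boolBit (none j))))
  where
  none : ∀ j → occupied (R j) q ≡ false
  none zero    = eq
  none (suc j) with occupied (R (suc j)) q in eq′
  ... | false = refl
  ... | true  = trans (sym (nested j eq′)) (none j)

keyShape : ℕ → Chain → List ℕ
keyShape n c = sh n (ρ n (map (map (cmpl n)) (toTab c)))

rowLen-map : ∀ (g : ℕ → ℕ) T i → rowLen (map (map g) T) i ≡ rowLen T i
rowLen-map g []         i       = refl
rowLen-map g (row ∷ rs) zero    = length-map g row
rowLen-map g (row ∷ rs) (suc i) = rowLen-map g rs i

keyShape-length : ∀ n c → length (keyShape n c) ≡ n
keyShape-length n c = trans (length-map _ (upTo n)) (length-upTo n)

occupied-nothing : ∀ n q → occupied (replicate n nothing) q ≡ false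
occupied-nothing zero    q       = refl
occupied-nothing (suc n) zero    = refl
occupied-nothing (suc n) (suc q) = occupied-nothing n q

keyShape-ind : ∀ {n c} → Valid c → Within n c → ∀ j {q} → q < n →
               ind (suc j) (at (keyShape n c) q) ≡ boolBit (occupied (rows n c j) q)
keyShape-ind {n} {c} valid range j {q} q<n = trans (cong (ind (suc j)) at-height) (by-length (j <? l))
  where
  T′ = map (map (cmpl n)) (toTab c)
  R  = rowF n (columnOf T′)
  l  = rowLen T′ 0
  l≡ : l ≡ len c 0
  l≡ = trans (rowLen-map (cmpl n) (toTab c) 0) (toTab-len valid 0)
  R≡ : ∀ j → R j ≡ rows n c j
  R≡ = rowF-cong n (λ j → trans (columnOf-map (cmpl n) (toTab c) j) (cong (map (cmpl n)) (columnOf-toTab valid j)))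
  at-height : at (keyShape n c) q ≡ height R l q
  at-height = trans (cong (λ F → at (sh n F) q) (ρ-rows n T′))
    (trans (cong (λ xs → at xs q) (map-upTo (height R l) n)) (at-applyUpTo (height R l) n q<n))
  cols-empty : ∀ j → len c 0 ≤ j → cols c j ≡ []
  cols-empty j le = trans (sym (columnOf-toTab valid j)) (columnOf-empty (toTab c) j
    (λ i → ≤-trans (≤-reflexive (toTab-len valid i)) (≤-trans (antitone-≤ (len-antitone valid) {0} {i} z≤n) le)))
  row-empty : ∀ j → len c 0 ≤ j → rows n c j ≡ replicate n nothing
  row-empty zero    le = cong (λ xs → firstRow n (map (cmpl n) xs)) (cols-empty 0 le)
  row-empty (suc j) le = cong (λ xs → nextRow n (rows n c j) (map (cmpl n) xs)) (cols-empty (suc j) le)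
  all≥ : All (λ b → 0 ≤ cmpl n (proj₁ b)) c
  all≥ = All.map (λ _ → z≤n) range
  by-length : Dec (j < l) → ind (suc j) (height R l q) ≡ boolBit (occupied (rows n c j) q)
  by-length (yes j<l) = trans (height-ind R l q (λ j o → subst (λ r → occupied r q ≡ true) (sym (R≡ j))
      (over-occupied (SSAF.over (ssaf valid range) all≥ j) q (subst (λ r → occupied r q ≡ true) (R≡ (suc j)) o))) j<l)
    (cong (λ r → boolBit (occupied r q)) (R≡ j))
  by-length (no j≮l) = trans (ind-no (s≤s (≤-trans (height-≤ R l q) (≮⇒≥ j≮l))))
    (sym (trans (cong (λ r → boolBit (occupied r q)) (row-empty j (≤-trans (≤-reflexive (sym l≡)) (≮⇒≥ j≮l))))
                (cong boolBit (occupied-nothing n q))))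

keyShape-cnt : ∀ {n c} → Valid c → Within n c → ∀ {u} → u ≤ n → ∀ j →
               cnt (at (keyShape n c)) (suc j) u ≡ A (n ∸ u) c j
keyShape-cnt {n} {c} valid range {u} u≤n j = trans (go u u≤n) (SSAF.count (ssaf valid range) u u≤n j)
  where
  go : ∀ u → u ≤ n → cnt (at (keyShape n c)) (suc j) u ≡ occ (rows n c j) u
  go zero    _  = sym (occ-zero (rows n c j))
    where
    occ-zero : ∀ r → occ r 0 ≡ 0
    occ-zero []      = refl
    occ-zero (_ ∷ _) = refl
  go (suc u) lt = trans (cong₂ _+_ (go u (<⇒≤ lt)) (keyShape-ind valid range j lt)) (sym (occ-suc (rows n c j) u))

keyPair-rsk : ∀ {n w p q} → Biword n w → Rsk n w p q → keyPair n w ≡ (keyShape n p , keyShape n q)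
keyPair-rsk {n} bw r = cong (λ PQ → sh n (ρ n (map (map (cmpl n)) (proj₁ PQ))) , sh n (ρ n (map (map (cmpl n)) (proj₂ PQ))))
                         (rsk-correct bw r)

cmpl-range : ∀ {n x} → InRange n x → InRange n (cmpl n x)
cmpl-range {n} {suc x} (_ , s≤s x≤n) = m<n⇒0<n∸m (s≤s x≤n) , m∸n≤m n x

rsk-range : ∀ {n w p q} → Biword n w → Rsk n w p q → Within n p × Within n q
rsk-range {n} (ranges , _) r =
    rsk-allP {P = InRange n} (All.map (λ rg → cmpl-range (proj₂ rg)) ranges) r
  , rsk-allQ {P = InRange n} (All.map (λ rg → cmpl-range (proj₁ rg)) ranges) r

-- Bruhat order and prefix counts.

≡ᵇ-true : ∀ {m n} → m ≡ n → (m ≡ᵇ n) ≡ true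
≡ᵇ-true {m} {n} e with m ≡ᵇ n | ≡⇒≡ᵇ m n e
... | true | _ = refl

≡ᵇ-false : ∀ {m n} → m ≢ n → (m ≡ᵇ n) ≡ false
≡ᵇ-false {m} {n} m≢n with m ≡ᵇ n in eq
... | false = refl
... | true  = contradiction (≡ᵇ⇒≡ m n (subst T (sym eq) tt)) m≢n

length-imapFrom : ∀ k f xs → length (imapFrom k f xs) ≡ length xs
length-imapFrom k f []       = refl
length-imapFrom k f (x ∷ xs) = cong suc (length-imapFrom (suc k) f xs)

length-swapPos : ∀ i j δ → length (swapPos i j δ) ≡ length δ
length-swapPos i j δ = length-imapFrom 0 _ δ

at-imapFrom : ∀ k f xs {q} → q < length xs → at (imapFrom k f xs) q ≡ f (k + q) (at xs q)
at-imapFrom k f (x ∷ xs) {zero}  _        = cong (λ z → f z x) (sym (+-identityʳ k))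
at-imapFrom k f (x ∷ xs) {suc q} (s≤s lt) = trans (at-imapFrom (suc k) f xs lt) (cong (λ z → f z (at xs q)) (sym (+-suc k q)))

record Swapped (n i j : ℕ) (f f′ : ℕ → ℕ) : Set where
  field
    i<j   : i < j
    j<n   : j < n
    at-i  : f′ i ≡ f j
    at-j  : f′ j ≡ f i
    other : ∀ {k} → k < n → k ≢ i → k ≢ j → f′ k ≡ f k

swapPos-swapped : ∀ {i j} δ → i < j → j < length δ → Swapped (length δ) i j (at δ) (at (swapPos i j δ))
swapPos-swapped {i} {j} δ i<j j<n = record
  { i<j = i<j ; j<n = j<n
  ; at-i = trans (at-imapFrom 0 _ δ (<-trans i<j j<n)) (first i)
  ; at-j = trans (at-imapFrom 0 _ δ j<n) second
  ; other = λ k<n k≢i k≢j → trans (at-imapFrom 0 _ δ k<n) (third k≢i k≢j) }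
  where
  first : ∀ i → (if i ≡ᵇ i then at δ j else (if i ≡ᵇ j then at δ i else at δ i)) ≡ at δ j
  first i rewrite ≡ᵇ-true {i} refl = refl
  second : (if j ≡ᵇ i then at δ j else (if j ≡ᵇ j then at δ i else at δ j)) ≡ at δ i
  second rewrite ≡ᵇ-false (≢-sym (<⇒≢ i<j)) | ≡ᵇ-true {j} refl = refl
  third : ∀ {k} → k ≢ i → k ≢ j → (if k ≡ᵇ i then at δ j else (if k ≡ᵇ j then at δ i else at δ k)) ≡ at δ k
  third k≢i k≢j rewrite ≡ᵇ-false k≢i | ≡ᵇ-false k≢j = refl

cnt-cong : ∀ {f g} m t → (∀ {k} → k < t → f k ≡ g k) → cnt f m t ≡ cnt g m t
cnt-cong m zero    _  = refl
cnt-cong m (suc t) eq = cong₂ _+_ (cnt-cong m t (λ lt → eq (m<n⇒m<1+n lt))) (cong (ind m) (eq ≤-refl))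

cnt-swap-before : ∀ {n i j f f′} → Swapped n i j f f′ → ∀ m {t} → t ≤ i → cnt f′ m t ≡ cnt f m t
cnt-swap-before sw m {t} t≤i = cnt-cong m t (λ k<t → other
    (<-trans (<-≤-trans k<t t≤i) (<-trans i<j j<n)) (<⇒≢ (<-≤-trans k<t t≤i)) (<⇒≢ (<-trans (<-≤-trans k<t t≤i) i<j)))
  where open Swapped sw

+-rotate : ∀ a b c → a + b + c ≡ a + c + b
+-rotate = solve 3 (λ a b c → a :+ b :+ c := a :+ c :+ b) refl
  where open +-*-Solver

cnt-swap-between : ∀ {n i j f f′} → Swapped n i j f f′ → ∀ m {t} → i < t → t ≤ j →
                   cnt f′ m t + ind m (f i) ≡ cnt f m t + ind m (f j)
cnt-swap-between {i = i} {j} {f} {f′} sw m {suc t} i<t t≤j with m≤n⇒m<n∨m≡n (≤-pred i<t)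
... | inj₂ refl = trans (cong₂ (λ x y → x + y + ind m (f i)) (cnt-swap-before sw m ≤-refl) (cong (ind m) (Swapped.at-i sw)))
                        (+-rotate (cnt f m i) _ _)
... | inj₁ i<t′ = begin
  cnt f′ m t + ind m (f′ t) + ind m (f i) ≡⟨ +-rotate (cnt f′ m t) _ _ ⟩
  cnt f′ m t + ind m (f i) + ind m (f′ t) ≡⟨ cong₂ _+_ (cnt-swap-between sw m i<t′ (<⇒≤ t≤j)) (cong (ind m)
                                               (other (<-trans t≤j j<n) (≢-sym (<⇒≢ i<t′)) (<⇒≢ t≤j))) ⟩
  cnt f m t + ind m (f j) + ind m (f t)   ≡⟨ +-rotate (cnt f m t) _ _ ⟩
  cnt f m t + ind m (f t) + ind m (f j)   ∎
  where
  open Swapped sw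
  open ≡-Reasoning

cnt-swap-after : ∀ {n i j f f′} → Swapped n i j f f′ → ∀ m {t} → j < t → t ≤ n → cnt f′ m t ≡ cnt f m t
cnt-swap-after {i = i} {j} {f} {f′} sw m {suc t} j<t t≤n with m≤n⇒m<n∨m≡n (≤-pred j<t)
... | inj₂ refl = trans (cong (λ z → cnt f′ m j + ind m z) (Swapped.at-j sw)) (cnt-swap-between sw m (Swapped.i<j sw) ≤-refl)
... | inj₁ j<t′ = cong₂ _+_ (cnt-swap-after sw m j<t′ (<⇒≤ t≤n))
    (cong (ind m) (other t≤n (≢-sym (<⇒≢ (<-trans i<j j<t′))) (≢-sym (<⇒≢ j<t′))))
  where open Swapped sw

ind-≤1 : ∀ m x → ind m x ≤ 1
ind-≤1 m x with m ≤? x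
... | yes _ = ≤-refl
... | no _  = z≤n

ind-monoʳ : ∀ m {x y} → x ≤ y → ind m x ≤ ind m y
ind-monoʳ m {x} {y} x≤y with m ≤? x
... | yes le = ≤-reflexive (sym (ind-yes (≤-trans le x≤y)))
... | no _   = z≤n

ind-monoˡ : ∀ {m m′} x → m ≤ m′ → ind m′ x ≤ ind m x
ind-monoˡ {m} {m′} x m≤m′ with m′ ≤? x
... | yes le = ≤-reflexive (sym (ind-yes (≤-trans m≤m′ le)))
... | no _   = z≤n

-- The tableau criterion for Bruhat order.
record Dominates (n : ℕ) (f g : ℕ → ℕ) : Set where
  field
    prefix : ∀ m {t} → t ≤ n → cnt g m t ≤ cnt f m t
    total  : ∀ m → cnt f m n ≡ cnt g m n

≤B-length : ∀ {α γ} → α ≤B γ → length γ ≡ length α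
≤B-length bruhat-refl = refl
≤B-length (bruhat-step {δ} i j _ _ _ α≤δ) = trans (length-swapPos i j δ) (≤B-length α≤δ)

-- Each step carries the larger of two entries to the right, so no prefix gains entries of size at
-- least `m`.
≤B-dominates : ∀ {α γ} → α ≤B γ → Dominates (length α) (at α) (at γ)
≤B-dominates bruhat-refl = record { prefix = λ _ _ → ≤-refl ; total = λ _ → refl }
≤B-dominates {α} (bruhat-step {δ} i j i<j j<n lt α≤δ) = record
  { prefix = λ m {t} t≤n → ≤-trans (step≤ m t≤n) (prefix m t≤n)
  ; total  = λ m → trans (total m) (sym (cnt-swap-after sw m (Swapped.j<n sw) ≤-refl)) }
  where
  open Dominates (≤B-dominates α≤δ)
  sw : Swapped (length α) i j (at δ) (at (swapPos i j δ))
  sw = subst (λ n → Swapped n i j (at δ) (at (swapPos i j δ))) (≤B-length α≤δ) (swapPos-swapped δ i<j j<n)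
  step≤ : ∀ m {t} → t ≤ length α → cnt (at (swapPos i j δ)) m t ≤ cnt (at δ) m t
  step≤ m {t} t≤n with t ≤? i | t ≤? j
  ... | yes t≤i | _ = ≤-reflexive (cnt-swap-before sw m t≤i)
  ... | no t≰i | yes t≤j = +-cancelʳ-≤ (ind m (at δ i)) _ _ (≤-trans (≤-reflexive (cnt-swap-between sw m (≰⇒> t≰i) t≤j))
                             (+-monoʳ-≤ (cnt (at δ) m t) (ind-monoʳ m (<⇒≤ lt))))
  ... | no _ | no t≰j = ≤-reflexive (cnt-swap-after sw m (≰⇒> t≰j) t≤n)

≤B-trans : ∀ {α δ γ} → α ≤B δ → δ ≤B γ → α ≤B γ
≤B-trans p bruhat-refl = p
≤B-trans p (bruhat-step i j i<j j<n lt q) = bruhat-step i j i<j j<n lt (≤B-trans p q)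

at-ext : ∀ {α γ : List ℕ} → length α ≡ length γ → (∀ {k} → k < length α → at α k ≡ at γ k) → α ≡ γ
at-ext {[]} {[]} _ _ = refl
at-ext {a ∷ α} {b ∷ γ} le eq = cong₂ _∷_ (eq {0} (s≤s z≤n)) (at-ext (suc-injective le) (λ {k} lt → eq {suc k} (s≤s lt)))

Between : (ℕ → ℕ) → ℕ → ℕ → ℕ → Set
Between f lo hi k = lo ≤ f k × f k < hi

NoneBetween : (ℕ → ℕ) → ℕ → ℕ → ℕ → ℕ → Set
NoneBetween f lo hi i t = ∀ {k} → i < k → k < t → ¬ Between f lo hi k

search : ∀ f lo hi i t → (∃[ j ] i < j × j < t × Between f lo hi j × NoneBetween f lo hi i j) ⊎ NoneBetween f lo hi i t
search f lo hi i zero = inj₂ (λ _ ())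
search f lo hi i (suc t) with search f lo hi i t
... | inj₁ (j , i<j , j<t , bt , none) = inj₁ (j , i<j , m<n⇒m<1+n j<t , bt , none)
... | inj₂ none with i <? t | lo ≤? f t | f t <? hi
...   | yes i<t | yes le | yes lt = inj₁ (t , i<t , ≤-refl , (le , lt) , none)
...   | no i≮t | _ | _ = inj₂ (λ i<k k<1+t _ → i≮t (<-≤-trans i<k (≤-pred k<1+t)))
...   | yes _ | no ¬le | _ = inj₂ λ {k} i<k k<1+t bt → last (m≤n⇒m<n∨m≡n (≤-pred k<1+t)) i<k bt
  where
  last : ∀ {k} → k < t ⊎ k ≡ t → i < k → ¬ Between f lo hi k
  last (inj₁ k<t)  i<k bt       = none i<k k<t bt
  last (inj₂ refl) i<k (le , _) = ¬le le
...   | yes _ | yes _ | no ¬lt = inj₂ λ {k} i<k k<1+t bt → last (m≤n⇒m<n∨m≡n (≤-pred k<1+t)) i<k bt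
  where
  last : ∀ {k} → k < t ⊎ k ≡ t → i < k → ¬ Between f lo hi k
  last (inj₁ k<t)  i<k bt       = none i<k k<t bt
  last (inj₂ refl) i<k (_ , lt) = ¬lt lt

-- Count the entries in [q , m) for q = g i. After position `i`, the prefix of `f` gains none of
-- them, and that of `g` gains at least q itself. Subtracting these numbers from the counts at
-- threshold q, where `f` is at least `g`, leaves a strict inequality at `m`.
dominates-strict : ∀ {n f g i m t} → Dominates n f g → (∀ {k} → k < i → f k ≡ g k) →
                   g i < m → m ≤ f i → i < t → t ≤ n → NoneBetween f (g i) (f i) i t → cnt g m t < cnt f m t
dominates-strict {n} {f} {g} {i} {m} {t} dom agree q<m m≤fi i<t t≤n none =
  +-cancelʳ-< (cnt g q i) _ _ (begin-strict
    cnt g m t + cnt g q i <⟨ G t i<t ⟩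
    cnt g q t + cnt g m i ≤⟨ +-mono-≤ (Dominates.prefix dom q t≤n) (≤-reflexive (sym (cnt-cong m i agree))) ⟩
    cnt f q t + cnt f m i ≡⟨ sym (F t i<t none) ⟩
    cnt f m t + cnt f q i ≡⟨ cong (cnt f m t +_) (cnt-cong q i agree) ⟩
    cnt f m t + cnt g q i ∎)
  where
  open ≤-Reasoning
  q = g i
  F : ∀ t → i < t → NoneBetween f q (f i) i t → cnt f m t + cnt f q i ≡ cnt f q t + cnt f m i
  F (suc t) i<t none with m≤n⇒m<n∨m≡n (≤-pred i<t)
  ... | inj₂ refl rewrite ind-yes m≤fi | ind-yes (<⇒≤ (<-≤-trans q<m m≤fi)) =
    solve 2 (λ a b → a :+ con 1 :+ b := b :+ con 1 :+ a) refl (cnt f m i) (cnt f q i)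
    where open +-*-Solver
  ... | inj₁ i<t′ = trans (+-rotate (cnt f m t) _ _) (trans (cong₂ _+_ (F t i<t′ (λ i<k k<t → none i<k (m<n⇒m<1+n k<t))) same)
                      (+-rotate (cnt f q t) _ _))
    where
    same : ind m (f t) ≡ ind q (f t)
    same with f t <? q
    ... | yes lt = trans (ind-no (<-trans lt q<m)) (sym (ind-no lt))
    ... | no ¬lt = trans (ind-yes (≤-trans m≤fi hi≤)) (sym (ind-yes (≮⇒≥ ¬lt)))
      where
      hi≤ : f i ≤ f t
      hi≤ = ≮⇒≥ (λ lt → none i<t′ ≤-refl (≮⇒≥ ¬lt , lt))
  G : ∀ t → i < t → cnt g m t + cnt g q i < cnt g q t + cnt g m i
  G (suc t) i<t with m≤n⇒m<n∨m≡n (≤-pred i<t)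
  ... | inj₂ refl rewrite ind-no q<m | ind-yes (≤-refl {q}) = ≤-reflexive
    (solve 2 (λ a b → con 1 :+ (a :+ con 0 :+ b) := b :+ con 1 :+ a) refl (cnt g m i) (cnt g q i))
    where open +-*-Solver
  ... | inj₁ i<t′ = subst₂ _<_ (+-rotate (cnt g m t) _ _) (+-rotate (cnt g q t) _ _)
                      (+-mono-<-≤ (G t i<t′) (ind-monoˡ (g t) (<⇒≤ q<m)))

-- The exchange costs one only for prefixes ending between `i` and `j` and thresholds in (f j , f
-- i]; there `dominates-strict` supplies the slack.
swap-dominates : ∀ {n f f′ g i j} → Dominates n f g → (∀ {k} → k < i → f k ≡ g k) → Swapped n i j f f′ →
                 Between f (g i) (f i) j → NoneBetween f (g i) (f i) i j → Dominates n f′ g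
swap-dominates {n} {f} {f′} {g} {i} {j} dom agree sw (gi≤ , fj<) none = record
  { prefix = pre ; total = λ m → trans (cnt-swap-after sw m j<n ≤-refl) (total m) }
  where
  open Dominates dom
  open Swapped sw
  pre : ∀ m {t} → t ≤ n → cnt g m t ≤ cnt f′ m t
  pre m {t} t≤n with t ≤? i | t ≤? j
  ... | yes t≤i | _ = ≤-trans (prefix m t≤n) (≤-reflexive (sym (cnt-swap-before sw m t≤i)))
  ... | no _ | no t≰j = ≤-trans (prefix m t≤n) (≤-reflexive (sym (cnt-swap-after sw m (≰⇒> t≰j) t≤n)))
  ... | no t≰i | yes t≤j with m ≤? f j | m ≤? f i
  ...   | yes m≤fj | _ = ≤-trans (prefix m t≤n) (≤-reflexive (sym (+-cancelʳ-≡ 1 _ _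
            (subst₂ (λ x y → cnt f′ m t + x ≡ cnt f m t + y) (ind-yes (≤-trans m≤fj (<⇒≤ fj<))) (ind-yes m≤fj)
               (cnt-swap-between sw m (≰⇒> t≰i) t≤j)))))
  ...   | no m≰fj | no m≰fi = ≤-trans (prefix m t≤n) (≤-reflexive (sym (+-cancelʳ-≡ 0 _ _
            (subst₂ (λ x y → cnt f′ m t + x ≡ cnt f m t + y) (ind-no (≰⇒> m≰fi)) (ind-no (≰⇒> m≰fj))
               (cnt-swap-between sw m (≰⇒> t≰i) t≤j)))))
  ...   | no m≰fj | yes m≤fi = ≤-pred (≤-trans
            (dominates-strict dom agree (≤-<-trans gi≤ (≰⇒> m≰fj)) m≤fi (≰⇒> t≰i) t≤n
               (λ i<k k<t → none i<k (<-≤-trans k<t t≤j)))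
            (≤-reflexive (sym (trans (+-comm 1 _) (trans
              (subst₂ (λ x y → cnt f′ m t + x ≡ cnt f m t + y) (ind-yes m≤fi) (ind-no (≰⇒> m≰fj))
                 (cnt-swap-between sw m (≰⇒> t≰i) t≤j)) (+-identityʳ _))))))

dominates-first : ∀ {n f g i} → Dominates n f g → i < n → (∀ {k} → k < i → f k ≡ g k) → g i ≤ f i
dominates-first {n} {f} {g} {i} dom i<n agree with g i ≤? f i
... | yes le = le
... | no ¬le = contradiction (Dominates.prefix dom (g i) i<n) (<⇒≱ (+-mono-≤-<
    (≤-reflexive (cnt-cong (g i) i agree))
    (subst₂ _<_ (sym (ind-no (≰⇒> ¬le))) (sym (ind-yes (≤-refl {g i}))) (s≤s z≤n))))

-- At the first position i where α and γ differ, α is larger; exchange it with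
-- the first later entry lying in the interval [γ i, α i).
dominates-≤B : ∀ {α γ} → length γ ≡ length α → Dominates (length α) (at α) (at γ) → α ≤B γ
dominates-≤B {α₀} {γ} len₀ dom₀ = outer n 0 (+-identityʳ n) α₀ refl dom₀ (λ ())
  where
  n = length α₀
  outer : ∀ d i → d + i ≡ n → ∀ α → length α ≡ n → Dominates n (at α) (at γ) → (∀ {k} → k < i → at α k ≡ at γ k) → α ≤B γ
  -- `e` bounds the excess of `α` over `γ` at position `i`, which every exchange lowers.
  inner : ∀ d i → suc d + i ≡ n → ∀ e α → at α i ≤ at γ i + e → length α ≡ n → Dominates n (at α) (at γ) →
          (∀ {k} → k < i → at α k ≡ at γ k) → α ≤B γ
  outer zero    i refl α eα dom agree = subst (α ≤B_) (at-ext (trans eα (sym len₀)) (λ lt → agree (subst (_ <_) eα lt))) bruhat-refl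
  outer (suc d) i eq α eα dom agree = inner d i eq (at α i) α (m≤n+m _ _) eα dom agree
  inner d i eq e α bound eα dom agree with m≤n⇒m<n∨m≡n (dominates-first dom i<n agree)
    where
    i<n : i < n
    i<n = subst (i <_) eq (s≤s (m≤n+m i d))
  ... | inj₂ gi≡fi = outer d (suc i) (trans (+-suc d i) eq) α eα dom agree′
    where
    agree′ : ∀ {k} → k < suc i → at α k ≡ at γ k
    agree′ k<1+i with m≤n⇒m<n∨m≡n (≤-pred k<1+i)
    ... | inj₁ k<i  = agree k<i
    ... | inj₂ refl = sym gi≡fi
  ... | inj₁ gi<fi with search (at α) (at γ i) (at α i) i n
  -- Without an entry to exchange, the strict inequality would reach the full length and contradict
  -- the equal totals.
  ...   | inj₂ none = contradiction (Dominates.total dom (at α i))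
            (≢-sym (<⇒≢ (dominates-strict dom agree gi<fi ≤-refl (subst (i <_) eq (s≤s (m≤n+m i d))) ≤-refl none)))
  inner d i eq zero α bound eα dom agree | inj₁ gi<fi | inj₁ _ =
    contradiction bound (<⇒≱ (subst (_< at α i) (sym (+-identityʳ _)) gi<fi))
  inner d i eq (suc e) α bound eα dom agree | inj₁ gi<fi | inj₁ (j , i<j , j<n , bt , none) =
    ≤B-trans (bruhat-step i j i<j j<α (proj₂ bt) bruhat-refl)
      (inner d i eq e (swapPos i j α) bound′ (trans (length-swapPos i j α) eα)
         (swap-dominates dom agree sw bt none)
         (λ k<i → trans (Swapped.other sw (<-trans k<i (<-trans i<j j<n)) (<⇒≢ k<i) (<⇒≢ (<-trans k<i i<j))) (agree k<i)))
    where
    j<α : j < length α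
    j<α = subst (j <_) (sym eα) j<n
    sw : Swapped n i j (at α) (at (swapPos i j α))
    sw = subst (λ n → Swapped n i j (at α) (at (swapPos i j α))) eα (swapPos-swapped α i<j j<α)
    bound′ : at (swapPos i j α) i ≤ at γ i + e
    bound′ = subst (_≤ at γ i + e) (sym (Swapped.at-i sw))
               (≤-pred (≤-trans (proj₂ bt) (≤-trans bound (≤-reflexive (+-suc (at γ i) e)))))

-- Simple transpositions with increasing indices.

Count : Set
Count = ℕ → ℕ → ℕ

-- The effect on prefix counts b of applying simple transpositions with
-- increasing indices S: the entry x is carried to the right along each run of S.
record Shift (n : ℕ) (b : Count) (x : ℕ → ℕ) (S : ℕ → Set) (γ : Count) : Set where
  field
    S?    : ∀ t → Dec (S t)
    S-pos : ¬ S 0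
    S-<   : ∀ {t} → S t → t < n
    b-suc : ∀ m t → b m (suc t) ≡ b m t + ind (suc m) (x t)
    off   : ∀ m {t} → t ≤ n → ¬ S t → γ m t ≡ b m t
    on    : ∀ m {t} → S (suc t) → γ m (suc t) ≡ γ m t + ind (suc m) (x (suc t))

  -- The entry `c` in transit: with the first `t` entries of the result it makes up the first
  -- `suc t` original ones. For `t` outside `S` it is `x t` itself.
  carry : ∀ {t} → t < n → ∃[ c ] (∀ m → γ m t + ind (suc m) c ≡ b m (suc t))
  carry {t} t<n with S? t
  carry {t}     t<n | no ¬St = x t , λ m → trans (cong (_+ ind (suc m) (x t)) (off m (<⇒≤ t<n) ¬St)) (sym (b-suc m t))
  carry {zero}  t<n | yes S0 = contradiction S0 S-pos
  carry {suc t} t<n | yes St with carry {t} (<-trans ≤-refl t<n)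
  ... | c , eq = c , λ m → trans (cong (_+ ind (suc m) c) (on m St)) (trans (+-rotate (γ m t) _ _)
                     (trans (cong (_+ ind (suc m) (x (suc t))) (eq m)) (sym (b-suc m (suc t)))))

  γ≤b : ∀ m {t} → t < n → γ m t ≤ b m (suc t)
  γ≤b m t<n with carry t<n
  ... | c , eq = ≤-trans (m≤m+n _ _) (≤-reflexive (eq m))

Good : (ℕ → ℕ) → Count → Count → ℕ → ℕ → Set
Good tot f g t u = ∀ m → tot m ≤ f m t + g m u

AllGood : ℕ → (ℕ → ℕ) → Count → Count → Set
AllGood n tot f g = ∀ t u → t + u ≡ n → Good tot f g t u

-- If the conclusion fails at m then x ≤ m < c, and this forces the inequality
-- excluded by the second hypothesis at every index.
carry-step : ∀ {tot P K : ℕ → ℕ} {c x y} → (∀ m → tot m ≤ P m + (K m + ind (suc m) y)) →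
             ¬ (∀ m → tot m ≤ P m + ind (suc m) c + K m) →
             (∀ m → tot m ≤ P m + ind (suc m) c + ind (suc m) x + K m) →
             ∀ m → tot m ≤ P m + ind (suc m) x + K m
carry-step {tot} {P} {K} {c} {x} {y} h₁ h₂ h₃ m with tot m ≤? P m + ind (suc m) x + K m
... | yes le = le
... | no ¬le = contradiction all h₂
  where
  c-large : suc m ≤ c
  c-large = ≮⇒≥ λ c< → ¬le (subst (λ z → tot m ≤ z + ind (suc m) x + K m) (+-identityʳ (P m))
              (subst (λ z → tot m ≤ P m + z + ind (suc m) x + K m) (ind-no c<) (h₃ m)))
  x-small : x < suc m
  x-small = ≰⇒> λ le → ¬le (begin
    tot m                            ≤⟨ h₁ m ⟩
    P m + (K m + ind (suc m) y)      ≤⟨ +-monoʳ-≤ (P m) (+-monoʳ-≤ (K m) (ind-≤1 (suc m) y)) ⟩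
    P m + (K m + 1)                  ≡⟨ solve 2 (λ p k → p :+ (k :+ con 1) := p :+ con 1 :+ k) refl (P m) (K m) ⟩
    P m + 1 + K m                    ≡⟨ cong (λ z → P m + z + K m) (sym (ind-yes le)) ⟩
    P m + ind (suc m) x + K m        ∎)
    where
    open ≤-Reasoning
    open +-*-Solver
  all : ∀ m → tot m ≤ P m + ind (suc m) c + K m
  all m₀ = bound (suc m₀ ≤? c)
    where
    bound : Dec (suc m₀ ≤ c) → tot m₀ ≤ P m₀ + ind (suc m₀) c + K m₀
    bound (yes le) = subst (λ z → tot m₀ ≤ P m₀ + z + K m₀) (sym (ind-yes le)) (begin
        tot m₀                           ≤⟨ h₁ m₀ ⟩
        P m₀ + (K m₀ + ind (suc m₀) y)   ≤⟨ +-monoʳ-≤ (P m₀) (+-monoʳ-≤ (K m₀) (ind-≤1 (suc m₀) y)) ⟩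
        P m₀ + (K m₀ + 1)                ≡⟨ solve 2 (λ p k → p :+ (k :+ con 1) := p :+ con 1 :+ k) refl (P m₀) (K m₀) ⟩
        P m₀ + 1 + K m₀                  ∎)
      where
      open ≤-Reasoning
      open +-*-Solver
    bound (no ¬c) = subst₂ _≤_ refl (cong (λ z → P m₀ + z + K m₀) (sym (ind-no (≰⇒> ¬c))))
      (subst (λ z → tot m₀ ≤ z + K m₀) (+-identityʳ (P m₀ + 0))
        (subst₂ (λ z z′ → tot m₀ ≤ P m₀ + z + z′ + K m₀) (ind-no (≰⇒> ¬c))
           (ind-no (<-trans (<-≤-trans x-small c-large) (≰⇒> ¬c))) (h₃ m₀)))

-- F t says that the block at t is empty; forward is an induction along a run.
module OneSide {n : ℕ} {tot : ℕ → ℕ} {b κ : Count} {x y : ℕ → ℕ}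
               (κ-suc : ∀ m {t} → t < n → κ m t ≡ κ m (suc t) + ind (suc m) (y t)) where

  F : ℕ → Set
  F t = ∀ m → tot m ≤ b m t + κ m t

  forward : ∀ {S γ} → Shift n b x S γ → ∀ t₀ → ¬ S t₀ →
            (∀ {s} → t₀ ≤ s → S (suc s) → ¬ S s → F s) →
            (∀ {s} → t₀ < s → S s → ¬ F s) →
            (∀ {s} → t₀ < s → S s → ∀ m → tot m ≤ b m (suc s) + κ m s) →
            ∀ {s} → t₀ < s → S s → ∀ m → tot m ≤ γ m s + κ m s
  forward {S} {γ} sh t₀ ¬St₀ base neg nxt {suc s} t₀<s Ss m =
    subst (λ z → tot m ≤ z + κ m (suc s)) (sym (on m Ss))
      (carry-step {tot} {λ m → γ m s} {λ m → κ m (suc s)} {c} {x (suc s)} {y s}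
        (λ m → ≤-trans (previous m) (+-monoʳ-≤ (γ m s) (≤-reflexive (κ-suc m s<n))))
        (λ all → neg t₀<s Ss (λ m → subst (λ z → tot m ≤ z + κ m (suc s)) (eq m) (all m)))
        (λ m → subst (λ z → tot m ≤ z + κ m (suc s))
                 (trans (b-suc m (suc s)) (cong (_+ ind (suc m) (x (suc s))) (sym (eq m)))) (nxt t₀<s Ss m))
        m)
    where
    open Shift sh
    s<n : s < n
    s<n = <-trans ≤-refl (S-< Ss)
    c = proj₁ (carry s<n)
    eq = proj₂ (carry s<n)
    previous : ∀ m → tot m ≤ γ m s + κ m s
    previous with S? s
    ... | no ¬Ss′ = λ m → ≤-trans (base (≤-pred t₀<s) Ss ¬Ss′ m)
                            (+-monoˡ-≤ (κ m s) (≤-reflexive (sym (off m (<⇒≤ s<n) ¬Ss′))))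
    ... | yes Ss′ = forward sh t₀ ¬St₀ base neg nxt (≤∧≢⇒< (≤-pred t₀<s) λ { refl → ¬St₀ Ss′ }) Ss′

  module _ {S S′ γ γ′} (sh : Shift n b x S γ) (sh′ : Shift n b x S′ γ′) (t₁ : ℕ)
           (shrink : ∀ {s} → S′ s → S s × s ≢ t₁) (expand : ∀ {s} → S s → s ≢ t₁ → S′ s) where

    private
      module Sh  = Shift sh
      module Sh′ = Shift sh′

    omit-below : ∀ m {s} → s ≤ n → s < t₁ → γ′ m s ≡ γ m s
    omit-below m {s} s≤n s<t₁ with Sh.S? s
    omit-below m {s} s≤n s<t₁ | no ¬Ss = trans (Sh′.off m s≤n (λ S′s → ¬Ss (proj₁ (shrink S′s)))) (sym (Sh.off m s≤n ¬Ss))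
    omit-below m {zero} s≤n s<t₁ | yes S0 = contradiction S0 Sh.S-pos
    omit-below m {suc s} s≤n s<t₁ | yes Ss = trans (Sh′.on m (expand Ss (<⇒≢ s<t₁)))
      (trans (cong (_+ ind (suc m) (x (suc s))) (omit-below m (<⇒≤ s≤n) (<-trans ≤-refl s<t₁))) (sym (Sh.on m Ss)))

    -- If the block at t₁ is empty but no later one is, then t₁ can be omitted: the
    -- run restarts at t₁ with a new carried entry.
    omit-good : (∀ {s} → S s → ∀ m → tot m ≤ γ m s + κ m s) →
                (∀ {s} → S (suc s) → ¬ S s → F s) →
                F t₁ → (∀ {s} → t₁ < s → S s → ¬ F s) →
                ∀ {s} → S′ s → ∀ m → tot m ≤ γ′ m s + κ m s
    omit-good full base Ft₁ neg {s} S′s with <-cmp s t₁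
    ... | tri< s<t₁ _ _ = λ m → ≤-trans (full (proj₁ (shrink S′s)) m)
            (+-monoˡ-≤ (κ m s) (≤-reflexive (sym (omit-below m (<⇒≤ (Sh′.S-< S′s)) s<t₁))))
    ... | tri≈ _ s≡t₁ _ = contradiction s≡t₁ (proj₂ (shrink S′s))
    ... | tri> _ _ t₁<s = forward sh′ t₁ (λ S′t₁ → proj₂ (shrink S′t₁) refl) base′
            (λ lt S′s → neg lt (proj₁ (shrink S′s)))
            (λ {s} lt S′s m → ≤-trans (full (proj₁ (shrink S′s)) m) (+-monoˡ-≤ (κ m s) (Sh.γ≤b m (Sh′.S-< S′s))))
            t₁<s S′s
      where
      base′ : ∀ {s} → t₁ ≤ s → S′ (suc s) → ¬ S′ s → F s
      base′ {s} t₁≤s S′ss ¬S′s with s ≟ t₁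
      ... | yes refl = Ft₁
      ... | no s≢t₁  = base (proj₁ (shrink S′ss)) (λ Ss → ¬S′s (expand Ss s≢t₁))

  -- Induction from the largest index down: an omission is informative only once all later blocks
  -- are known to be nonempty.
  negative : ∀ {S : ℕ → Set} → (∀ {t} → S t → t < n) → (∀ {t₁} → S t₁ → (∀ {s} → t₁ < s → S s → ¬ F s) → ¬ F t₁) →
             ∀ {s} → S s → ¬ F s
  negative {S} S-< hyp {s} = go n s (m≤n+m n s)
    where
    go : ∀ d s → n ≤ s + d → S s → ¬ F s
    go zero    s le Ss = contradiction (S-< Ss) (≤⇒≯ (subst (n ≤_) (+-identityʳ s) le))
    go (suc d) s le Ss = hyp Ss (λ {s′} s<s′ → go d s′ (≤-trans le (≤-trans (≤-reflexive (+-suc s d)) (+-monoˡ-≤ d s<s′))))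

-- Comparisons against blocks, with both products present.

-- One negated comparison of (b): index `t₁` is dropped on one side, while `δ`, the other side, is
-- complete.
record Omission (n : ℕ) (tot : ℕ → ℕ) (b : Count) (x : ℕ → ℕ) (S : ℕ → Set) (δ : Count) (t₁ : ℕ) : Set₁ where
  field
    {γ′}   : Count
    {S′}   : ℕ → Set
    shift′ : Shift n b x S′ γ′
    shrink : ∀ {s} → S′ s → S s × s ≢ t₁
    expand : ∀ {s} → S s → s ≢ t₁ → S′ s
    fails  : ¬ AllGood n tot γ′ δ

-- Condition (a) along the antidiagonal, where the pair t, u stands for the cell (u + 1 , t + 1).
-- The corner fields exclude letters beyond two consecutive extra cells; at the end of a run this
-- follows from `outside` at the neighbouring index.
record Support (n : ℕ) (tot : ℕ → ℕ) (b c : Count) (S U : ℕ → Set) : Set where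
  field
    outside : ∀ {t u} → t + u ≡ n → ¬ S t → ¬ U u → Good tot b c t u
    insideˡ : ∀ {t u} → t + u ≡ n → S t → ¬ Good tot b c t u
    insideʳ : ∀ {t u} → t + u ≡ n → U u → ¬ Good tot b c t u
    cornerˡ : ∀ {t u} → t + u ≡ n → S t → S (suc t) → Good tot b c (suc t) u
    cornerʳ : ∀ {t u} → t + u ≡ n → U u → U (suc u) → Good tot b c t (suc u)

module TwoSides {n : ℕ} {tot : ℕ → ℕ} {b c γ δ : Count} {x y : ℕ → ℕ} {S U : ℕ → Set}
                (shˡ : Shift n b x S γ) (shʳ : Shift n c y U δ)
                (gap : ∀ {t u} → S t → U u → suc n < t + u) where

  private
    module L = Shift shˡ
    module R = Shift shʳ

    κ : Count
    κ m t = c m (n ∸ t)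

    κ-suc : ∀ m {t} → t < n → κ m t ≡ κ m (suc t) + ind (suc m) (y (n ∸ suc t))
    κ-suc m {t} t<n = trans (cong (c m) (sym (suc[n∸1+t]))) (R.b-suc m (n ∸ suc t))
      where
      suc[n∸1+t] : suc (n ∸ suc t) ≡ n ∸ t
      suc[n∸1+t] = sym (+-∸-assoc 1 t<n)

    open OneSide {n} {tot} {b} {κ} {x} {λ t → y (n ∸ suc t)} κ-suc

    to-κ : ∀ {f : Count} {t u} → t + u ≡ n → Good tot f c t u → ∀ m → tot m ≤ f m t + κ m t
    to-κ {f} {t} {u} refl g m = subst (λ z → tot m ≤ f m t + c m z) (sym (m+n∸m≡n t u)) (g m)

    of-κ : ∀ {f : Count} {t u} → t + u ≡ n → (∀ m → tot m ≤ f m t + κ m t) → Good tot f c t u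
    of-κ {f} {t} {u} refl g m = subst (λ z → tot m ≤ f m t + c m z) (m+n∸m≡n t u) (g m)

    -- The bound is `suc n` because of the start `suc s` of a run: the index n - s facing `s` must
    -- be outside `U` too.
    far : ∀ {t u} → t + u ≤ suc n → S t → ¬ U u
    far le St Uu = <⇒≱ (gap St Uu) le

    u≤ : ∀ {t u} → t + u ≡ n → u ≤ n
    u≤ {t} {u} refl = m≤n+m u t

    t≤ : ∀ {t u} → t + u ≡ n → t ≤ n
    t≤ {t} {u} refl = m≤m+n t u

  support-good : Support n tot b c S U → ∀ {t u} → t + u ≡ n → S t → Good tot γ c t u
  support-good sup {t} eq St = of-κ {γ} eq (forward shˡ 0 L.S-pos base neg nxt (n≢0⇒n>0 λ { refl → L.S-pos St }) St)
    where
    open Support sup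
    base : ∀ {s} → 0 ≤ s → S (suc s) → ¬ S s → F s
    base {s} _ Sss ¬Ss = to-κ {b} split (outside split ¬Ss (far (≤-reflexive (cong suc split)) Sss))
      where
      split : s + (n ∸ s) ≡ n
      split = m+[n∸m]≡n (<⇒≤ (<-trans ≤-refl (L.S-< Sss)))
    neg : ∀ {s} → 0 < s → S s → ¬ F s
    neg _ Ss Fs = insideˡ (m+[n∸m]≡n (<⇒≤ (L.S-< Ss))) Ss Fs
    nxt : ∀ {s} → 0 < s → S s → ∀ m → tot m ≤ b m (suc s) + κ m s
    nxt {s} _ Ss with L.S? (suc s)
    ... | yes Sss = cornerˡ (m+[n∸m]≡n (<⇒≤ (L.S-< Ss))) Ss Sss
    ... | no ¬Sss = λ m → ≤-trans (outside split ¬Sss (far (≤-trans (+-monoˡ-≤ (n ∸ suc s) (n≤1+n s)) (m≤n⇒m≤1+n (≤-reflexive split))) Ss) m)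
                      (+-monoʳ-≤ (b m (suc s)) (≤-trans (m≤m+n _ _) (≤-reflexive (sym (κ-suc m (L.S-< Ss))))))
      where
      split : suc s + (n ∸ suc s) ≡ n
      split = m+[n∸m]≡n (L.S-< Ss)

  full-inside : AllGood n tot γ δ → ∀ {t u} → t + u ≡ n → S t → Good tot γ c t u
  full-inside full {t} {u} eq St m = ≤-trans (full t u eq m)
    (+-monoʳ-≤ (γ m t) (≤-reflexive (R.off m (u≤ eq) (far (m≤n⇒m≤1+n (≤-reflexive eq)) St))))

  full-outside : AllGood n tot γ δ → ∀ {t u} → t + u ≡ n → ¬ S t → ¬ U u → Good tot b c t u
  full-outside full {t} {u} eq ¬St ¬Uu m = ≤-trans (full t u eq m)
    (+-mono-≤ (≤-reflexive (L.off m (t≤ eq) ¬St)) (≤-reflexive (R.off m (u≤ eq) ¬Uu)))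

  full-corner : AllGood n tot γ δ → ∀ {t u} → t + u ≡ n → S t → Good tot b c (suc t) u
  full-corner full {t} {u} eq St m = ≤-trans (full-inside full eq St m) (+-monoˡ-≤ (c m u) (L.γ≤b m (L.S-< St)))

  full-negative : AllGood n tot γ δ → (∀ {t₁} → S t₁ → Omission n tot b x S δ t₁) →
                  ∀ {t u} → t + u ≡ n → S t → ¬ Good tot b c t u
  full-negative full omission eq St good = negative {S} L.S-< hyp St (to-κ {b} eq good)
    where
    hyp : ∀ {t₁} → S t₁ → (∀ {s} → t₁ < s → S s → ¬ F s) → ¬ F t₁
    hyp {t₁} St₁ neg Ft₁ = fails full′
      where
      open Omission (omission St₁)
      in′ : ∀ {s} → S′ s → ∀ m → tot m ≤ γ′ m s + κ m s
      in′ = omit-good shˡ shift′ t₁ shrink expand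
              (λ Ss → to-κ {γ} (m+[n∸m]≡n (<⇒≤ (L.S-< Ss))) (full-inside full (m+[n∸m]≡n (<⇒≤ (L.S-< Ss))) Ss))
              (λ {s} Sss ¬Ss → to-κ {b} (m+[n∸m]≡n (<⇒≤ (<-trans ≤-refl (L.S-< Sss))))
                 (full-outside full (m+[n∸m]≡n (<⇒≤ (<-trans ≤-refl (L.S-< Sss)))) ¬Ss
                    (far (≤-reflexive (cong suc (m+[n∸m]≡n (<⇒≤ (<-trans ≤-refl (L.S-< Sss)))))) Sss)))
              Ft₁ neg
      c≤δ : ∀ {t u} → t + u ≡ n → S t → ∀ m → c m u ≤ δ m u
      c≤δ eq St m = ≤-reflexive (sym (R.off m (u≤ eq) (far (m≤n⇒m≤1+n (≤-reflexive eq)) St)))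
      full′ : AllGood n tot γ′ δ
      full′ t u eq m with Shift.S? shift′ t | L.S? t
      ... | yes S′t | _ = ≤-trans (of-κ {γ′} eq (in′ S′t) m) (+-monoʳ-≤ (γ′ m t) (c≤δ eq (proj₁ (shrink S′t)) m))
      ... | no ¬S′t | no ¬St = ≤-trans (full t u eq m) (+-monoˡ-≤ (δ m u) (≤-reflexive
              (trans (L.off m (t≤ eq) ¬St) (sym (Shift.off shift′ m (t≤ eq) ¬S′t)))))
      ... | no ¬S′t | yes St with t ≟ t₁
      ...   | no t≢t₁  = contradiction (expand St t≢t₁) ¬S′t
      ...   | yes refl = ≤-trans (of-κ {b} eq Ft₁ m)
              (+-mono-≤ (≤-reflexive (sym (Shift.off shift′ m (t≤ eq) ¬S′t))) (c≤δ eq St m))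

good-comm : ∀ {tot f g t u} → Good tot f g t u → Good tot g f u t
good-comm {tot} {f} {g} {t} {u} good m = subst (tot m ≤_) (+-comm (f m t) (g m u)) (good m)

support-comm : ∀ {n tot b c S U} → Support n tot b c S U → Support n tot c b U S
support-comm {n} {tot} {b} {c} sup = record
  { outside = λ {t} {u} eq ¬Uu ¬St → good-comm {tot} {b} {c} (outside (comm t u eq) ¬St ¬Uu)
  ; insideˡ = λ {t} {u} eq Uu g → insideʳ (comm t u eq) Uu (good-comm {tot} {c} {b} g)
  ; insideʳ = λ {t} {u} eq St g → insideˡ (comm t u eq) St (good-comm {tot} {c} {b} g)
  ; cornerˡ = λ {t} {u} eq Uu Usu → good-comm {tot} {b} {c} (cornerʳ (comm t u eq) Uu Usu)
  ; cornerʳ = λ {t} {u} eq St Sst → good-comm {tot} {b} {c} (cornerˡ (comm t u eq) St Sst) }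
  where
  open Support sup
  comm : ∀ t u → t + u ≡ n → u + t ≡ n
  comm t u eq = trans (+-comm u t) eq

module _ {n : ℕ} {tot : ℕ → ℕ} {b c γ δ : Count} {x y : ℕ → ℕ} {S U : ℕ → Set}
         (shˡ : Shift n b x S γ) (shʳ : Shift n c y U δ)
         (gap : ∀ {t u} → S t → U u → suc n < t + u) where

  private
    module L = TwoSides {tot = tot} shˡ shʳ gap
    module R = TwoSides {tot = tot} shʳ shˡ (λ {t} {u} Ut Su → subst (suc n <_) (+-comm u t) (gap Su Ut))

    comm : ∀ t u → t + u ≡ n → u + t ≡ n
    comm t u eq = trans (+-comm u t) eq

  support⇒full : Support n tot b c S U → AllGood n tot γ δ
  support⇒full sup t u eq m with Shift.S? shˡ t | Shift.S? shʳ u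
  ... | yes St | yes Uu = contradiction (m≤n⇒m≤1+n (≤-reflexive eq)) (<⇒≱ (gap St Uu))
  ... | yes St | no ¬Uu = ≤-trans (L.support-good sup eq St m) (+-monoʳ-≤ (γ m t) (≤-reflexive (sym (Shift.off shʳ m (≤-trans (m≤n+m u t) (≤-reflexive eq)) ¬Uu))))
  ... | no ¬St | yes Uu = good-comm {tot} {δ} {γ} (λ m → ≤-trans (R.support-good (support-comm sup) (comm t u eq) Uu m)
          (+-monoʳ-≤ (δ m u) (≤-reflexive (sym (Shift.off shˡ m (≤-trans (m≤m+n t u) (≤-reflexive eq)) ¬St))))) m
  ... | no ¬St | no ¬Uu = ≤-trans (Support.outside sup eq ¬St ¬Uu m)
          (+-mono-≤ (≤-reflexive (sym (Shift.off shˡ m (≤-trans (m≤m+n t u) (≤-reflexive eq)) ¬St)))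
                    (≤-reflexive (sym (Shift.off shʳ m (≤-trans (m≤n+m u t) (≤-reflexive eq)) ¬Uu))))

  full⇒support : AllGood n tot γ δ →
                 (∀ {t₁} → S t₁ → Omission n tot b x S δ t₁) → (∀ {u₁} → U u₁ → Omission n tot c y U γ u₁) →
                 Support n tot b c S U
  full⇒support full omitˡ omitʳ = record
    { outside = L.full-outside full
    ; insideˡ = L.full-negative full omitˡ
    ; insideʳ = λ {t} {u} eq Uu g → R.full-negative full′ omitʳ (comm t u eq) Uu (good-comm {tot} {b} {c} g)
    ; cornerˡ = λ eq St _ → L.full-corner full eq St
    ; cornerʳ = λ {t} {u} eq Uu _ → good-comm {tot} {c} {b} (R.full-corner full′ (comm t u eq) Uu) }
    where
    full′ : AllGood n tot δ γ
    full′ t u eq = good-comm {tot} {γ} {δ} (full u t (comm t u eq))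

  -- Without `t₁` the prefix count at `t₁` is the original one, so the comparison would declare a
  -- nonempty block empty.
  support⇒omission-fails : Support n tot b c S U → ∀ {t₁ γ′ S′} → S t₁ → Shift n b x S′ γ′ → ¬ S′ t₁ →
                           ¬ AllGood n tot γ′ δ
  support⇒omission-fails sup {t₁} St₁ sh′ ¬S′t₁ full = Support.insideˡ sup split St₁ (λ m → ≤-trans (full t₁ (n ∸ t₁) split m)
      (+-mono-≤ (≤-reflexive (Shift.off sh′ m t₁≤n ¬S′t₁)) (≤-reflexive (Shift.off shʳ m (m∸n≤m n t₁)
         (λ Uu → <⇒≱ (gap St₁ Uu) (m≤n⇒m≤1+n (≤-reflexive split)))))))
    where
    t₁≤n : t₁ ≤ n
    t₁≤n = <⇒≤ (Shift.S-< shˡ St₁)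
    split : t₁ + (n ∸ t₁) ≡ n
    split = m+[n∸m]≡n t₁≤n

-- Products of transpositions and reversal on compositions.

cntF : List ℕ → Count
cntF α m t = cnt (at α) (suc m) t

length-applyS : ∀ es α → length (applyS es α) ≡ length α
length-applyS []       α = refl
length-applyS (a ∷ es) α = trans (length-applyS es (s a α)) (length-swapPos (a ∸ 1) a α)

module _ {n : ℕ} where

  s-swapped : ∀ {a} α → length α ≡ n → suc a < n → Swapped n a (suc a) (at α) (at (s (suc a) α))
  s-swapped α refl lt = swapPos-swapped α ≤-refl lt

  s-cnt-off : ∀ {a t} α → length α ≡ n → 1 ≤ a → a < n → t ≢ a → t ≤ n → ∀ m → cnt (at (s a α)) m t ≡ cnt (at α) m t
  s-cnt-off {suc a} {t} α eq _ a<n t≢a t≤n m with <-cmp t (suc a)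
  ... | tri< t<a _ _ = cnt-swap-before (s-swapped α eq a<n) m (≤-pred t<a)
  ... | tri≈ _ t≡a _ = contradiction t≡a t≢a
  ... | tri> _ _ a<t = cnt-swap-after (s-swapped α eq a<n) m a<t t≤n

  s-cnt-at : ∀ {a} α → length α ≡ n → suc a < n → ∀ m →
             cnt (at (s (suc a) α)) m (suc a) ≡ cnt (at α) m a + ind m (at α (suc a))
  s-cnt-at α eq a<n m = cong₂ _+_ (cnt-swap-before (s-swapped α eq a<n) m ≤-refl) (cong (ind m) (Swapped.at-i (s-swapped α eq a<n)))

  s-above : ∀ {a k} α → length α ≡ n → 1 ≤ a → a < n → a < k → k < n → at (s a α) k ≡ at α k
  s-above {suc a} α eq _ a<n a<k k<n = Swapped.other (s-swapped α eq a<n) k<n (≢-sym (<⇒≢ (<-trans ≤-refl a<k))) (≢-sym (<⇒≢ a<k))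

  Indices : List ℕ → Set
  Indices es = AllPairs _<_ es × All (λ a → 1 ≤ a × a < n) es

  applyS-off : ∀ {es} α → length α ≡ n → Indices es → ∀ m {t} → t ≤ n → ¬ t ∈ es →
               cnt (at (applyS es α)) m t ≡ cnt (at α) m t
  applyS-off α eq ([] , []) m t≤n t∉ = refl
  applyS-off {a ∷ es} α eq (_ ∷ asc , (1≤a , a<n) ∷ rng) m t≤n t∉ =
    trans (applyS-off (s a α) (trans (length-swapPos (a ∸ 1) a α) eq) (asc , rng) m t≤n (λ t∈ → t∉ (there t∈)))
          (s-cnt-off α eq 1≤a a<n (λ t≡a → t∉ (here t≡a)) t≤n m)

  -- As the indices increase, the entry at position `suc t`, counted from 0, is still the original
  -- one when the transposition `s (suc t)` brings it into the prefix of length `suc t`.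
  applyS-on : ∀ {es} α → length α ≡ n → Indices es → ∀ m {t} → suc t ∈ es →
              cnt (at (applyS es α)) m (suc t) ≡ cnt (at (applyS es α)) m t + ind m (at α (suc t))
  applyS-on {a ∷ es} α eq (a< ∷ asc , (1≤a , a<n) ∷ rng) m {t} (here refl) =
    trans (off m (<⇒≤ a<n) (λ a∈ → <-irrefl refl (All.lookup a< a∈)))
      (trans (s-cnt-at α eq a<n m) (cong (_+ ind m (at α (suc t)))
        (sym (trans (off m (<⇒≤ (<-trans ≤-refl a<n)) (λ t∈ → <⇒≱ (All.lookup a< t∈) (n≤1+n t)))
               (s-cnt-off α eq 1≤a a<n (<⇒≢ ≤-refl) (<⇒≤ (<-trans ≤-refl a<n)) m)))))
    where
    off = applyS-off (s a α) (trans (length-swapPos (a ∸ 1) a α) eq) (asc , rng)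
  applyS-on {a ∷ es} α eq (a< ∷ asc , (1≤a , a<n) ∷ rng) m {t} (there t∈) =
    trans (applyS-on (s a α) (trans (length-swapPos (a ∸ 1) a α) eq) (asc , rng) m t∈)
      (cong (λ z → cnt (at (applyS es (s a α))) m t + ind m z)
        (s-above α eq 1≤a a<n (All.lookup a< t∈) (proj₂ (All.lookup rng t∈))))

  applyS-shift : ∀ {es} α → length α ≡ n → Indices es → Shift n (cntF α) (at α) (_∈ es) (cntF (applyS es α))
  applyS-shift {es} α eq ix@(_ , rng) = record
    { S? = _∈? es
    ; S-pos = λ 0∈ → contradiction (proj₁ (All.lookup rng 0∈)) (λ ())
    ; S-< = λ t∈ → proj₂ (All.lookup rng t∈)
    ; b-suc = λ _ _ → refl
    ; off = λ m → applyS-off α eq ix (suc m)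
    ; on = λ m → applyS-on α eq ix (suc m) }

  applyS-total : ∀ {es} α → length α ≡ n → Indices es → ∀ m → cnt (at (applyS es α)) m n ≡ cnt (at α) m n
  applyS-total α eq ix@(_ , rng) m = applyS-off α eq ix m ≤-refl (λ n∈ → <-irrefl refl (proj₂ (All.lookup rng n∈)))

cnt-zero : ∀ f t → cnt f 0 t ≡ t
cnt-zero f zero    = refl
cnt-zero f (suc t) = trans (cong₂ _+_ (cnt-zero f t) (ind-yes {0} {f t} z≤n)) (+-comm t 1)

at-++ˡ : ∀ (α γ : List ℕ) {k} → k < length α → at (α ++ γ) k ≡ at α k
at-++ˡ (x ∷ α) γ {zero}  _        = refl
at-++ˡ (x ∷ α) γ {suc k} (s≤s lt) = at-++ˡ α γ lt

at-++ʳ : ∀ (α γ : List ℕ) k → at (α ++ γ) (length α + k) ≡ at γ k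
at-++ʳ []      γ k = refl
at-++ʳ (x ∷ α) γ k = at-++ʳ α γ k

at-reverse : ∀ α {i k} → suc (i + k) ≡ length α → at (reverse α) i ≡ at α k
at-reverse (x ∷ α) {i} {zero} eq = trans (cong (λ xs → at xs i) (unfold-reverse x α))
  (trans (cong (at (reverse α ++ x ∷ [])) i≡) (at-++ʳ (reverse α) (x ∷ []) 0))
  where
  i≡ : i ≡ length (reverse α) + 0
  i≡ = trans (trans (sym (+-identityʳ i)) (trans (suc-injective eq) (sym (length-reverse α)))) (sym (+-identityʳ _))
at-reverse (x ∷ α) {i} {suc k} eq = trans (cong (λ xs → at xs i) (unfold-reverse x α))
  (trans (at-++ˡ (reverse α) (x ∷ []) (subst (i <_) (trans i+k (sym (length-reverse α))) (m≤m+n (suc i) k)))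
         (at-reverse α i+k))
  where
  i+k : suc (i + k) ≡ length α
  i+k = trans (sym (+-suc i k)) (suc-injective eq)

cnt-reverse : ∀ α m t u → t + u ≡ length α → cnt (at (reverse α)) m t + cnt (at α) m u ≡ cnt (at α) m (length α)
cnt-reverse α m zero    u refl = refl
cnt-reverse α m (suc t) u eq = trans (+-assoc (cnt (at (reverse α)) m t) _ _)
  (trans (cong (cnt (at (reverse α)) m t +_)
     (trans (+-comm _ (cnt (at α) m u)) (cong (λ z → cnt (at α) m u + ind m z) (at-reverse α eq))))
   (cnt-reverse α m t (suc u) (trans (+-suc t u) eq)))

module _ {n : ℕ} {tot : ℕ → ℕ} {α γ : List ℕ} (lenα : length α ≡ n) (lenγ : length γ ≡ n)
         (totα : ∀ m → cntF α m n ≡ tot m) (totγ : ∀ m → cntF γ m n ≡ tot m) where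

  -- The first `t` entries of `ω γ` are the last `t` of `γ`; passing to the complementary prefix
  -- makes the tableau criterion symmetric in both compositions.
  ≤B⇒good : α ≤B ω γ → AllGood n tot (cntF α) (cntF γ)
  ≤B⇒good α≤γ t u eq m = begin
    tot m                                    ≡⟨ sym (totγ m) ⟩
    cntF γ m n                               ≡⟨ cong (cntF γ m) (sym lenγ) ⟩
    cntF γ m (length γ)                      ≡⟨ sym (cnt-reverse γ (suc m) t u (trans eq (sym lenγ))) ⟩
    cntF (ω γ) m t + cntF γ m u              ≤⟨ +-monoˡ-≤ (cntF γ m u) (Dominates.prefix (≤B-dominates α≤γ) (suc m) t≤) ⟩
    cntF α m t + cntF γ m u                  ∎
    where
    open ≤-Reasoning
    t≤ : t ≤ length α
    t≤ = ≤-trans (m≤m+n t u) (≤-reflexive (trans eq (sym lenα)))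

  good⇒≤B : AllGood n tot (cntF α) (cntF γ) → α ≤B ω γ
  good⇒≤B good = dominates-≤B (trans (length-reverse γ) (trans lenγ (sym lenα)))
    (record { prefix = λ m {t} t≤ → pre m (≤-trans t≤ (≤-reflexive lenα)) ; total = total })
    where
    pre : ∀ m {t} → t ≤ n → cnt (at (ω γ)) m t ≤ cnt (at α) m t
    pre zero {t} _ = ≤-reflexive (trans (cnt-zero (at (ω γ)) t) (sym (cnt-zero (at α) t)))
    pre (suc m) {t} t≤n = +-cancelʳ-≤ (cntF γ m (n ∸ t)) _ _ (begin
      cntF (ω γ) m t + cntF γ m (n ∸ t)      ≡⟨ cnt-reverse γ (suc m) t (n ∸ t) (trans (m+[n∸m]≡n t≤n) (sym lenγ)) ⟩
      cntF γ m (length γ)                    ≡⟨ cong (cntF γ m) lenγ ⟩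
      cntF γ m n                             ≡⟨ totγ m ⟩
      tot m                                  ≤⟨ good t (n ∸ t) (m+[n∸m]≡n t≤n) m ⟩
      cntF α m t + cntF γ m (n ∸ t)          ∎)
      where open ≤-Reasoning
    total : ∀ m → cnt (at α) m (length α) ≡ cnt (at (ω γ)) m (length α)
    total zero = trans (cnt-zero (at α) (length α)) (sym (cnt-zero (at (ω γ)) (length α)))
    total (suc m) = begin
      cntF α m (length α)      ≡⟨ cong (cntF α m) lenα ⟩
      cntF α m n               ≡⟨ trans (totα m) (sym (totγ m)) ⟩
      cntF γ m n               ≡⟨ cong (cntF γ m) (sym lenγ) ⟩
      cntF γ m (length γ)      ≡⟨ sym (cnt-reverse γ (suc m) (length γ) 0 (+-identityʳ _)) ⟩
      cntF (ω γ) m (length γ) + 0 ≡⟨ +-identityʳ _ ⟩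
      cntF (ω γ) m (length γ)  ≡⟨ cong (cntF (ω γ) m) (trans lenγ (sym lenα)) ⟩
      cntF (ω γ) m (length α)  ∎
      where open ≡-Reasoning

-- Index ranges and the sequence r.

range-applyUpTo : ∀ a b → range a b ≡ applyUpTo (a +_) (suc b ∸ a)
range-applyUpTo a b = map-upTo (a +_) (suc b ∸ a)

∈-range⁺ : ∀ {a b j} → a ≤ j → j ≤ b → j ∈ range a b
∈-range⁺ {a} {b} {j} a≤j j≤b = subst₂ _∈_ (m+[n∸m]≡n a≤j) (sym (range-applyUpTo a b))
  (∈-applyUpTo⁺ (a +_) (∸-monoˡ-< (s≤s j≤b) a≤j))

∈-range⁻ : ∀ {a b j} → j ∈ range a b → a ≤ j × j ≤ b
∈-range⁻ {a} {b} {j} j∈ with ∈-applyUpTo⁻ (a +_) (subst (j ∈_) (range-applyUpTo a b) j∈)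
... | i , i<l , refl = m≤m+n a i , ≤-pred (≤-trans (≤-reflexive (sym (+-suc a i)))
    (≤-trans (+-monoʳ-≤ a i<l) (≤-reflexive (m+[n∸m]≡n {a} {suc b} (<⇒≤ (m∸n≢0⇒n<m {suc b} {a} (λ e → contradiction (subst (i <_) e i<l) (λ ()))))))))

allPairs-applyUpTo⁻ : ∀ {R : ℕ → ℕ → Set} f l → AllPairs R (applyUpTo f l) → ∀ {i j} → i < j → j < l → R (f i) (f j)
allPairs-applyUpTo⁻ f (suc l) (p ∷ ps) {zero}  {suc j} _ (s≤s j<l) = All.applyUpTo⁻ (λ x → f (suc x)) l p j<l
allPairs-applyUpTo⁻ f (suc l) (p ∷ ps) {suc i} {suc j} (s≤s i<j) (s≤s j<l) = allPairs-applyUpTo⁻ (λ x → f (suc x)) l ps i<j j<l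

allPairs-range⁻ : ∀ {R : ℕ → ℕ → Set} {a b} → AllPairs R (range a b) → ∀ {i j} → a ≤ i → i < j → j ≤ b → R i j
allPairs-range⁻ {R} {a} {b} ps {i} {j} a≤i i<j j≤b =
  subst₂ R (m+[n∸m]≡n a≤i) (m+[n∸m]≡n (≤-trans a≤i (<⇒≤ i<j)))
    (allPairs-applyUpTo⁻ {R} (a +_) (suc b ∸ a) (subst (AllPairs R) (range-applyUpTo a b) ps)
       (∸-monoˡ-< i<j a≤i) (∸-monoˡ-< (s≤s j≤b) (≤-trans a≤i (<⇒≤ i<j))))

allPairs-range⁺ : ∀ {R : ℕ → ℕ → Set} a b → (∀ {i j} → a ≤ i → i < j → j ≤ b → R i j) → AllPairs R (range a b)
allPairs-range⁺ {R} a b rel = subst (AllPairs R) (sym (range-applyUpTo a b))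
  (AllPairs.applyUpTo⁺₁ (a +_) (suc b ∸ a) λ {i} {j} i<j j<l → rel (m≤m+n a i) (+-monoʳ-< a i<j)
    (proj₂ (∈-range⁻ {a} {b} (subst (a + j ∈_) (sym (range-applyUpTo a b)) (∈-applyUpTo⁺ (a +_) j<l)))))

allPairs-++⁻ : ∀ {R : ℕ → ℕ → Set} xs {ys} → AllPairs R (xs ++ ys) →
               AllPairs R xs × AllPairs R ys × All (λ x → All (R x) ys) xs
allPairs-++⁻ []       ps       = [] , ps , []
allPairs-++⁻ (x ∷ xs) (p ∷ ps) with allPairs-++⁻ xs ps
... | l , r , lr = All.++⁻ˡ xs p ∷ l , r , All.++⁻ʳ xs p ∷ lr

allPairs-reverse⁻ : ∀ {R : ℕ → ℕ → Set} xs → AllPairs R (reverse xs) → AllPairs (λ x y → R y x) xs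
allPairs-reverse⁻ [] _ = []
allPairs-reverse⁻ {R} (x ∷ xs) ps with allPairs-++⁻ (reverse xs) (subst (AllPairs R) (unfold-reverse x xs) ps)
... | l , _ , lr = All.tabulate (λ y∈ → All.head (All.lookup lr (reverse⁺ y∈))) ∷ allPairs-reverse⁻ xs l

omit-all : ∀ {P : ℕ → Set} i {xs} → All P xs → All P (omit i xs)
omit-all i [] = []
omit-all i {x ∷ xs} (p ∷ ps) with x ≡ᵇ i
... | true  = omit-all i ps
... | false = p ∷ omit-all i ps

omit-allPairs : ∀ {R : ℕ → ℕ → Set} i {xs} → AllPairs R xs → AllPairs R (omit i xs)
omit-allPairs i [] = []
omit-allPairs i {x ∷ xs} (p ∷ ps) with x ≡ᵇ i
... | true  = omit-allPairs i ps
... | false = omit-all i p ∷ omit-allPairs i ps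

∈-omit⁻ : ∀ i {x} xs → x ∈ omit i xs → x ∈ xs × x ≢ i
∈-omit⁻ i (y ∷ xs) x∈ with y ≡ᵇ i in eq
∈-omit⁻ i (y ∷ xs) x∈          | true with ∈-omit⁻ i xs x∈
... | x∈′ , x≢i = there x∈′ , x≢i
∈-omit⁻ i (y ∷ xs) (here refl) | false = here refl , λ y≡i → contradiction (trans (sym eq) (≡ᵇ-true y≡i)) (λ ())
∈-omit⁻ i (y ∷ xs) (there x∈)  | false with ∈-omit⁻ i xs x∈
... | x∈′ , x≢i = there x∈′ , x≢i

∈-omit⁺ : ∀ i {x xs} → x ∈ xs → x ≢ i → x ∈ omit i xs
∈-omit⁺ i {xs = y ∷ xs} (here refl) x≢i rewrite ≡ᵇ-false x≢i = here refl
∈-omit⁺ i {xs = y ∷ xs} (there x∈) x≢i with y ≡ᵇ i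
... | true  = ∈-omit⁺ i x∈ x≢i
... | false = there (∈-omit⁺ i x∈ x≢i)

record Increasing (n a b : ℕ) (f : ℕ → ℕ) : Set where
  field
    mono   : ∀ {i j} → a ≤ i → i < j → j ≤ b → f i < f j
    bounds : ∀ {i} → a ≤ i → i ≤ b → 1 ≤ f i × f i < n

  range-bounds : All (λ i → 1 ≤ f i × f i < n) (range a b)
  range-bounds = All.tabulate (λ i∈ → bounds (proj₁ (∈-range⁻ i∈)) (proj₂ (∈-range⁻ i∈)))

  indices : Indices {n} (map f (range a b))
  indices = AllPairs.map⁺ (allPairs-range⁺ a b mono) , All.map⁺ range-bounds

  omit-indices : ∀ i → Indices {n} (map f (omit i (range a b)))
  omit-indices i = AllPairs.map⁺ (omit-allPairs i (allPairs-range⁺ a b mono)) , All.map⁺ (omit-all i range-bounds)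

  injective : ∀ {i j} → a ≤ i → i ≤ b → a ≤ j → j ≤ b → f i ≡ f j → i ≡ j
  injective {i} {j} a≤i i≤b a≤j j≤b eq with <-cmp i j
  ... | tri< i<j _ _ = contradiction eq (<⇒≢ (mono a≤i i<j j≤b))
  ... | tri≈ _ i≡j _ = i≡j
  ... | tri> _ _ j<i = contradiction (sym eq) (<⇒≢ (mono a≤j j<i i≤b))

  omit-shrink : ∀ {i} → a ≤ i → i ≤ b → ∀ {x} → x ∈ map f (omit i (range a b)) → x ∈ map f (range a b) × x ≢ f i
  omit-shrink {i} a≤i i≤b x∈ with ∈-map⁻ f x∈
  ... | j , j∈ , refl with ∈-omit⁻ i (range a b) j∈
  ...   | j∈′ , j≢i = ∈-map⁺ f j∈′ , λ eq → j≢i (injective (proj₁ (∈-range⁻ j∈′)) (proj₂ (∈-range⁻ j∈′)) a≤i i≤b eq)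

  omit-expand : ∀ {i x} → x ∈ map f (range a b) → x ≢ f i → x ∈ map f (omit i (range a b))
  omit-expand {i} x∈ x≢ with ∈-map⁻ f x∈
  ... | j , j∈ , refl = ∈-map⁺ f (∈-omit⁺ i j∈ (λ { refl → x≢ refl }))

rHyp-increasing : ∀ {n p k r} → RHyp n p k r → Increasing n 1 p r × Increasing n (suc p) k (e n r)
rHyp-increasing {n} {p} {k} {r} (linked , bounds) =
    record { mono = λ {i} {j} → allPairs-range⁻ (AllPairs.map⁻ {f = r} hi) {i} {j} ; bounds = hi-bounds }
  , record { mono = λ a≤i i<j j≤b → ∸-monoʳ-< (allPairs-range⁻ (allPairs-reverse⁻ (range (suc p) k) (AllPairs.map⁻ {f = r} lo)) a≤i i<j j≤b)
                                      (<⇒≤ (proj₂ (lo-bounds a≤i (<⇒≤ (<-≤-trans i<j j≤b)))))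
           ; bounds = λ a≤i i≤b → m<n⇒0<n∸m (proj₂ (lo-bounds a≤i i≤b))
                                , ∸-monoʳ-< {n} {_} {0} (proj₁ (lo-bounds a≤i i≤b)) (<⇒≤ (proj₂ (lo-bounds a≤i i≤b))) }
  where
  los = map r (reverse (range (suc p) k))
  split = allPairs-++⁻ los (Linked⇒AllPairs <-trans linked)
  lo = proj₁ split
  hi = proj₁ (proj₂ split)
  hi-bounds : ∀ {i} → 1 ≤ i → i ≤ p → 1 ≤ r i × r i < n
  hi-bounds 1≤i i≤p = All.lookup (All.++⁻ʳ los bounds) (∈-map⁺ r (∈-range⁺ 1≤i i≤p))
  lo-bounds : ∀ {i} → suc p ≤ i → i ≤ k → 1 ≤ r i × r i < n
  lo-bounds p<i i≤k = All.lookup (All.++⁻ˡ los bounds) (∈-map⁺ r (reverse⁺ (∈-range⁺ p<i i≤k)))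

module _ {n p k : ℕ} {r : ℕ → ℕ} (incʳ : Increasing n 1 p r) (incᵉ : Increasing n (suc p) k (e n r)) where

  private
    module Hi = Increasing incʳ
    module Lo = Increasing incᵉ

    es rs : List ℕ
    es = map (e n r) (range (suc p) k)
    rs = map r (range 1 p)

    r<n : ∀ {j} → suc p ≤ j → j ≤ k → r j < n
    r<n {j} p<j j≤k = ≰⇒> λ n≤r → contradiction (proj₁ (Lo.bounds p<j j≤k)) (λ 1≤ → <⇒≱ 1≤ (≤-reflexive (m≤n⇒m∸n≡0 n≤r)))

    least : ∀ {i} → 1 ≤ i → i ≤ p → r 1 ≤ r i
    least {i} 1≤i i≤p with m≤n⇒m<n∨m≡n 1≤i
    ... | inj₁ 1<i  = <⇒≤ (Hi.mono ≤-refl 1<i i≤p)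
    ... | inj₂ refl = ≤-refl

    greatest : ∀ {j} → suc p ≤ j → j ≤ k → n ∸ r (suc p) ≤ n ∸ r j
    greatest {j} p<j j≤k with m≤n⇒m<n∨m≡n p<j
    ... | inj₁ lt   = <⇒≤ (Lo.mono ≤-refl lt j≤k)
    ... | inj₂ refl = ≤-refl

  -- The sum is least at e_{p+1} and r_1, where it is n + r_1 - r_{p+1}.
  sides-gap : (0 < p → p < k → suc (r (suc p)) < r 1) → ∀ {t u} → t ∈ es → u ∈ rs → suc n < t + u
  sides-gap gap t∈ u∈ with ∈-map⁻ (e n r) t∈ | ∈-map⁻ r u∈
  ... | j , j∈ , refl | i , i∈ , refl = begin-strict
    suc n                                 ≡⟨ cong suc (sym (m∸n+n≡m (<⇒≤ (r<n ≤-refl p<k)))) ⟩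
    suc (n ∸ r (suc p) + r (suc p))       ≡⟨ sym (+-suc _ _) ⟩
    n ∸ r (suc p) + suc (r (suc p))       <⟨ +-mono-≤-< (greatest p<j j≤k) (<-≤-trans (gap 0<p p<k) (least 1≤i i≤p)) ⟩
    n ∸ r j + r i                         ∎
    where
    open ≤-Reasoning
    p<j = proj₁ (∈-range⁻ {suc p} {k} j∈)
    j≤k = proj₂ (∈-range⁻ {suc p} {k} j∈)
    1≤i = proj₁ (∈-range⁻ {1} {p} i∈)
    i≤p = proj₂ (∈-range⁻ {1} {p} i∈)
    p<k : p < k
    p<k = ≤-trans p<j j≤k
    0<p : 0 < p
    0<p = ≤-trans 1≤i i≤p

  ∈-extra⁻ : ∀ {c} → c ∈ extraCells n p k r → ∃[ t ] ∃[ u ] t + u ≡ n × (t ∈ es ⊎ u ∈ rs) × c ≡ (suc u , suc t)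
  ∈-extra⁻ c∈ with ∈-++⁻ (map (λ j → suc (r j) , suc (e n r j)) (reverse (range (suc p) k))) c∈
  ... | inj₁ c∈ˡ with ∈-map⁻ (λ j → suc (r j) , suc (e n r j)) c∈ˡ
  ...   | j , j∈ , refl = n ∸ r j , r j , m∸n+n≡m (<⇒≤ (r<n (proj₁ bd) (proj₂ bd))) , inj₁ (∈-map⁺ (e n r) j∈′) , refl
    where
    j∈′ = reverse⁻ j∈
    bd = ∈-range⁻ {suc p} {k} j∈′
  ∈-extra⁻ c∈ | inj₂ c∈ʳ with ∈-map⁻ (λ i → suc (r i) , suc (n ∸ r i)) c∈ʳ
  ...   | i , i∈ , refl = n ∸ r i , r i , m∸n+n≡m (<⇒≤ (proj₂ (Hi.bounds (proj₁ bd) (proj₂ bd)))) , inj₂ (∈-map⁺ r i∈) , refl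
    where
    bd = ∈-range⁻ {1} {p} i∈

  ∈-extra⁺ : ∀ {t u} → t + u ≡ n → t ∈ es ⊎ u ∈ rs → (suc u , suc t) ∈ extraCells n p k r
  ∈-extra⁺ {t} {u} refl (inj₁ t∈) with ∈-map⁻ (e n r) t∈
  ... | j , j∈ , t≡ = ∈-++⁺ˡ (subst (_∈ map (λ j → suc (r j) , suc (e n r j)) (reverse (range (suc p) k))) (cong₂ (λ x y → suc x , suc y) r≡ (sym t≡))
                        (∈-map⁺ (λ j → suc (r j) , suc (e n r j)) (reverse⁺ j∈)))
    where
    bd = ∈-range⁻ {suc p} {k} j∈
    r≡ : r j ≡ u
    r≡ = trans (sym (m∸[m∸n]≡n (<⇒≤ (r<n (proj₁ bd) (proj₂ bd))))) (trans (cong (n ∸_) (sym t≡)) (m+n∸m≡n t u))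
  ∈-extra⁺ {t} {u} refl (inj₂ u∈) with ∈-map⁻ r u∈
  ... | i , i∈ , refl = ∈-++⁺ʳ (map (λ j → suc (r j) , suc (e n r j)) (reverse (range (suc p) k)))
      (subst (_∈ map (λ i → suc (r i) , suc (n ∸ r i)) (range 1 p)) (cong (λ y → suc (r i) , suc y) (m+n∸n≡m t (r i))) (∈-map⁺ (λ i → suc (r i) , suc (n ∸ r i)) i∈))

-- Cells against blocks.

too-high : ∀ {n t u i j} → t + u ≡ n → t < j → u < i → ¬ (i + j ≤ suc n)
too-high {n} {t} {u} {i} {j} refl t<j u<i le = <⇒≱ (s≤s (≤-reflexive (+-comm t u)))
  (≤-pred (subst (_≤ suc (t + u)) refl (≤-trans (s≤s (≤-reflexive (sym (+-suc u t)))) (≤-trans (+-mono-≤ u<i t<j) le))))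

sum-rigid : ∀ {t t′ u u′} → t + u ≡ t′ + u′ → t ≤ t′ → u ≤ u′ → t ≡ t′ × u ≡ u′
sum-rigid {t} {t′} {u} {u′} eq t≤ u≤ = +-squeezeˡ t≤ u≤ eq , +-squeezeˡ u≤ t≤ (trans (+-comm u t) (trans eq (+-comm t′ u′)))

module _ {n : ℕ} {tot : ℕ → ℕ} {b c : Count} {S U : ℕ → Set} {w : List Biletter} {extra : List (ℕ × ℕ)}
         (S? : ∀ t → Dec (S t)) (U? : ∀ u → Dec (U u)) (S-< : ∀ {t} → S t → t < n) (U-< : ∀ {u} → U u → u < n)
         (gap : ∀ {t u} → S t → U u → suc n < t + u)
         (extra⁻ : ∀ {z} → z ∈ extra → ∃[ t ] ∃[ u ] t + u ≡ n × (S t ⊎ U u) × z ≡ (suc u , suc t))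
         (extra⁺ : ∀ {t u} → t + u ≡ n → S t ⊎ U u → (suc u , suc t) ∈ extra)
         (block⇒good : ∀ {t u} → t ≤ n → u ≤ n → (∀ {z} → z ∈ w → ¬ InBlock t u z) → Good tot b c t u)
         (good⇒block : ∀ {t u} → t ≤ n → u ≤ n → Good tot b c t u → ∀ {z} → z ∈ w → ¬ InBlock t u z)
         (ranges : All (λ z → InRange n (proj₁ z) × InRange n (proj₂ z)) w) where

  private
    Allowed : Biletter → Set
    Allowed z = InStaircase n (cell z) ⊎ cell z ∈ extra

    t≤ : ∀ {t u} → t + u ≡ n → t ≤ n
    t≤ {t} {u} refl = m≤m+n t u

    u≤ : ∀ {t u} → t + u ≡ n → u ≤ n
    u≤ {t} {u} refl = m≤n+m u t

    -- Allowed cells satisfy i + j ≤ n + 2, and the block of a pair on the antidiagonal meets this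
    -- region only in its corner cell.
    allowed-corner : ∀ {t u z} → t + u ≡ n → Allowed z → InBlock t u z → (S t ⊎ U u) × cell z ≡ (suc u , suc t)
    allowed-corner eq (inj₁ low) (t<j , u<i) = contradiction low (too-high eq t<j u<i)
    allowed-corner eq (inj₂ z∈) (t<j , u<i) with extra⁻ z∈
    ... | t′ , u′ , eq′ , SU , refl with sum-rigid (trans eq (sym eq′)) (≤-pred t<j) (≤-pred u<i)
    ...   | refl , refl = SU , refl

  support-of-cells : All Allowed w × All (λ z → Any (λ b → cell b ≡ z) w) extra → Support n tot b c S U
  support-of-cells (allowed , occurs) = record
    { outside = λ eq ¬St ¬Uu → block⇒good (t≤ eq) (u≤ eq) λ z∈ inb →
        neither ¬St ¬Uu (proj₁ (allowed-corner eq (All.lookup allowed z∈) inb))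
    ; insideˡ = λ eq St → occupied-corner eq (inj₁ St)
    ; insideʳ = λ eq Uu → occupied-corner eq (inj₂ Uu)
    ; cornerˡ = λ eq St Sst → block⇒good (<⇒≤ (S-< Sst)) (u≤ eq) λ z∈ (t<j , u<i) →
        beyond eq z∈ (<-trans ≤-refl t<j , u<i) (inj₁ t<j)
    ; cornerʳ = λ eq Uu Usu → block⇒good (t≤ eq) (<⇒≤ (U-< Usu)) λ z∈ (t<j , u<i) →
        beyond eq z∈ (t<j , <-trans ≤-refl u<i) (inj₂ u<i) }
    where
    neither : ∀ {t u} → ¬ S t → ¬ U u → ¬ (S t ⊎ U u)
    neither ¬St ¬Uu (inj₁ St) = ¬St St
    neither ¬St ¬Uu (inj₂ Uu) = ¬Uu Uu
    occupied-corner : ∀ {t u} → t + u ≡ n → S t ⊎ U u → ¬ Good tot b c t u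
    occupied-corner {t} {u} eq SU good = no-letter (All.lookup occurs (extra⁺ eq SU)) (good⇒block (t≤ eq) (u≤ eq) good)
      where
      no-letter : ∀ {w} → Any (λ b → cell b ≡ (suc u , suc t)) w → ¬ (∀ {z} → z ∈ w → ¬ InBlock t u z)
      no-letter (here refl)  none = none (here refl) (≤-refl , ≤-refl)
      no-letter (there z∈) none = no-letter z∈ (λ z∈′ → none (there z∈′))
    beyond : ∀ {t u z} → t + u ≡ n → z ∈ w → InBlock t u z → ¬ (suc t < proj₁ z ⊎ suc u < proj₂ z)
    beyond eq z∈ inb past with allowed-corner eq (All.lookup allowed z∈) inb
    beyond eq z∈ inb (inj₁ lt) | _ , refl = <-irrefl refl lt
    beyond eq z∈ inb (inj₂ lt) | _ , refl = <-irrefl refl lt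

  cells-of-support : Support n tot b c S U → All Allowed w × All (λ z → Any (λ b → cell b ≡ z) w) extra
  cells-of-support sup = allowed , All.tabulate occurs
    where
    open Support sup
    -- `past` treats a letter to the right of the corner cell: if the neighbouring index is in the
    -- set too, a corner field forbids the letter; otherwise it lies in the next antidiagonal block,
    -- which is empty by `outside`.
    diagonal : ∀ {t u j} → t + u ≡ n → t < j → j ≤ n → (j , suc u) ∈ w → Allowed (j , suc u)
    past : ∀ {t u j} → t + u ≡ n → S t ⊎ U u → suc t < j → j ≤ n → (j , suc u) ∈ w → Allowed (j , suc u)
    diagonal {t} {u} {j} eq t<j j≤n z∈ with S? t | U? u
    ... | no ¬St | no ¬Uu = contradiction (t<j , ≤-refl) (good⇒block (t≤ eq) (u≤ eq) (outside eq ¬St ¬Uu) z∈)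
    diagonal {t} {u} {j} eq t<j j≤n z∈ | yes St | _ with m≤n⇒m<n∨m≡n t<j
    ... | inj₁ lt   = past eq (inj₁ St) lt j≤n z∈
    ... | inj₂ refl = inj₂ (extra⁺ eq (inj₁ St))
    diagonal {t} {u} {j} eq t<j j≤n z∈ | no _ | yes Uu with m≤n⇒m<n∨m≡n t<j
    ... | inj₁ lt   = past eq (inj₂ Uu) lt j≤n z∈
    ... | inj₂ refl = inj₂ (extra⁺ eq (inj₂ Uu))
    past {t} {zero} {j} eq SU lt j≤n z∈ = contradiction (subst (j ≤_) (trans (sym eq) (+-identityʳ t)) j≤n) (<⇒≱ (<-trans ≤-refl lt))
    past {t} {suc u} {j} eq (inj₁ St) lt j≤n z∈ with S? (suc t)
    ... | yes Sst = contradiction (lt , ≤-refl) (good⇒block (<⇒≤ (S-< Sst)) (u≤ eq) (cornerˡ eq St Sst) z∈)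
    ... | no ¬Sst = contradiction (lt , n≤1+n (suc u)) (good⇒block (t≤ eq′) (u≤ eq′)
        (outside eq′ ¬Sst (λ Uu → <⇒≱ (gap St Uu) (m≤n⇒m≤1+n (≤-trans (+-monoʳ-≤ t (n≤1+n u)) (≤-reflexive eq))))) z∈)
      where
      eq′ : suc t + u ≡ n
      eq′ = trans (sym (+-suc t u)) eq
    past {t} {suc u} {j} eq (inj₂ Usu) lt j≤n z∈ with U? u
    ... | yes Uu = contradiction (lt , ≤-refl) (good⇒block (t≤ eq′) (u≤ eq) (cornerʳ eq′ Uu Usu) z∈)
      where
      eq′ : suc t + u ≡ n
      eq′ = trans (sym (+-suc t u)) eq
    ... | no ¬Uu = contradiction (lt , n≤1+n (suc u)) (good⇒block (t≤ eq′) (u≤ eq′)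
        (outside eq′ (λ Sst → <⇒≱ (gap Sst Usu) (≤-reflexive (cong suc eq))) ¬Uu) z∈)
      where
      eq′ : suc t + u ≡ n
      eq′ = trans (sym (+-suc t u)) eq
    allowed : All Allowed w
    allowed = All.tabulate λ {z} z∈ → letter (All.lookup ranges z∈) z∈
      where
      letter : ∀ {z} → InRange n (proj₁ z) × InRange n (proj₂ z) → z ∈ w → Allowed z
      letter {j , suc u} ((1≤j , j≤n) , (_ , u<n)) z∈ with suc u + j ≤? suc n
      ... | yes low = inj₁ low
      ... | no high = diagonal {n ∸ u} {u} (m∸n+n≡m (<⇒≤ u<n)) (+-cancelˡ-< u _ _
              (subst (_< u + j) (sym (m+[n∸m]≡n (<⇒≤ u<n))) (≤-pred (≰⇒> high)))) j≤n z∈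
    occurs : ∀ {z} → z ∈ extra → Any (λ b → cell b ≡ z) w
    occurs {z} z∈ with any? (λ b → Product.≡-dec _≟_ _≟_ (cell b) z) w
    ... | yes found = found
    ... | no absent with extra⁻ z∈
    ...   | t , u , eq , SU , refl = contradiction good (corner SU)
      where
      good : Good tot b c t u
      good = block⇒good (t≤ eq) (u≤ eq) λ z∈ inb →
        absent (lose z∈ (proj₂ (allowed-corner eq (All.lookup allowed z∈) inb)))
      corner : S t ⊎ U u → ¬ Good tot b c t u
      corner (inj₁ St) = insideˡ eq St
      corner (inj₂ Uu) = insideʳ eq Uu

-- The key-pair of a biword and the equivalence.

module KeyCounts {n : ℕ} {w : List Biletter} (bw : Biword n w) where

  private
    P Q : Chain
    P = proj₁ (rsk-total n w)
    Q = proj₁ (proj₂ (rsk-total n w))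
    rsk : Rsk n w P Q
    rsk = proj₂ (proj₂ (rsk-total n w))
    validP = proj₁ (rsk-valid bw rsk)
    validQ = proj₁ (proj₂ (rsk-valid bw rsk))
    rangeP = proj₁ (rsk-range bw rsk)
    rangeQ = proj₂ (rsk-range bw rsk)

  ν β : List ℕ
  ν = proj₁ (keyPair n w)
  β = proj₂ (keyPair n w)

  tot : ℕ → ℕ
  tot = colLen P

  private
    ν≡ : ν ≡ keyShape n P
    ν≡ = cong proj₁ (keyPair-rsk bw rsk)
    β≡ : β ≡ keyShape n Q
    β≡ = cong proj₂ (keyPair-rsk bw rsk)
    cnt-ν : ∀ {u} → u ≤ n → ∀ m → cntF ν m u ≡ A (n ∸ u) P m
    cnt-ν {u} u≤n m = subst (λ α → cntF α m u ≡ A (n ∸ u) P m) (sym ν≡) (keyShape-cnt validP rangeP u≤n m)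
    cnt-β : ∀ {t} → t ≤ n → ∀ m → cntF β m t ≡ A (n ∸ t) Q m
    cnt-β {t} t≤n m = subst (λ α → cntF α m t ≡ A (n ∸ t) Q m) (sym β≡) (keyShape-cnt validQ rangeQ t≤n m)
    A-all : ∀ {c} → Valid c → Within n c → ∀ m → A (n ∸ n) c m ≡ colLen c m
    A-all {c} valid range m = trans (cong (λ v → A v c m) (n∸n≡0 n)) (trans (sym (+-identityʳ _))
      (trans (cong (A 0 c m +_) (sym (C-zero valid (All.map proj₁ range) m))) (A+C 0 c m)))

  length-ν : length ν ≡ n
  length-ν = trans (cong length ν≡) (keyShape-length n P)

  length-β : length β ≡ n
  length-β = trans (cong length β≡) (keyShape-length n Q)

  total-ν : ∀ m → cntF ν m n ≡ tot m
  total-ν m = trans (cnt-ν ≤-refl m) (A-all validP rangeP m)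

  total-β : ∀ m → cntF β m n ≡ tot m
  total-β m = trans (cnt-β ≤-refl m) (trans (A-all validQ rangeQ m) (sym (rsk-colLen bw rsk m)))

  block⇒good : ∀ {t u} → t ≤ n → u ≤ n → (∀ {z} → z ∈ w → ¬ InBlock t u z) → Good tot (cntF β) (cntF ν) t u
  block⇒good {t} {u} t≤n u≤n empty m = begin
    tot m                            ≡⟨ sym (A+C (n ∸ u) P m) ⟩
    A (n ∸ u) P m + C (n ∸ u) P m    ≤⟨ +-monoʳ-≤ (A (n ∸ u) P m) (block-empty⇒ t u bw rsk (All.tabulate empty) m) ⟩
    A (n ∸ u) P m + A (n ∸ t) Q m    ≡⟨ +-comm (A (n ∸ u) P m) _ ⟩
    A (n ∸ t) Q m + A (n ∸ u) P m    ≡⟨ cong₂ _+_ (sym (cnt-β t≤n m)) (sym (cnt-ν u≤n m)) ⟩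
    cntF β m t + cntF ν m u          ∎
    where open ≤-Reasoning

  good⇒block : ∀ {t u} → t ≤ n → u ≤ n → Good tot (cntF β) (cntF ν) t u → ∀ {z} → z ∈ w → ¬ InBlock t u z
  good⇒block {t} {u} t≤n u≤n good z∈ inb with block-nonempty⇒ t u bw rsk (lose z∈ inb)
  ... | m , lt = <⇒≱ (begin-strict
    cntF β m t + cntF ν m u          ≡⟨ cong₂ _+_ (cnt-β t≤n m) (cnt-ν u≤n m) ⟩
    A (n ∸ t) Q m + A (n ∸ u) P m    <⟨ +-monoˡ-< (A (n ∸ u) P m) lt ⟩
    C (n ∸ u) P m + A (n ∸ u) P m    ≡⟨ +-comm (C (n ∸ u) P m) _ ⟩
    A (n ∸ u) P m + C (n ∸ u) P m    ≡⟨ A+C (n ∸ u) P m ⟩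
    tot m                            ∎) (good m)
    where open ≤-Reasoning

theorem5 : (n : ℕ) (w : List Biletter) → Biword n w →
    (p k : ℕ) (r : ℕ → ℕ) → p ≤ k → k < n → RHyp n p k r →
    (0 < p → p < k → suc (r (suc p)) < r 1) →
    (CondA n w p k r ⇔ CondB n w p k r)
theorem5 n w bw p k r p≤k k<n rhyp r-gap = mk⇔ (λ a → B-of-support (support-of a)) (λ b → cells (support-of-B b))
  where
  open KeyCounts bw
  incʳ = proj₁ (rHyp-increasing rhyp)
  incᵉ = proj₂ (rHyp-increasing rhyp)
  module Hi = Increasing incʳ
  module Lo = Increasing incᵉ
  es = map (e n r) (range (suc p) k)
  rs = map r (range 1 p)
  gap : ∀ {t u} → t ∈ es → u ∈ rs → suc n < t + u
  gap = sides-gap incʳ incᵉ r-gap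
  gap′ : ∀ {u t} → u ∈ rs → t ∈ es → suc n < u + t
  gap′ {u} {t} u∈ t∈ = subst (suc n <_) (+-comm t u) (gap t∈ u∈)
  shᵉ = applyS-shift β length-β Lo.indices
  shʳ = applyS-shift ν length-ν Hi.indices
  Sup : Set
  Sup = Support n tot (cntF β) (cntF ν) (_∈ es) (_∈ rs)
  support-of : CondA n w p k r → Sup
  support-of = support-of-cells (_∈? es) (_∈? rs) (Shift.S-< shᵉ) (Shift.S-< shʳ) gap
    (∈-extra⁻ incʳ incᵉ) (∈-extra⁺ incʳ incᵉ) block⇒good good⇒block (proj₁ bw)
  cells : Sup → CondA n w p k r
  cells = cells-of-support (_∈? es) (_∈? rs) (Shift.S-< shᵉ) (Shift.S-< shʳ) gap
    (∈-extra⁻ incʳ incᵉ) (∈-extra⁺ incʳ incᵉ) block⇒good good⇒block (proj₁ bw)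

  module _ {es′ rs′ : List ℕ} (ixᵉ : Indices {n} es′) (ixʳ : Indices {n} rs′) where
    private
      lenᵉ = trans (length-applyS es′ β) length-β
      lenʳ = trans (length-applyS rs′ ν) length-ν
      totᵉ : ∀ m → cntF (applyS es′ β) m n ≡ tot m
      totᵉ m = trans (applyS-total β length-β ixᵉ (suc m)) (total-β m)
      totʳ : ∀ m → cntF (applyS rs′ ν) m n ≡ tot m
      totʳ m = trans (applyS-total ν length-ν ixʳ (suc m)) (total-ν m)
    to-good : applyS es′ β ≤B ω (applyS rs′ ν) →
              AllGood n tot (cntF (applyS es′ β)) (cntF (applyS rs′ ν))
    to-good = ≤B⇒good {γ = applyS rs′ ν} lenᵉ lenʳ totᵉ totʳ
    of-good : AllGood n tot (cntF (applyS es′ β)) (cntF (applyS rs′ ν)) →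
              applyS es′ β ≤B ω (applyS rs′ ν)
    of-good = good⇒≤B {γ = applyS rs′ ν} lenᵉ lenʳ totᵉ totʳ

  flip-good : ∀ {f g : Count} → AllGood n tot f g → AllGood n tot g f
  flip-good {f} {g} good u t eq = good-comm {tot} {f} {g} (good t u (trans (+-comm t u) eq))

  B-of-support : Sup → CondB n w p k r
  B-of-support sup =
      (λ i 1≤i i≤p le → support⇒omission-fails shʳ shᵉ gap′ (support-comm sup) (∈-map⁺ r (∈-range⁺ 1≤i i≤p))
         (applyS-shift ν length-ν (Hi.omit-indices i)) (λ x∈ → proj₂ (Hi.omit-shrink 1≤i i≤p x∈) refl)
         (flip-good {cntF (applyS es β)} {cntF (applyS (map r (omit i (range 1 p))) ν)} (to-good Lo.indices (Hi.omit-indices i) le)))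
    , (λ j p<j j≤k le → support⇒omission-fails shᵉ shʳ gap sup (∈-map⁺ (e n r) (∈-range⁺ p<j j≤k))
         (applyS-shift β length-β (Lo.omit-indices j)) (λ x∈ → proj₂ (Lo.omit-shrink p<j j≤k x∈) refl)
         (to-good (Lo.omit-indices j) Hi.indices le))
    , of-good Lo.indices Hi.indices (support⇒full shᵉ shʳ gap sup)

  support-of-B : CondB n w p k r → Sup
  support-of-B (omitʳ , omitᵉ , full) = full⇒support shᵉ shʳ gap (to-good Lo.indices Hi.indices full) left right
    where
    left : ∀ {t} → t ∈ es → Omission n tot (cntF β) (at β) (_∈ es) (cntF (applyS rs ν)) t
    left t∈ with ∈-map⁻ (e n r) t∈
    ... | j , j∈ , refl = record
      { shift′ = applyS-shift β length-β (Lo.omit-indices j)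
      ; shrink = Lo.omit-shrink (proj₁ bd) (proj₂ bd)
      ; expand = Lo.omit-expand
      ; fails  = λ good → omitᵉ j (proj₁ bd) (proj₂ bd) (of-good (Lo.omit-indices j) Hi.indices good) }
      where bd = ∈-range⁻ {suc p} {k} j∈
    right : ∀ {u} → u ∈ rs → Omission n tot (cntF ν) (at ν) (_∈ rs) (cntF (applyS es β)) u
    right u∈ with ∈-map⁻ r u∈
    ... | i , i∈ , refl = record
      { shift′ = applyS-shift ν length-ν (Hi.omit-indices i)
      ; shrink = Hi.omit-shrink (proj₁ bd) (proj₂ bd)
      ; expand = Hi.omit-expand
      ; fails  = λ good → omitʳ i (proj₁ bd) (proj₂ bd) (of-good Lo.indices (Hi.omit-indices i)
          (flip-good {cntF (applyS (map r (omit i (range 1 p))) ν)} {cntF (applyS es β)} good)) }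
      where bd = ∈-range⁻ {1} {p} i∈
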